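{- Let $a=(a_i)_{i\in\mathbb Z}$ be a sequence of pairwise distinct complex numbers and $\mu$ a Young diagram. An element $F\in\Lambda$ equals $s_{\mu;a}$ if and only if (i) $F(x(\lambda);y(\lambda))=0$ for all Young diagrams $\lambda\ne\mu$ with $|\lambda|\le|\mu|$, and (ii) $F$ has degree $\le|\mu|$ and $F(x(\mu);y(\mu))=\prod_{(i,j)\in\mu}(a_{\mu_i-i+1}-a_{j-\mu'_j})$. Also, $F$ equals $s_{\mu;a}$ if and only if (i$'$) $F(x(\lambda);y(\lambda))=0$ for all Young diagrams $\lambda$ with $|\lambda|<|\mu|$, and (ii$'$) the top-degree homogeneous component of $F$ is the Schur function $s_\mu$.
   Context: $\Lambda$ is the algebra of symmetric functions over $\mathbb C$ with complete homogeneous $h_k$, elementary $e_k$, power sums $\mathbf p_k$, Schur functions $s_\mu$. For a sequence $a$ define $h_{k;a}=\sum_{i=1}^k(-1)^{k-i}e_{k-i}(a_1,\dots,a_{k-1})h_i$ ($k\ge1$), $h_{0;a}=1$, $h_{k;a}=0$ ($k<0$); $(\tau^ra)_i=a_{i+r}$; $s_{\mu;a}=\det[h_{\mu_i-i+j;\,\tau^{1-j}a}]_{i,j=1}^N$ for any $N\ge\ell(\mu)$. Dual sequence: $\widehat a_i=-a_{1-i}$. $\mu'$ is the transposed diagram; boxes $(i,j)$ are indexed by row $i$ and column $j$. Each $f\in\Lambda$ is evaluated at $(x;y)\in\mathbb C^d\times\mathbb C^d$ via $\mathbf p_k\mapsto\sum_ix_i^k+(-1)^{k-1}\sum_jy_j^k$.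 For a nonempty diagram $\lambda=(p_1,\dots,p_d\mid q_1,\dots,q_d)$ in Frobenius notation ($p_i=\lambda_i-i$, $q_i=\lambda'_i-i$, $d$ the number of diagonal boxes), $(x(\lambda);y(\lambda))=(a_{p_1+1},\dots,a_{p_d+1};\widehat a_{q_1+1},\dots,\widehat a_{q_d+1})$; and $(x(\varnothing);y(\varnothing))=(0;0)$. -}

module Defs where

open import Algebra.Apartness.Bundles using (HeytingField; HeytingCommutativeRing)
open import Algebra.Bundles using (CommutativeRing; Semiring)
import Algebra.Definitions.RawSemiring as RawSemiringDefs
open import Data.Fin.Base using (Fin; zero; suc; toℕ; punchIn)
open import Data.Integer.Base as ℤ using (ℤ; +_; -[1+_])
open import Data.List.Base using (List; []; _∷_; length; filter; upTo)
open import Data.List.Relation.Unary.All using (All)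
open import Data.List.Relation.Unary.Linked using (Linked)
open import Data.Nat.Base as ℕ using (ℕ; zero; suc; pred; _≥_; _∸_)
import Data.Nat.ListAction as ℕList
open import Data.Nat.Properties using (_≤?_)
open import Data.Product.Base using (Σ-syntax; ∃-syntax; _×_; _,_; proj₁)
open import Data.Vec.Functional using (Vector; head; tail)
open import Data.Vec.Base as Vec using (Vec)
open import Level using (_⊔_)
open import Relation.Binary.PropositionalEquality.Core using (_≢_)
open import Relation.Nullary.Negation.Core using (¬_)

record Diagram : Set where
  constructor mkDiagram
  field
    parts      : List ℕ
    decreasing : Linked _≥_ parts
    positive   : All ℕ.NonZero parts

open Diagram public

_≢ᴰ_ : Diagram → Diagram → Set
ν ≢ᴰ μ = parts ν ≢ parts μ

∣_∣ : Diagram → ℕ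
∣ μ ∣ = ℕList.sum (parts μ)

ℓ : Diagram → ℕ
ℓ μ = length (parts μ)

nth : List ℕ → ℕ → ℕ
nth []       _       = 0
nth (r ∷ rs) zero    = r
nth (r ∷ rs) (suc i) = nth rs i

-- Rows and columns are numbered from 1; the value of `row` at 0 is
-- irrelevant.  row μ i is μᵢ and col μ j is μ′ⱼ.

row : Diagram → ℕ → ℕ
row μ i = nth (parts μ) (pred i)

col : Diagram → ℕ → ℕ
col μ j = length (filter (j ≤?_) (parts μ))

diagonal : Diagram → ℕ
diagonal μ = length (filter (λ i → suc i ≤? row μ (suc i)) (upTo (ℓ μ)))

pos : ∀ {n} → Fin n → ℕ
pos i = suc (toℕ i)

frobP frobQ : (μ : Diagram) → Fin (diagonal μ) → ℤ
frobP μ i = + row μ (pos i) ℤ.- + pos i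
frobQ μ i = + col μ (pos i) ℤ.- + pos i

module Determinant {c e} (R : CommutativeRing c e) where
  open CommutativeRing R using (Carrier; _*_; -_; 1#; semiring)
  open RawSemiringDefs (Semiring.rawSemiring semiring) using (sum; _^_)

  det : ∀ {n} → (Fin n → Fin n → Carrier) → Carrier
  det {zero}  M = 1#
  det {suc n} M =
    sum λ j → (- 1#) ^ toℕ j * (M zero j * det λ i k → M (suc i) (punchIn j k))

-- # is used rather than ¬ _≈_ because 1/k has to be computed.  ℂ is an
-- instance, both classically (with # the negation of ≈) and for the
-- usual constructive complex numbers.

CharacteristicZero : ∀ {c ℓ₁ ℓ₂} → HeytingField c ℓ₁ ℓ₂ → Set ℓ₂
CharacteristicZero 𝕜 = ∀ n → (suc n ×ℕ 1#) #ᴷ 0#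
  where
  open HeytingField 𝕜 using (heytingCommutativeRing; 0#; 1#) renaming (_#_ to _#ᴷ_)
  open CommutativeRing (HeytingCommutativeRing.commutativeRing heytingCommutativeRing) using (semiring)
  open RawSemiringDefs (Semiring.rawSemiring semiring) using () renaming (_×_ to _×ℕ_)

module SymmetricFunctions {c ℓ₁ ℓ₂} (𝕜 : HeytingField c ℓ₁ ℓ₂)
                          (char0 : CharacteristicZero 𝕜) where

  𝕜-ring : CommutativeRing c ℓ₁
  𝕜-ring = HeytingCommutativeRing.commutativeRing
             (HeytingField.heytingCommutativeRing 𝕜)

  open CommutativeRing 𝕜-ring public using (_≈_; 0#)
  open CommutativeRing 𝕜-ring
    using (Carrier; _+_; _*_; -_; _-_; 1#; semiring)
  open RawSemiringDefs (Semiring.rawSemiring semiring) using (sum; product; _^_)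

  -- 1/(k+1)
  recip : ℕ → Carrier
  recip k = proj₁ (HeytingField.#⇒invertible 𝕜 (char0 k))

  -- Symmetric functions form the free commutative 𝕜-algebra on the power
  -- sums 𝐩₁, 𝐩₂, …; here it is terms modulo the congruence _≈Λ_ generated
  -- by the laws of commutative 𝕜-algebras.

  infix  8 -Λ_
  infixl 7 _*Λ_
  infixl 6 _+Λ_
  infix  4 _≈Λ_

  data Λ : Set c where
    con       : Carrier → Λ
    𝐩[1+_]    : ℕ → Λ
    _+Λ_ _*Λ_ : Λ → Λ → Λ
    -Λ_       : Λ → Λ

  0Λ 1Λ : Λ
  0Λ = con 0#
  1Λ = con 1#

  data _≈Λ_ : Λ → Λ → Set (c ⊔ ℓ₁) where
    reflΛ      : ∀ {F} → F ≈Λ F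
    symΛ       : ∀ {F G} → F ≈Λ G → G ≈Λ F
    transΛ     : ∀ {F G H} → F ≈Λ G → G ≈Λ H → F ≈Λ H
    con-cong   : ∀ {x y} → x ≈ y → con x ≈Λ con y
    +-cong     : ∀ {F F′ G G′} → F ≈Λ F′ → G ≈Λ G′ → F +Λ G ≈Λ F′ +Λ G′
    *-cong     : ∀ {F F′ G G′} → F ≈Λ F′ → G ≈Λ G′ → F *Λ G ≈Λ F′ *Λ G′
    -‿cong     : ∀ {F F′} → F ≈Λ F′ → -Λ F ≈Λ -Λ F′
    con-+      : ∀ x y → con (x + y) ≈Λ con x +Λ con y
    con-*      : ∀ x y → con (x * y) ≈Λ con x *Λ con y
    +-assoc    : ∀ F G H → (F +Λ G) +Λ H ≈Λ F +Λ (G +Λ H)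
    +-comm     : ∀ F G → F +Λ G ≈Λ G +Λ F
    +-identity : ∀ F → 0Λ +Λ F ≈Λ F
    -‿inverse  : ∀ F → -Λ F +Λ F ≈Λ 0Λ
    *-assoc    : ∀ F G H → (F *Λ G) *Λ H ≈Λ F *Λ (G *Λ H)
    *-comm     : ∀ F G → F *Λ G ≈Λ G *Λ F
    *-identity : ∀ F → 1Λ *Λ F ≈Λ F
    distrib    : ∀ F G H → F *Λ (G +Λ H) ≈Λ (F *Λ G) +Λ (F *Λ H)

  Λ-ring : CommutativeRing c (c ⊔ ℓ₁)
  Λ-ring = record
    { Carrier = Λ ; _≈_ = _≈Λ_ ; _+_ = _+Λ_ ; _*_ = _*Λ_ ; -_ = -Λ_
    ; 0# = 0Λ ; 1# = 1Λ
    ; isCommutativeRing = record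
      { isRing = record
        { +-isAbelianGroup = record
          { isGroup = record
            { isMonoid = record
              { isSemigroup = record
                { isMagma = record
                  { isEquivalence = record
                    { refl = reflΛ ; sym = symΛ ; trans = transΛ }
                  ; ∙-cong = +-cong }
                ; assoc = +-assoc }
              ; identity = +-identity
                         , λ F → transΛ (+-comm F 0Λ) (+-identity F) }
            ; inverse = -‿inverse
                      , λ F → transΛ (+-comm F (-Λ F)) (-‿inverse F)
            ; ⁻¹-cong = -‿cong }
          ; comm = +-comm }
        ; *-cong = *-cong
        ; *-assoc = *-assoc
        ; *-identity = *-identity
                     , λ F → transΛ (*-comm F 1Λ) (*-identity F)
        ; distrib = distrib
                  , λ F G H → transΛ (*-comm (G +Λ H) F)
                      (transΛ (distrib F G H)
                              (+-cong (*-comm F G) (*-comm F H))) }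
      ; *-comm = *-comm } }

  open CommutativeRing Λ-ring public using () renaming (_-_ to _-Λ_)
  open RawSemiringDefs (Semiring.rawSemiring (CommutativeRing.semiring Λ-ring)) public
    using () renaming (sum to ∑Λ)
  open Determinant Λ-ring public using (det)

  data Homogeneous : ℕ → Λ → Set (c ⊔ ℓ₁) where
    nil  : ∀ {n} → Homogeneous n 0Λ
    con  : ∀ x → Homogeneous 0 (con x)
    𝐩    : ∀ k → Homogeneous (suc k) 𝐩[1+ k ]
    add  : ∀ {n F G} → Homogeneous n F → Homogeneous n G → Homogeneous n (F +Λ G)
    mul  : ∀ {m n F G} → Homogeneous m F → Homogeneous n G →
           Homogeneous (m ℕ.+ n) (F *Λ G)
    resp : ∀ {n F G} → F ≈Λ G → Homogeneous n F → Homogeneous n G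

  Degree< : ℕ → Λ → Set (c ⊔ ℓ₁)
  Degree< n F = Σ[ G ∈ Vector Λ n ] (∀ i → Homogeneous (toℕ i) (G i)) × F ≈Λ ∑Λ G

  Degree≤ : ℕ → Λ → Set (c ⊔ ℓ₁)
  Degree≤ n = Degree< (suc n)

  IsTopComponent : Λ → Λ → Set (c ⊔ ℓ₁)
  IsTopComponent F G =
    ∃[ n ] Homogeneous n G × ¬ (G ≈Λ 0Λ) × Degree< n (F -Λ G)

  powerSum : ∀ {d} → ℕ → Vector Carrier d → Carrier
  powerSum k x = sum λ i → x i ^ k

  eval : ∀ {d} → Vector Carrier d → Vector Carrier d → Λ → Carrier
  eval x y (con z)    = z
  eval x y 𝐩[1+ k ]   = powerSum (suc k) x + (- 1#) ^ k * powerSum (suc k) y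
  eval x y (F +Λ G)   = eval x y F + eval x y G
  eval x y (F *Λ G)   = eval x y F * eval x y G
  eval x y (-Λ F)     = - eval x y F

  -- h↓ k is hₖ , hₖ₋₁ , … , h₀, computed by Newton's identities
  -- k hₖ = 𝐩₁ hₖ₋₁ + 𝐩₂ hₖ₋₂ + ⋯ + 𝐩ₖ h₀.
  h↓ : (k : ℕ) → Vec Λ (suc k)
  h↓ zero    = 1Λ Vec.∷ Vec.[]
  h↓ (suc k) =
    (con (recip k) *Λ ∑Λ λ i → 𝐩[1+ toℕ i ] *Λ Vec.lookup (h↓ k) i) Vec.∷ h↓ k

  h : ℕ → Λ
  h k = Vec.head (h↓ k)

  hℤ : ℤ → Λ
  hℤ (+ k)    = h k
  hℤ -[1+ _ ] = 0Λ

  -- Jacobi–Trudi; independent of the size ≥ ℓ μ of the determinant.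
  schur : Diagram → Λ
  schur μ = det {ℓ μ} λ i j → hℤ (+ row μ (pos i) ℤ.- + pos i ℤ.+ + pos j)

  Sequence : Set c
  Sequence = ℤ → Carrier

  τ : ℤ → Sequence → Sequence
  τ r a i = a (i ℤ.+ r)

  dual : Sequence → Sequence
  dual a i = - a (+ 1 ℤ.- i)

  -- Monomials of eₖ(x₁, …, xₙ) are split by whether x₁ occurs in them.
  elementary : ∀ {n} → ℕ → Vector Carrier n → Carrier
  elementary         zero    x = 1#
  elementary {zero}  (suc k) x = 0#
  elementary {suc n} (suc k) x =
    head x * elementary k (tail x) + elementary (suc k) (tail x)

  -- In the second clause the subscript is m + 1 and the summation index,
  -- 1 ≤ pos i ≤ m + 1, leaves the exponent (m + 1) - pos i = m ∸ toℕ i.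
  h⟨_⟩ : Sequence → ℤ → Λ
  h⟨ a ⟩ (+ zero)  = 1Λ
  h⟨ a ⟩ (+ suc m) = ∑Λ {suc m} λ i →
    con ((- 1#) ^ (m ∸ toℕ i) * elementary {m} (m ∸ toℕ i) (λ l → a (+ pos l)))
      *Λ h (pos i)
  h⟨ a ⟩ -[1+ _ ]  = 0Λ

  -- s⟨ a ⟩ N μ is the N × N determinant for s_{μ;a}, N ≥ ℓ μ.
  s⟨_⟩ : Sequence → ℕ → Diagram → Λ
  s⟨ a ⟩ N μ = det {N} λ i j →
    h⟨ τ (+ 1 ℤ.- + pos j) a ⟩ (+ row μ (pos i) ℤ.- + pos i ℤ.+ + pos j)

  -- For the empty diagram these are the unique point (0 ; 0) of 𝕜⁰ × 𝕜⁰;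
  -- every 𝐩ₖ evaluates to 0 there.
  xCoords yCoords : Sequence → (ν : Diagram) → Vector Carrier (diagonal ν)
  xCoords a ν i = a (frobP ν i ℤ.+ + 1)
  yCoords a ν i = dual a (frobQ ν i ℤ.+ + 1)

  evalAt : Sequence → Diagram → Λ → Carrier
  evalAt a ν = eval (xCoords a ν) (yCoords a ν)

  boxProduct : Sequence → Diagram → Carrier
  boxProduct a μ = product {ℓ μ} λ i → product {row μ (pos i)} λ j →
    a (+ row μ (pos i) ℤ.- + pos i ℤ.+ + 1) - a (+ pos j ℤ.- + col μ (pos j))

{-# OPTIONS --safe #-}
module Submission where

-- Write H(u) = Σ hₖ u⁻ᵏ at the point of λ as ∏ᵢ (u - a₁₋ᵢ) / (u - zᵢ) with
-- zᵢ = a_{λᵢ - i + 1}.  The entries of the determinant for s_{μ;a} are then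
-- the coefficients of 1/u in Tᵢ(u) Vⱼ(u) / ∏ (u - zₖ), where Tᵢ is the
-- product of u - aₗ over l ≤ μᵢ - i and Vⱼ is monic of degree j - 1.  Column
-- operations replace Vⱼ by (u - z₁) ⋯ (u - zⱼ₋₁), so that the entries become
-- divided differences of Tᵢ at zⱼ, zⱼ₊₁, ….  As Tᵢ(zₖ) = 0 for
-- λₖ - k < μᵢ - i, the matrix has a large zero block unless μ ⊆ λ, and is
-- triangular for μ = λ, with the hook products on its diagonal.
-- Uniqueness: the Schur functions span Λ, so an element of degree < n is a
-- combination of the s_{ν;a} with |ν| < n; evaluating at its smallest ν shows
-- that it is zero if it vanishes at all diagrams with fewer than n boxes.

open import Defs
open import Algebra.Apartness.Bundles using (HeytingField)
open import Algebra.Bundles using (CommutativeRing; RawRing; Semiring)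
import Algebra.Properties.AbelianGroup as AbelianGroupProperties
import Algebra.Properties.CommutativeMonoid.Sum as MonoidSum
import Algebra.Properties.Ring as RingProperties
import Algebra.Properties.Semiring.Mult as SemiringMult
import Algebra.Properties.Semiring.Mult.TCOptimised as SemiringMult′
import Algebra.Properties.Semiring.Sum as SemiringSum
import Algebra.Solver.Ring as RingSolver
open import Algebra.Solver.Ring.AlmostCommutativeRing
  using (fromCommutativeRing; _-Raw-AlmostCommutative⟶_)
open import Data.Fin.Base as Fin using (Fin; zero; suc; toℕ; punchIn; punchOut; inject₁)
import Data.Fin.Properties as FinP
open import Data.Integer.Base as ℤ using (ℤ; +_; -[1+_])
import Data.Integer.Properties as ℤP
import Data.Integer.Solver as ℤSolver
open import Data.List.Base as List using (List; []; _∷_; length; filter; upTo; applyUpTo; _++_)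
import Data.List.Properties as ListP
open import Data.List.Relation.Unary.All as All using (All; []; _∷_)
import Data.List.Relation.Unary.All.Properties as AllP
open import Data.List.Relation.Unary.Any using (Any; here; there)
open import Data.List.Relation.Unary.Linked as Linked using (Linked; []; [-]; _∷_)
import Data.List.Relation.Unary.Linked.Properties as LinkedP
open import Data.Maybe.Base using (Maybe; just; nothing)
open import Data.Nat.Base as ℕ using (ℕ; zero; suc; _≤_; _<_; _≥_; _∸_; z≤n; s≤s; NonZero)
open import Data.Nat.Induction using (<-rec)
import Data.Nat.ListAction as ℕList
import Data.Nat.Properties as ℕP
open import Data.Product.Base using (Σ-syntax; ∃-syntax; _×_; _,_; proj₁; proj₂)
open import Data.Sum.Base using (_⊎_; inj₁; inj₂)
import Data.Vec.Base as Vec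
open import Data.Vec.Functional using (Vector; updateAt)
import Data.Vec.Functional.Properties as VecFP
open import Function.Base using (_∘_; const; id)
open import Function.Bundles using (_⇔_; mk⇔; Equivalence)
open import Level using (_⊔_)
open import Relation.Binary.Definitions using (tri<; tri≈; tri>)
open import Relation.Binary.PropositionalEquality as ≡ using (_≡_; _≢_)
open import Relation.Nullary using (yes; no)
open import Relation.Nullary.Negation using (¬_; contradiction)
open import Relation.Unary using (Decidable)

-- Rational functions never appear as fractions. A quotient such as Tᵢ Vⱼ / ∏ (u - zₖ) is stored
-- through its coefficients of u⁰, u⁻¹, ..., so divided differences need no division and this part
-- runs in any commutative ring. The price is that positive powers of u are forgotten: division by u
-- - z is only a right inverse of multiplication by u - z, and it commutes with another factor only
-- on series without constant term. Conditions like `f 0 ≈ 0#` and the tracking of leading terms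
-- come from there. The infinite product for H(u) is cut off after M ≥ ℓ(λ) factors, since zᵢ = a₁₋ᵢ
-- for i > ℓ(λ). Moving all indices by M then makes them natural numbers: Tᵢ is the product of the
-- first μᵢ + M - i factors of one sequence `β M`, and the nodes zₖ are members of that sequence.
-- Equality in the field is not decidable. Uniqueness can still cancel hook products, because
-- tightness of apartness yields `x ≈ 0#` from `x * y ≈ 0#` and `¬ y ≈ 0#`. That the determinant
-- does not depend on N is obtained from uniqueness as well.

private
  module ℤS = ℤSolver.+-*-Solver
  module ℤ∑ = MonoidSum ℤP.+-0-commutativeMonoid

-- Polynomial identities with integer coefficients in a commutative ring.

module IntegerSolver {c e} (R : CommutativeRing c e) where
  open CommutativeRing R hiding (zero)
  open RingProperties ring
  open AbelianGroupProperties +-abelianGroup using (⁻¹-∙-comm)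
  open SemiringMult′ semiring renaming (_×_ to _·_)
  open import Relation.Binary.Reasoning.Setoid setoid

  -- Coefficients are integers because equality in the ring itself cannot be decided. The optimised
  -- multiple `_·_` reduces `1 · 1#` to `1#`, so that `con (+ 1)` in a solver equation is `1#` by
  -- definition.
  fromℤ : ℤ → Carrier
  fromℤ (+ n)    = n · 1#
  fromℤ -[1+ n ] = - (suc n · 1#)

  suc×1 : ∀ n → suc n · 1# ≈ 1# + n · 1#
  suc×1 n = ×-homo-+ 1# 1 n

  cancel-1 : ∀ x y → (1# + x) - (1# + y) ≈ x - y
  cancel-1 x y = begin
    (1# + x) + - (1# + y)     ≈⟨ +-cong (+-comm 1# x) (sym (⁻¹-∙-comm 1# y)) ⟩
    (x + 1#) + (- 1# + - y)   ≈⟨ +-assoc x 1# _ ⟩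
    x + (1# + (- 1# + - y))   ≈⟨ +-congˡ (sym (+-assoc 1# (- 1#) (- y))) ⟩
    x + ((1# + - 1#) + - y)   ≈⟨ +-congˡ (+-congʳ (-‿inverseʳ 1#)) ⟩
    x + (0# + - y)            ≈⟨ +-congˡ (+-identityˡ (- y)) ⟩
    x - y                     ∎

  fromℤ-⊖ : ∀ m n → fromℤ (m ℤ.⊖ n) ≈ m · 1# - n · 1#
  fromℤ-⊖ zero    zero    = sym (-‿inverseʳ 0#)
  fromℤ-⊖ zero    (suc n) = sym (+-identityˡ _)
  fromℤ-⊖ (suc m) zero    = sym (trans (+-congˡ -0#≈0#) (+-identityʳ _))
  fromℤ-⊖ (suc m) (suc n) = begin
    fromℤ (suc m ℤ.⊖ suc n)          ≡⟨ ≡.cong fromℤ (ℤP.[1+m]⊖[1+n]≡m⊖n m n) ⟩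
    fromℤ (m ℤ.⊖ n)                  ≈⟨ fromℤ-⊖ m n ⟩
    m · 1# - n · 1#                  ≈⟨ cancel-1 _ _ ⟨
    (1# + m · 1#) - (1# + n · 1#)    ≈⟨ +-cong (suc×1 m) (-‿cong (suc×1 n)) ⟨
    suc m · 1# - suc n · 1#          ∎

  fromℤ-+ : ∀ i j → fromℤ (i ℤ.+ j) ≈ fromℤ i + fromℤ j
  fromℤ-+ (+ m)    (+ n)    = ×-homo-+ 1# m n
  fromℤ-+ (+ m)    -[1+ n ] = fromℤ-⊖ m (suc n)
  fromℤ-+ -[1+ m ] (+ n)    = trans (fromℤ-⊖ n (suc m)) (+-comm _ _)
  fromℤ-+ -[1+ m ] -[1+ n ] = begin
    - (suc (suc (m ℕ.+ n)) · 1#)         ≡⟨ ≡.cong (λ k → - (suc k · 1#)) (ℕP.+-suc m n) ⟨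
    - ((suc m ℕ.+ suc n) · 1#)           ≈⟨ -‿cong (×-homo-+ 1# (suc m) (suc n)) ⟩
    - (suc m · 1# + suc n · 1#)          ≈⟨ ⁻¹-∙-comm _ _ ⟨
    - (suc m · 1#) + - (suc n · 1#)      ∎

  fromℤ-neg : ∀ i → fromℤ (ℤ.- i) ≈ - fromℤ i
  fromℤ-neg (+ zero)  = sym -0#≈0#
  fromℤ-neg (+ suc n) = refl
  fromℤ-neg -[1+ n ]  = sym (-‿involutive _)

  fromℤ-*ⁿ : ∀ n j → fromℤ (+ n ℤ.* j) ≈ (n · 1#) * fromℤ j
  fromℤ-*ⁿ n (+ m)    = trans (reflexive (≡.cong fromℤ (≡.sym (ℤP.pos-* n m)))) (×1-homo-* n m)
  fromℤ-*ⁿ n -[1+ m ] = begin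
    fromℤ (+ n ℤ.* (ℤ.- (+ suc m)))   ≡⟨ ≡.cong fromℤ (ℤP.neg-distribʳ-* (+ n) (+ suc m)) ⟨
    fromℤ (ℤ.- (+ n ℤ.* + suc m))     ≈⟨ fromℤ-neg (+ n ℤ.* + suc m) ⟩
    - fromℤ (+ n ℤ.* + suc m)         ≈⟨ -‿cong (fromℤ-*ⁿ n (+ suc m)) ⟩
    - ((n · 1#) * (suc m · 1#))       ≈⟨ -‿distribʳ-* _ _ ⟩
    (n · 1#) * - (suc m · 1#)         ∎

  fromℤ-* : ∀ i j → fromℤ (i ℤ.* j) ≈ fromℤ i * fromℤ j
  fromℤ-* (+ n)    j = fromℤ-*ⁿ n j
  fromℤ-* -[1+ n ] j = begin
    fromℤ (ℤ.- (+ suc n) ℤ.* j)    ≡⟨ ≡.cong fromℤ (ℤP.neg-distribˡ-* (+ suc n) j) ⟨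
    fromℤ (ℤ.- (+ suc n ℤ.* j))    ≈⟨ fromℤ-neg (+ suc n ℤ.* j) ⟩
    - fromℤ (+ suc n ℤ.* j)        ≈⟨ -‿cong (fromℤ-*ⁿ (suc n) j) ⟩
    - ((suc n · 1#) * fromℤ j)     ≈⟨ -‿distribˡ-* _ _ ⟩
    - (suc n · 1#) * fromℤ j       ∎

  ℤ-rawRing : RawRing _ _
  ℤ-rawRing = record
    { Carrier = ℤ ; _≈_ = _≡_ ; _+_ = ℤ._+_ ; _*_ = ℤ._*_ ; -_ = ℤ.-_
    ; 0# = + 0 ; 1# = + 1 }

  morphism : ℤ-rawRing -Raw-AlmostCommutative⟶ fromCommutativeRing R
  morphism = record
    { ⟦_⟧ = fromℤ ; +-homo = fromℤ-+ ; *-homo = fromℤ-* ; -‿homo = fromℤ-neg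
    ; 0-homo = refl ; 1-homo = refl }

  fromℤ-≟ : ∀ i j → Maybe (fromℤ i ≈ fromℤ j)
  fromℤ-≟ i j with i ℤP.≟ j
  ... | yes i≡j = just (reflexive (≡.cong fromℤ i≡j))
  ... | no  _   = nothing

  open RingSolver ℤ-rawRing (fromCommutativeRing R) morphism fromℤ-≟ public
    using (solve; _:=_; con; _:+_; _:*_; _:-_; :-_)

-- Determinants by expansion along the first row.

module DeterminantProperties {c e} (R : CommutativeRing c e) where
  open CommutativeRing R hiding (zero)
  open SemiringSum semiring
  open import Algebra.Definitions.RawSemiring (Semiring.rawSemiring semiring) using (_^_; product)
  open Determinant R
  open IntegerSolver R
  open import Relation.Binary.Reasoning.Setoid setoid

  Matrix : ℕ → Set c
  Matrix n = Fin n → Fin n → Carrier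

  minor : ∀ {n} → Matrix (suc n) → Fin (suc n) → Matrix n
  minor M j i k = M (suc i) (punchIn j k)

  sign : ∀ {n} → Fin n → Carrier
  sign j = (- 1#) ^ toℕ j

  sum-zero : ∀ {n} {f : Fin n → Carrier} → (∀ i → f i ≈ 0#) → sum f ≈ 0#
  sum-zero {n} f≈0 = trans (sum-cong-≋ f≈0) (sum-replicate-zero n)

  sum-adjacent-cancel : ∀ {n} (f : Fin (suc n) → Carrier) (p : Fin n) →
    f (inject₁ p) + f (suc p) ≈ 0# →
    (∀ k → k ≢ inject₁ p → k ≢ suc p → f k ≈ 0#) → sum f ≈ 0#
  sum-adjacent-cancel f zero pair others = begin
    f zero + (f (suc zero) + _)    ≈⟨ +-assoc _ _ _ ⟨
    (f zero + f (suc zero)) + _    ≈⟨ +-cong pair (sum-zero λ k → others (suc (suc k)) (λ ()) (λ ())) ⟩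
    0# + 0#                        ≈⟨ +-identityˡ 0# ⟩
    0#                             ∎
  sum-adjacent-cancel f (suc p) pair others = begin
    f zero + sum (f ∘ suc)   ≈⟨ +-cong (others zero (λ ()) (λ ()))
                                  (sum-adjacent-cancel (f ∘ suc) p pair
                                    λ k k≢p k≢sp → others (suc k) (k≢p ∘ FinP.suc-injective) (k≢sp ∘ FinP.suc-injective)) ⟩
    0# + 0#                  ≈⟨ +-identityˡ 0# ⟩
    0#                       ∎

  det-cong : ∀ {n} {M M′ : Matrix n} → (∀ i j → M i j ≈ M′ i j) → det M ≈ det M′
  det-cong {zero}  eq = refl
  det-cong {suc n} eq = sum-cong-≋ λ j →
    *-congˡ {sign j} (*-cong (eq zero j) (det-cong λ i k → eq (suc i) (punchIn j k)))

  zero-term : ∀ s {x} d → x ≈ 0# → s * (x * d) ≈ 0#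
  zero-term s d x≈0 = trans (*-congˡ (trans (*-congʳ x≈0) (zeroˡ d))) (zeroʳ s)

  zero-term′ : ∀ s x {d} → d ≈ 0# → s * (x * d) ≈ 0#
  zero-term′ s x d≈0 = trans (*-congˡ (trans (*-congˡ d≈0) (zeroʳ x))) (zeroʳ s)

  punchIn-≥ : ∀ {n} (j : Fin (suc n)) (k : Fin n) → toℕ j ℕ.≤ toℕ k → toℕ (punchIn j k) ≡ suc (toℕ k)
  punchIn-≥ zero    k       _         = ≡.refl
  punchIn-≥ (suc j) (suc k) (s≤s j≤k) = ≡.cong suc (punchIn-≥ j k j≤k)

  -- The block has r + 1 rows and n - r columns, one too many for a nonzero determinant. In the
  -- expansion, a column that meets the block has a zero entry in the first row. Any other column
  -- lies to the left of the block, and its minor contains the block for r - 1.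
  det-zeroBlock : ∀ {n} (M : Matrix n) (r : ℕ) → r ℕ.< n →
    (∀ i k → toℕ i ℕ.≤ r → r ℕ.≤ toℕ k → M i k ≈ 0#) → det M ≈ 0#
  det-zeroBlock {suc n} M zero    _         block = sum-zero λ j → zero-term (sign j) (det (minor M j)) (block zero j z≤n z≤n)
  det-zeroBlock {suc n} M (suc r) (s≤s r<n) block = sum-zero term
    where
    term : ∀ j → sign j * (M zero j * det (minor M j)) ≈ 0#
    term j with suc r ℕP.≤? toℕ j
    ... | yes r<j = zero-term _ _ (block zero j z≤n r<j)
    ... | no  r≮j = zero-term′ _ _ (det-zeroBlock (minor M j) r r<n λ i k i≤r r≤k →
              block (suc i) (punchIn j k) (s≤s i≤r)
                (≡.subst (suc r ℕ.≤_)
                  (≡.sym (punchIn-≥ j k (ℕP.≤-trans (ℕP.≤-pred (ℕP.≰⇒> r≮j)) r≤k)))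
                  (s≤s r≤k)))

  det-lowerTriangular : ∀ {n} (M : Matrix n) →
    (∀ i k → toℕ i ℕ.< toℕ k → M i k ≈ 0#) → det M ≈ product (λ i → M i i)
  det-lowerTriangular {zero}  M upper = refl
  det-lowerTriangular {suc n} M upper = begin
    1# * (M zero zero * det (minor M zero)) + sum (λ j → sign (suc j) * (M zero (suc j) * det (minor M (suc j))))
      ≈⟨ +-cong (*-identityˡ _) (sum-zero λ j → zero-term _ _ (upper zero (suc j) (s≤s z≤n))) ⟩
    M zero zero * det (minor M zero) + 0#
      ≈⟨ +-identityʳ _ ⟩
    M zero zero * det (minor M zero)
      ≈⟨ *-congˡ (det-lowerTriangular (minor M zero) λ i k i<k → upper (suc i) (suc k) (s≤s i<k)) ⟩
    M zero zero * product (λ i → M (suc i) (suc i)) ∎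

  det-column-linear : ∀ {n} (q : Fin n) (x : Carrier) (X Y B : Matrix n) →
    (∀ i → X i q ≈ Y i q + x * B i q) →
    (∀ i k → k ≢ q → X i k ≈ Y i k) → (∀ i k → k ≢ q → X i k ≈ B i k) →
    det X ≈ det Y + x * det B
  det-column-linear {suc n} q x X Y B col XY XB = begin
    sum (term X)                                   ≈⟨ sum-cong-≋ term-linear ⟩
    sum (λ j → term Y j + x * term B j)            ≈⟨ ∑-distrib-+ (term Y) (λ j → x * term B j) ⟩
    det Y + sum (λ j → x * term B j)               ≈⟨ +-congˡ (*-distribˡ-sum x (term B)) ⟨
    det Y + x * det B                              ∎
    where
    term : Matrix (suc n) → Fin (suc n) → Carrier
    term M j = sign j * (M zero j * det (minor M j))

    term-linear : ∀ j → term X j ≈ term Y j + x * term B j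
    term-linear j with j FinP.≟ q
    ... | yes ≡.refl = begin
      sign j * (X zero j * det (minor X j))
        ≈⟨ *-congˡ (*-congʳ (col zero)) ⟩
      sign j * ((Y zero j + x * B zero j) * det (minor X j))
        ≈⟨ solve 5 (λ s y x b d → s :* ((y :+ x :* b) :* d) := s :* (y :* d) :+ x :* (s :* (b :* d)))
             refl (sign j) (Y zero j) x (B zero j) (det (minor X j)) ⟩
      sign j * (Y zero j * det (minor X j)) + x * (sign j * (B zero j * det (minor X j)))
        ≈⟨ +-cong (*-congˡ {sign j} (*-congˡ {Y zero j} (det-cong λ i k → XY (suc i) (punchIn j k) (FinP.punchInᵢ≢i j k))))
                  (*-congˡ {x} (*-congˡ {sign j} (*-congˡ {B zero j} (det-cong λ i k → XB (suc i) (punchIn j k) (FinP.punchInᵢ≢i j k))))) ⟩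
      term Y j + x * term B j ∎
    ... | no j≢q = begin
      sign j * (X zero j * det (minor X j))
        ≈⟨ *-congˡ {sign j} (*-congˡ {X zero j} (det-column-linear q′ x (minor X j) (minor Y j) (minor B j)
             (λ i → ≡.subst (λ t → X (suc i) t ≈ Y (suc i) t + x * B (suc i) t) (≡.sym q≡) (col (suc i)))
             (λ i k k≢ → XY (suc i) (punchIn j k) (other k k≢))
             (λ i k k≢ → XB (suc i) (punchIn j k) (other k k≢)))) ⟩
      sign j * (X zero j * (det (minor Y j) + x * det (minor B j)))
        ≈⟨ solve 5 (λ s y d x b → s :* (y :* (d :+ x :* b)) := s :* (y :* d) :+ x :* (s :* (y :* b)))
             refl (sign j) (X zero j) (det (minor Y j)) x (det (minor B j)) ⟩
      sign j * (X zero j * det (minor Y j)) + x * (sign j * (X zero j * det (minor B j)))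
        ≈⟨ +-cong (*-congˡ {sign j} (*-congʳ (XY zero j j≢q))) (*-congˡ {x} (*-congˡ {sign j} (*-congʳ (XB zero j j≢q)))) ⟩
      term Y j + x * term B j ∎
      where
      q′ = punchOut j≢q
      q≡ : punchIn j q′ ≡ q
      q≡ = FinP.punchIn-punchOut j≢q
      other : ∀ k → k ≢ q′ → punchIn j k ≢ q
      other k k≢ eq = k≢ (FinP.punchIn-injective j k q′ (≡.trans eq (≡.sym q≡)))

  -- Compares the minors without column p and without column p + 1: they keep the same columns
  -- except in one place, where the first has column p + 1 and the second has column p.
  punchIn-inject₁-suc : ∀ {n} (p : Fin n) (k : Fin n) →
    punchIn (inject₁ p) k ≡ punchIn (suc p) k ⊎
    (punchIn (inject₁ p) k ≡ suc p × punchIn (suc p) k ≡ inject₁ p)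
  punchIn-inject₁-suc zero    zero    = inj₂ (≡.refl , ≡.refl)
  punchIn-inject₁-suc zero    (suc k) = inj₁ ≡.refl
  punchIn-inject₁-suc (suc p) zero    = inj₁ ≡.refl
  punchIn-inject₁-suc (suc p) (suc k) with punchIn-inject₁-suc p k
  ... | inj₁ eq         = inj₁ (≡.cong suc eq)
  ... | inj₂ (eq , eq′) = inj₂ (≡.cong suc eq , ≡.cong suc eq′)

  punchIn-adjacent : ∀ {n} (k : Fin (suc (suc n))) (p : Fin (suc n)) → k ≢ inject₁ p → k ≢ suc p →
    Σ[ p′ ∈ Fin n ] punchIn k (inject₁ p′) ≡ inject₁ p × punchIn k (suc p′) ≡ suc p
  punchIn-adjacent zero          zero    k≢ _  = contradiction ≡.refl k≢
  punchIn-adjacent zero          (suc p) _  _  = p , ≡.refl , ≡.refl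
  punchIn-adjacent (suc zero)    zero    _  k≢ = contradiction ≡.refl k≢
  punchIn-adjacent {suc n} (suc (suc k)) zero    _  _  = zero , ≡.refl , ≡.refl
  punchIn-adjacent {suc n} (suc k)       (suc p) k≢ k≢′ with punchIn-adjacent k p (k≢ ∘ ≡.cong suc) (k≢′ ∘ ≡.cong suc)
  ... | p′ , eq , eq′ = suc p′ , ≡.cong suc eq , ≡.cong suc eq′
  punchIn-adjacent {zero}  (suc zero) (suc ()) _ _

  -- The two equal columns have equal minors and opposite signs, and every other minor again has two
  -- adjacent equal columns. Staying with adjacent columns spares any count of signs.
  det-adjacent-equal : ∀ {n} (M : Matrix (suc n)) (p : Fin n) →
    (∀ i → M i (inject₁ p) ≈ M i (suc p)) → det M ≈ 0#
  det-adjacent-equal {suc n} M p eq = sum-adjacent-cancel _ p pair others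
    where
    minors≈ : ∀ i k → minor M (inject₁ p) i k ≈ minor M (suc p) i k
    minors≈ i k with punchIn-inject₁-suc p k
    ... | inj₁ e        = reflexive (≡.cong (M (suc i)) e)
    ... | inj₂ (e , e′) = trans (reflexive (≡.cong (M (suc i)) e))
                           (trans (sym (eq (suc i))) (reflexive (≡.cong (M (suc i)) (≡.sym e′))))

    pair : sign (inject₁ p) * (M zero (inject₁ p) * det (minor M (inject₁ p))) +
           sign (suc p) * (M zero (suc p) * det (minor M (suc p))) ≈ 0#
    pair = begin
      sign (inject₁ p) * (M zero (inject₁ p) * det (minor M (inject₁ p))) + (- 1# * sign p) * (M zero (suc p) * det (minor M (suc p)))
        ≈⟨ +-congʳ (*-cong (reflexive (≡.cong ((- 1#) ^_) (FinP.toℕ-inject₁ p)))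
             (*-cong (eq zero) (det-cong minors≈))) ⟩
      sign p * (M zero (suc p) * det (minor M (suc p))) + (- 1# * sign p) * (M zero (suc p) * det (minor M (suc p)))
        ≈⟨ solve 2 (λ s x → s :* x :+ (:- con (+ 1) :* s) :* x := con (+ 0)) refl (sign p) _ ⟩
      0# ∎

    others : ∀ k → k ≢ inject₁ p → k ≢ suc p → sign k * (M zero k * det (minor M k)) ≈ 0#
    others k k≢ k≢′ with punchIn-adjacent k p k≢ k≢′
    ... | p′ , e , e′ = zero-term′ _ _ (det-adjacent-equal (minor M k) p′ λ i →
          trans (reflexive (≡.cong (M (suc i)) e)) (trans (eq (suc i)) (reflexive (≡.cong (M (suc i)) (≡.sym e′)))))

  det-add-adjacent : ∀ {n} (p : Fin n) (x : Carrier) (X Y : Matrix (suc n)) →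
    (∀ i → X i (suc p) ≈ Y i (suc p) + x * Y i (inject₁ p)) →
    (∀ i k → k ≢ suc p → X i k ≈ Y i k) → det X ≈ det Y
  det-add-adjacent {n} p x X Y col rest = begin
    det X              ≈⟨ det-column-linear (suc p) x X Y B
                            (λ i → trans (col i) (+-congˡ (*-congˡ (sym (B-suc i))))) rest
                            (λ i k k≢ → trans (rest i k k≢) (sym (B-other i k k≢))) ⟩
    det Y + x * det B  ≈⟨ +-congˡ (*-congˡ (det-adjacent-equal B p λ i →
                            trans (B-other i (inject₁ p) inject₁≢suc) (sym (B-suc i)))) ⟩
    det Y + x * 0#     ≈⟨ trans (+-congˡ (zeroʳ x)) (+-identityʳ _) ⟩
    det Y              ∎
    where
    B : Matrix (suc n)
    B i = updateAt (Y i) (suc p) (const (Y i (inject₁ p)))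

    B-suc : ∀ i → B i (suc p) ≈ Y i (inject₁ p)
    B-suc i = reflexive (VecFP.updateAt-updates (suc p) (Y i))

    B-other : ∀ i k → k ≢ suc p → B i k ≈ Y i k
    B-other i k k≢ = reflexive (VecFP.updateAt-minimal k (suc p) (Y i) k≢)

    inject₁≢suc : inject₁ p ≢ suc p
    inject₁≢suc eq = ℕP.1+n≢n (≡.sym (≡.trans (≡.sym (FinP.toℕ-inject₁ p)) (≡.cong toℕ eq)))

  -- Columns of X are exchanged for columns of Y from left to right. When column p + 1 has its turn,
  -- its left neighbour is already column p of Y, so the exchange is a single elementary operation.
  det-bidiagonal : ∀ {n} (x : Fin n → Carrier) (X Y : Matrix (suc n)) →
    (∀ i → X i zero ≈ Y i zero) →
    (∀ i p → X i (suc p) ≈ Y i (suc p) + x p * Y i (inject₁ p)) → det X ≈ det Y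
  det-bidiagonal {n} x X Y col₀ col = trans (det-cong (λ i j → sym (mixed-≥ 0 i j z≤n))) (trans (steps (suc n) ℕP.≤-refl)
      (det-cong (λ i j → mixed-< (suc n) i j (FinP.toℕ<n j))))
    where
    mixed : ℕ → Matrix (suc n)
    mixed m i j with toℕ j ℕP.<? m
    ... | yes _ = Y i j
    ... | no  _ = X i j

    mixed-< : ∀ m i j → toℕ j ℕ.< m → mixed m i j ≈ Y i j
    mixed-< m i j j<m with toℕ j ℕP.<? m
    ... | yes _ = refl
    ... | no  j≮m = contradiction j<m j≮m

    mixed-≥ : ∀ m i j → m ℕ.≤ toℕ j → mixed m i j ≈ X i j
    mixed-≥ m i j m≤j with toℕ j ℕP.<? m
    ... | yes j<m = contradiction j<m (ℕP.≤⇒≯ m≤j)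
    ... | no  _   = refl

    mixed-≢ : ∀ m i j → toℕ j ≢ m → mixed m i j ≈ mixed (suc m) i j
    mixed-≢ m i j j≢m with toℕ j ℕP.<? m
    ... | yes j<m = sym (mixed-< (suc m) i j (ℕP.m<n⇒m<1+n j<m))
    ... | no  j≮m = sym (mixed-≥ (suc m) i j (ℕP.≤∧≢⇒< (ℕP.≮⇒≥ j≮m) (j≢m ∘ ≡.sym)))

    step : ∀ m → m ℕ.< suc n → det (mixed m) ≈ det (mixed (suc m))
    step zero    _         = det-cong eq
      where
      eq : ∀ i j → mixed 0 i j ≈ mixed 1 i j
      eq i zero    = trans (mixed-≥ 0 i zero z≤n) (trans (col₀ i) (sym (mixed-< 1 i zero (s≤s z≤n))))
      eq i (suc j) = mixed-≢ 0 i (suc j) λ ()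
    step (suc m) (s≤s m<n) = det-add-adjacent p (x p) _ _
      (λ i → trans (mixed-≥ (suc m) i (suc p) (s≤s (ℕP.≤-reflexive (≡.sym p≡m))))
               (trans (col i p) (+-cong (sym (mixed-< (2 ℕ.+ m) i (suc p) (s≤s (s≤s (ℕP.≤-reflexive p≡m)))))
                 (*-congˡ (sym (mixed-< (2 ℕ.+ m) i (inject₁ p) (s≤s (ℕP.≤-trans (ℕP.≤-reflexive (≡.trans (FinP.toℕ-inject₁ p) p≡m)) (ℕP.n≤1+n m)))))))))
      (λ i k k≢ → mixed-≢ (suc m) i k λ eq → k≢ (FinP.toℕ-injective (≡.trans eq (≡.cong suc (≡.sym p≡m)))))
      where
      p = Fin.fromℕ< m<n
      p≡m : toℕ p ≡ m
      p≡m = FinP.toℕ-fromℕ< m<n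

    steps : ∀ m → m ℕ.≤ suc n → det (mixed 0) ≈ det (mixed m)
    steps zero    _   = refl
    steps (suc m) m<n = trans (steps m (ℕP.<⇒≤ m<n)) (step m m<n)

-- Series in 1/u, linear factors, and Newton's identities.

module SequenceOperators {c e} (R : CommutativeRing c e) where
  open CommutativeRing R hiding (zero)
  open RingProperties ring
  open import Algebra.Definitions.RawSemiring (Semiring.rawSemiring semiring) using (_^_; product)
    renaming (_×_ to _·_)
  open Determinant R
  open DeterminantProperties R
  open IntegerSolver R
  open import Relation.Binary.Reasoning.Setoid setoid

  -- f stands for Σ fₖ u⁻ᵏ modulo u R[u]; then f ◁ b is (u - b) f.
  Seq : Set c
  Seq = ℕ → Carrier

  infix 4 _≐_
  _≐_ : Seq → Seq → Set e
  f ≐ g = ∀ k → f k ≈ g k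

  infixl 7 _◁_
  _◁_ : Seq → Carrier → Seq
  (f ◁ b) k = f (suc k) - b * f k

  [1/u-_] : Carrier → Seq → Seq
  [1/u- z ] f zero    = 0#
  [1/u- z ] f (suc k) = z * [1/u- z ] f k + f k

  δ : Seq
  δ zero    = 1#
  δ (suc _) = 0#

  ◁-cong : ∀ {f g} b → f ≐ g → f ◁ b ≐ g ◁ b
  ◁-cong b f≐g k = +-cong (f≐g (suc k)) (-‿cong (*-congˡ (f≐g k)))

  ◁-congʳ : ∀ f {b b′} → b ≈ b′ → f ◁ b ≐ f ◁ b′
  ◁-congʳ f b≈b′ k = +-congˡ (-‿cong (*-congʳ b≈b′))

  ◁-comm : ∀ f b b′ → f ◁ b ◁ b′ ≐ f ◁ b′ ◁ b
  ◁-comm f b b′ k =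
    solve 5 (λ x y z b b′ → (x :- b :* y) :- b′ :* (y :- b :* z) := (x :- b′ :* y) :- b :* (y :- b′ :* z))
      refl (f (2 ℕ.+ k)) (f (suc k)) (f k) b b′

  [1/u-]-cong : ∀ z {f g} → f ≐ g → [1/u- z ] f ≐ [1/u- z ] g
  [1/u-]-cong z f≐g zero    = refl
  [1/u-]-cong z f≐g (suc k) = +-cong (*-congˡ ([1/u-]-cong z f≐g k)) (f≐g k)

  [1/u-]-congˡ : ∀ {z z′} f → z ≈ z′ → [1/u- z ] f ≐ [1/u- z′ ] f
  [1/u-]-congˡ f z≈z′ zero    = refl
  [1/u-]-congˡ f z≈z′ (suc k) = +-congʳ (*-cong z≈z′ ([1/u-]-congˡ f z≈z′ k))

  [1/u-]-◁ : ∀ z f → [1/u- z ] f ◁ z ≐ f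
  [1/u-]-◁ z f k = solve 3 (λ z x y → (z :* x :+ y) :- z :* x := y) refl z ([1/u- z ] f k) (f k)

  -- The hypothesis compensates for truncation: `f ◁ b` has lost the term f₀ u, whose quotient by u
  -- - z would begin with the constant f₀.
  [1/u-]-◁-comm : ∀ z b {f} → f 0 ≈ 0# → [1/u- z ] (f ◁ b) ≐ [1/u- z ] f ◁ b
  [1/u-]-◁-comm z b {f} f₀≈0 zero = sym (begin
    (z * 0# + f 0) - b * 0#   ≈⟨ solve 3 (λ z x b → (z :* con (+ 0) :+ x) :- b :* con (+ 0) := x) refl z (f 0) b ⟩
    f 0                       ≈⟨ f₀≈0 ⟩
    0#                        ∎)
  [1/u-]-◁-comm z b {f} f₀≈0 (suc k) = begin
    z * [1/u- z ] (f ◁ b) k + (f (suc k) - b * f k)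
      ≈⟨ +-congʳ (*-congˡ ([1/u-]-◁-comm z b f₀≈0 k)) ⟩
    z * ((z * g + f k) - b * g) + (f (suc k) - b * f k)
      ≈⟨ solve 5 (λ z b g x y → z :* ((z :* g :+ x) :- b :* g) :+ (y :- b :* x)
                              := (z :* (z :* g :+ x) :+ y) :- b :* (z :* g :+ x))
           refl z b g (f k) (f (suc k)) ⟩
    (z * (z * g + f k) + f (suc k)) - b * (z * g + f k) ∎
    where g = [1/u- z ] f k

  act : ℕ → (ℕ → Carrier) → Seq → Seq
  act zero    b f = f
  act (suc n) b f = act n (b ∘ suc) (f ◁ b 0)

  act-cong : ∀ n b {f g} → f ≐ g → act n b f ≐ act n b g
  act-cong zero    b f≐g = f≐g
  act-cong (suc n) b f≐g = act-cong n (b ∘ suc) (◁-cong (b 0) f≐g)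

  act-congˡ : ∀ n {b b′} f → (∀ l → l ℕ.< n → b l ≈ b′ l) → act n b f ≐ act n b′ f
  act-congˡ zero            f b≈b′ k = refl
  act-congˡ (suc n) {b} {b′} f b≈b′ k = trans
    (act-cong n (b ∘ suc) (◁-congʳ f (b≈b′ 0 (s≤s z≤n))) k)
    (act-congˡ n (f ◁ b′ 0) (λ l l<n → b≈b′ (suc l) (s≤s l<n)) k)

  act-◁ : ∀ n b f x → act n b (f ◁ x) ≐ act n b f ◁ x
  act-◁ zero    b f x k = refl
  act-◁ (suc n) b f x k = trans (act-cong n (b ∘ suc) (◁-comm f x (b 0)) k) (act-◁ n (b ∘ suc) (f ◁ b 0) x k)

  act-last : ∀ n b f → act (suc n) b f ≐ act n b f ◁ b n
  act-last zero    b f k = refl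
  act-last (suc n) b f k = act-last n (b ∘ suc) (f ◁ b 0) k

  act-act : ∀ m n b b′ f → act m b (act n b′ f) ≐ act n b′ (act m b f)
  act-act zero    n b b′ f k = refl
  act-act (suc m) n b b′ f k = trans
    (act-cong m (b ∘ suc) (λ l → sym (act-◁ n b′ f (b 0) l)) k)
    (act-act m n (b ∘ suc) b′ (f ◁ b 0) k)

  -- The expansion of 1 / ((u - z₀) ⋯ (u - zₙ₋₁)) in powers of 1/u.
  ρ : ℕ → (ℕ → Carrier) → Seq
  ρ zero    z = δ
  ρ (suc n) z = [1/u- z 0 ] (ρ n (z ∘ suc))

  act-ρ : ∀ j n z → act j z (ρ (j ℕ.+ n) z) ≐ ρ n (z ∘ (j ℕ.+_))
  act-ρ zero    n z k = refl
  act-ρ (suc j) n z k = trans (act-cong j (z ∘ suc) ([1/u-]-◁ (z 0) _) k) (act-ρ j n (z ∘ suc) k)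

  -- f is u⁻ᵖ + lower powers of u.
  Lead : ℕ → Seq → Set e
  Lead p f = (∀ k → k ℕ.< p → f k ≈ 0#) × f p ≈ 1#

  Lead-δ : Lead 0 δ
  Lead-δ = (λ k ()) , refl

  Lead-[1/u-] : ∀ {p} z {f} → Lead p f → Lead (suc p) ([1/u- z ] f)
  Lead-[1/u-] {p} z {f} (low , top) = low′ , trans (+-cong (trans (*-congˡ (low′ p ℕP.≤-refl)) (zeroʳ z)) top) (+-identityˡ 1#)
    where
    low′ : ∀ k → k ℕ.< suc p → [1/u- z ] f k ≈ 0#
    low′ zero    _         = refl
    low′ (suc k) (s≤s k<p) = trans (+-cong (trans (*-congˡ (low′ k (ℕP.<⇒≤ (s≤s k<p)))) (zeroʳ z)) (low k k<p)) (+-identityˡ 0#)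

  Lead-◁ : ∀ {p} b {f} → Lead (suc p) f → Lead p (f ◁ b)
  Lead-◁ {p} b {f} (low , top) =
    (λ k k<p → trans (+-cong (low (suc k) (s≤s k<p)) (zero-part k (ℕP.m<n⇒m<1+n k<p))) (+-identityˡ 0#)) ,
    trans (+-cong top (zero-part p ℕP.≤-refl)) (+-identityʳ 1#)
    where
    zero-part : ∀ k → k ℕ.< suc p → - (b * f k) ≈ 0#
    zero-part k k<p = trans (-‿cong (trans (*-congˡ (low k k<p)) (zeroʳ b))) -0#≈0#

  Lead-act : ∀ n {p} b {f} → Lead (n ℕ.+ p) f → Lead p (act n b f)
  Lead-act zero    b lead = lead
  Lead-act (suc n) b lead = Lead-act n (b ∘ suc) (Lead-◁ (b 0) lead)

  Lead-ρ : ∀ n z → Lead n (ρ n z)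
  Lead-ρ zero    z = Lead-δ
  Lead-ρ (suc n) z = Lead-[1/u-] (z 0) (Lead-ρ n (z ∘ suc))

  conv : Seq → Seq → ℕ → Carrier
  conv p f zero    = 0#
  conv p f (suc n) = p 0 * f n + conv (p ∘ suc) f n

  conv-[1/u-] : ∀ p z f n → conv p ([1/u- z ] f) (suc n) ≈ z * conv p ([1/u- z ] f) n + conv p f n
  conv-[1/u-] p z f zero    = solve 2 (λ p z → p :* con (+ 0) :+ con (+ 0) := z :* con (+ 0) :+ con (+ 0)) refl (p 0) z
  conv-[1/u-] p z f (suc n) = begin
    p 0 * (z * g n + f n) + conv (p ∘ suc) g (suc n)
      ≈⟨ +-congˡ (conv-[1/u-] (p ∘ suc) z f n) ⟩
    p 0 * (z * g n + f n) + (z * conv (p ∘ suc) g n + conv (p ∘ suc) f n)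
      ≈⟨ solve 6 (λ p z g f x y → p :* (z :* g :+ f) :+ (z :* x :+ y) := z :* (p :* g :+ x) :+ (p :* f :+ y))
           refl (p 0) z (g n) (f n) (conv (p ∘ suc) g n) (conv (p ∘ suc) f n) ⟩
    z * (p 0 * g n + conv (p ∘ suc) g n) + (p 0 * f n + conv (p ∘ suc) f n) ∎
    where g = [1/u- z ] f

  conv-◁ : ∀ p w f n → f 0 ≈ 0# → conv p (f ◁ w) n ≈ conv p f (suc n) - w * conv p f n
  conv-◁ p w f zero    f₀ = sym (begin
    (p 0 * f 0 + 0#) - w * 0#   ≈⟨ +-congʳ (+-congʳ (*-congˡ f₀)) ⟩
    (p 0 * 0# + 0#) - w * 0#    ≈⟨ solve 2 (λ p w → (p :* con (+ 0) :+ con (+ 0)) :- w :* con (+ 0) := con (+ 0)) refl (p 0) w ⟩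
    0#                          ∎)
  conv-◁ p w f (suc n) f₀ = begin
    p 0 * (f (suc n) - w * f n) + conv (p ∘ suc) (f ◁ w) n
      ≈⟨ +-congˡ (conv-◁ (p ∘ suc) w f n f₀) ⟩
    p 0 * (f (suc n) - w * f n) + (conv (p ∘ suc) f (suc n) - w * conv (p ∘ suc) f n)
      ≈⟨ solve 6 (λ p x w y a b → p :* (x :- w :* y) :+ (a :- w :* b) := (p :* x :+ a) :- w :* (p :* y :+ b))
           refl (p 0) (f (suc n)) w (f n) (conv (p ∘ suc) f (suc n)) (conv (p ∘ suc) f n) ⟩
    (p 0 * f (suc n) + conv (p ∘ suc) f (suc n)) - w * (p 0 * f n + conv (p ∘ suc) f n) ∎

  conv-+ : ∀ p q f n → conv (λ i → p i + q i) f n ≈ conv p f n + conv q f n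
  conv-+ p q f zero    = sym (+-identityˡ 0#)
  conv-+ p q f (suc n) = trans (+-congˡ (conv-+ (p ∘ suc) (q ∘ suc) f n))
    (solve 5 (λ p q f x y → (p :+ q) :* f :+ (x :+ y) := (p :* f :+ x) :+ (q :* f :+ y))
      refl (p 0) (q 0) (f n) (conv (p ∘ suc) f n) (conv (q ∘ suc) f n))

  conv-*ˡ : ∀ x p f n → conv (λ i → x * p i) f n ≈ x * conv p f n
  conv-*ˡ x p f zero    = sym (zeroʳ x)
  conv-*ˡ x p f (suc n) = trans (+-congˡ (conv-*ˡ x (p ∘ suc) f n))
    (solve 4 (λ x p f y → (x :* p) :* f :+ x :* y := x :* (p :* f :+ y)) refl x (p 0) (f n) (conv (p ∘ suc) f n))

  conv-cong : ∀ {p q} f n → p ≐ q → conv p f n ≈ conv q f n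
  conv-cong f zero    p≐q = refl
  conv-cong f (suc n) p≐q = +-cong (*-congʳ (p≐q 0)) (conv-cong f n (p≐q ∘ suc))

  powers : Carrier → Seq
  powers z i = z ^ suc i

  conv-powers : ∀ z f n → conv (powers z) f (suc n) ≈ z * f n + z * conv (powers z) f n
  conv-powers z f n = +-cong (*-congʳ (*-identityʳ z)) (conv-*ˡ z (powers z) f n)

  -- u^m f, expanded in powers of 1/u, satisfies Newton's identities for
  -- the power sums p₀, p₁, … (pᵢ has degree i + 1).
  Newton : ℕ → Seq → Seq → Set e
  Newton m p f = ∀ n → (n · 1#) * f n ≈ (m · 1#) * f n + conv p f n

  Newton-cong : ∀ {m p q f} → p ≐ q → Newton m p f → Newton m q f
  Newton-cong {f = f} p≐q nf n = trans (nf n) (+-congˡ (conv-cong f n p≐q))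

  conv-zeroˡ : ∀ f n → conv (const 0#) f n ≈ 0#
  conv-zeroˡ f zero    = refl
  conv-zeroˡ f (suc n) = trans (+-cong (zeroˡ (f n)) (conv-zeroˡ f n)) (+-identityˡ 0#)

  Newton-δ : Newton 0 (const 0#) δ
  Newton-δ zero    = solve 0 (con (+ 0) :* con (+ 1) := con (+ 0) :* con (+ 1) :+ con (+ 0)) refl
  Newton-δ (suc n) = begin
    (suc n · 1#) * 0#          ≈⟨ zeroʳ _ ⟩
    0#                         ≈⟨ zeroˡ 0# ⟨
    0# * 0#                    ≈⟨ +-identityʳ _ ⟨
    0# * 0# + 0#               ≈⟨ +-congˡ (conv-zeroˡ δ (suc n)) ⟨
    0# * 0# + conv (const 0#) δ (suc n) ∎

  -- Newton's identities say that -u f′ / f = m + Σ pᵢ u⁻ⁱ⁻¹. The factor 1 / (u - z) adds u / (u -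
  -- z) = 1 + Σ zⁱ⁺¹ u⁻ⁱ⁻¹ to this logarithmic derivative, hence the increase of `m`.
  Newton-[1/u-] : ∀ {m p f} z → Newton m p f → Newton (suc m) (λ i → p i + powers z i) ([1/u- z ] f)
  Newton-[1/u-] {m} {p} {f} z nf = go
    where
    g = [1/u- z ] f
    P = conv p g
    Z = conv (powers z) g

    go : Newton (suc m) (λ i → p i + powers z i) g
    go zero    = solve 1 (λ m → con (+ 0) :* con (+ 0) := (con (+ 1) :+ m) :* con (+ 0) :+ con (+ 0)) refl (m · 1#)
    go (suc n) = begin
      (1# + N) * (z * g n + f n)
        ≈⟨ solve 4 (λ N z g f → (con (+ 1) :+ N) :* (z :* g :+ f) := z :* (N :* g) :+ (z :* g :+ (N :* f :+ f))) refl N z (g n) (f n) ⟩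
      z * (N * g n) + (z * g n + (N * f n + f n))
        ≈⟨ +-cong (*-congˡ (trans (go n) (+-congˡ (conv-+ p (powers z) g n)))) (+-congˡ (+-congʳ (nf n))) ⟩
      z * ((1# + m′) * g n + (P n + Z n)) + (z * g n + ((m′ * f n + conv p f n) + f n))
        ≈⟨ solve 7 (λ m z g f P Z Q → z :* ((con (+ 1) :+ m) :* g :+ (P :+ Z)) :+ (z :* g :+ ((m :* f :+ Q) :+ f))
                                  := (con (+ 1) :+ m) :* (z :* g :+ f) :+ ((z :* P :+ Q) :+ (z :* g :+ z :* Z)))
             refl m′ z (g n) (f n) (P n) (Z n) (conv p f n) ⟩
      (1# + m′) * g (suc n) + ((z * P n + conv p f n) + (z * g n + z * Z n))
        ≈⟨ +-congˡ (+-cong (conv-[1/u-] p z f n) (conv-powers z g n)) ⟨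
      (1# + m′) * g (suc n) + (P (suc n) + Z (suc n))
        ≈⟨ +-congˡ (conv-+ p (powers z) g (suc n)) ⟨
      (1# + m′) * g (suc n) + conv (λ i → p i + powers z i) g (suc n) ∎
      where
      N = n · 1#
      m′ = m · 1#

  -- The factor u - w subtracts u / (u - w) from the logarithmic derivative. With f₀ = 0 the product
  -- has no term in u, so truncation loses nothing.
  Newton-◁ : ∀ {m p f} w → f 0 ≈ 0# → Newton (suc m) p f → Newton m (λ i → p i - powers w i) (f ◁ w)
  Newton-◁ {m} {p} {f} w f₀ nf n = begin
    N * (f (suc n) - w * f n)
      ≈⟨ solve 4 (λ N x w y → N :* (x :- w :* y) := ((con (+ 1) :+ N) :* x :- x) :- w :* (N :* y)) refl N (f (suc n)) w (f n) ⟩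
    ((1# + N) * f (suc n) - f (suc n)) - w * (N * f n)
      ≈⟨ +-cong (+-congʳ (nf (suc n))) (-‿cong (*-congˡ (nf n))) ⟩
    (((1# + m′) * f (suc n) + Q (suc n)) - f (suc n)) - w * ((1# + m′) * f n + Q n)
      ≈⟨ solve 6 (λ m x q w y r → (((con (+ 1) :+ m) :* x :+ q) :- x) :- w :* ((con (+ 1) :+ m) :* y :+ r)
                               := m :* (x :- w :* y) :+ ((q :- w :* r) :- w :* y))
           refl m′ (f (suc n)) (Q (suc n)) w (f n) (Q n) ⟩
    m′ * (f ◁ w) n + ((Q (suc n) - w * Q n) - w * f n)
      ≈⟨ +-congˡ (+-cong (conv-◁ p w f n f₀) conv-minus-powers) ⟨
    m′ * (f ◁ w) n + (conv p (f ◁ w) n + conv (λ i → - powers w i) (f ◁ w) n)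
      ≈⟨ +-congˡ (conv-+ p (λ i → - powers w i) (f ◁ w) n) ⟨
    m′ * (f ◁ w) n + conv (λ i → p i - powers w i) (f ◁ w) n ∎
    where
    N = n · 1#
    m′ = m · 1#
    Q = conv p f

    conv-minus-powers : conv (λ i → - powers w i) (f ◁ w) n ≈ - (w * f n)
    conv-minus-powers = begin
      conv (λ i → - powers w i) (f ◁ w) n       ≈⟨ conv-cong (f ◁ w) n (λ i → sym (-1*x≈-x (powers w i))) ⟩
      conv (λ i → - 1# * powers w i) (f ◁ w) n  ≈⟨ conv-*ˡ (- 1#) (powers w) (f ◁ w) n ⟩
      - 1# * conv (powers w) (f ◁ w) n          ≈⟨ *-congˡ (conv-◁ (powers w) w f n f₀) ⟩
      - 1# * (conv (powers w) f (suc n) - w * conv (powers w) f n)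
        ≈⟨ *-congˡ (+-congʳ (conv-powers w f n)) ⟩
      - 1# * ((w * f n + w * conv (powers w) f n) - w * conv (powers w) f n)
        ≈⟨ solve 2 (λ x y → :- con (+ 1) :* ((x :+ y) :- y) := :- x) refl (w * f n) (w * conv (powers w) f n) ⟩
      - (w * f n) ∎

  -- Changing the monic polynomials b₀ ⋯ bⱼ₋₁ that index the columns is a
  -- unitriangular column operation.

  actMatrix : ∀ {n} → (Fin n → Seq) → (ℕ → Carrier) → Matrix n
  actMatrix φ b i j = act (toℕ j) b (φ i) 1

  insertAt : ℕ → Carrier → (ℕ → Carrier) → ℕ → Carrier
  insertAt zero    x b zero    = x
  insertAt zero    x b (suc l) = b l
  insertAt (suc m) x b zero    = b 0
  insertAt (suc m) x b (suc l) = insertAt m x (b ∘ suc) l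

  insertAt-< : ∀ m x b l → l ℕ.< m → insertAt m x b l ≡ b l
  insertAt-< (suc m) x b zero    _         = ≡.refl
  insertAt-< (suc m) x b (suc l) (s≤s l<m) = insertAt-< m x (b ∘ suc) l l<m

  insertAt-≡ : ∀ m x b → insertAt m x b m ≡ x
  insertAt-≡ zero    x b = ≡.refl
  insertAt-≡ (suc m) x b = insertAt-≡ m x (b ∘ suc)

  -- For j ≥ m the first j + 1 factors of the new sequence are those of b₀, ..., bⱼ₋₁ together with
  -- u - x. Since u - x = (u - bⱼ) + (bⱼ - x), the result differs from the old one by bⱼ - x times
  -- the product of j factors. For j < m nothing changes.
  act-insertAt : ∀ m x b → Σ[ y ∈ (ℕ → Carrier) ] (∀ j f k →
    act (suc j) (insertAt m x b) f k ≈ act (suc j) b f k + y j * act j b f k)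
  act-insertAt zero x b = (λ j → b j - x) , λ j f k → begin
    act j b (f ◁ x) k                        ≈⟨ act-◁ j b f x k ⟩
    (act j b f ◁ x) k
      ≈⟨ solve 4 (λ p q x y → p :- x :* q := (p :- y :* q) :+ (y :- x) :* q) refl (act j b f (suc k)) (act j b f k) x (b j) ⟩
    (act j b f ◁ b j) k + (b j - x) * act j b f k
      ≈⟨ +-congʳ (act-last j b f k) ⟨
    act (suc j) b f k + (b j - x) * act j b f k ∎
  act-insertAt (suc m) x b with act-insertAt m x (b ∘ suc)
  ... | y , eq = y′ , eq′
    where
    y′ : ℕ → Carrier
    y′ zero    = 0#
    y′ (suc j) = y j
    eq′ : ∀ j f k → act (suc j) (insertAt (suc m) x b) f k ≈ act (suc j) b f k + y′ j * act j b f k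
    eq′ zero    f k = sym (trans (+-congˡ (zeroˡ _)) (+-identityʳ _))
    eq′ (suc j) f k = eq j (f ◁ b 0) k

  det-insertAt : ∀ {n} (φ : Fin n → Seq) m x b → det (actMatrix φ (insertAt m x b)) ≈ det (actMatrix φ b)
  det-insertAt {zero}  φ m x b = refl
  det-insertAt {suc n} φ m x b with act-insertAt m x b
  ... | y , eq = det-bidiagonal (y ∘ toℕ) (actMatrix φ (insertAt m x b)) (actMatrix φ b) (λ i → refl) λ i p →
        trans (eq (toℕ p) (φ i) 1)
          (+-congˡ (*-congˡ (reflexive (≡.cong (λ t → act t b (φ i) 1) (≡.sym (FinP.toℕ-inject₁ p))))))

  -- The entries of `z` are inserted one at a time, each at its final place, which pushes `b` to the
  -- right. After n insertions `b` has left the range that the n columns use.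
  det-actMatrix : ∀ {n} (φ : Fin n → Seq) b z → det (actMatrix φ b) ≈ det (actMatrix φ z)
  det-actMatrix {n} φ b z = trans (sym (inserted n))
    (det-cong λ i j → act-congˡ (toℕ j) (φ i) (λ l l<j → reflexive (prefix≡ n l (ℕP.<-trans l<j (FinP.toℕ<n j)))) 1)
    where
    prefix : ℕ → ℕ → Carrier
    prefix zero    = b
    prefix (suc m) = insertAt m (z m) (prefix m)

    inserted : ∀ m → det (actMatrix φ (prefix m)) ≈ det (actMatrix φ b)
    inserted zero    = refl
    inserted (suc m) = trans (det-insertAt φ m (z m) (prefix m)) (inserted m)

    prefix≡ : ∀ m l → l ℕ.< m → prefix m l ≡ z l
    prefix≡ (suc m) l (s≤s l≤m) with ℕP.m≤n⇒m<n∨m≡n l≤m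
    ... | inj₁ l<m    = ≡.trans (insertAt-< m (z m) (prefix m) l l<m) (prefix≡ m l l<m)
    ... | inj₂ ≡.refl = insertAt-≡ m (z m) (prefix m)

  prod : ℕ → (ℕ → Carrier) → Carrier
  prod n f = product {n} (f ∘ toℕ)

  prod-last : ∀ n f → prod (suc n) f ≈ prod n f * f n
  prod-last zero    f = trans (*-identityʳ _) (sym (*-identityˡ _))
  prod-last (suc n) f = trans (*-congˡ (prod-last n (f ∘ suc))) (sym (*-assoc _ _ _))

  prod-trivial : ∀ k f → (∀ i → f i ≈ 1#) → prod k f ≈ 1#
  prod-trivial zero    f f≈1 = refl
  prod-trivial (suc k) f f≈1 = trans (*-cong (f≈1 0) (prod-trivial k (f ∘ suc) (f≈1 ∘ suc))) (*-identityˡ 1#)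

  prod-extend : ∀ m k f → (∀ i → m ℕ.≤ i → f i ≈ 1#) → prod (m ℕ.+ k) f ≈ prod m f
  prod-extend zero    k f f≈1 = prod-trivial k f (λ i → f≈1 i z≤n)
  prod-extend (suc m) k f f≈1 = *-congˡ (prod-extend m k (f ∘ suc) (λ i m≤i → f≈1 (suc i) (s≤s m≤i)))

  -- Initial products of a fixed sequence, divided by factors at nodes from the same sequence.

  module Beta (β : ℕ → Carrier) where

    -- The factor with the largest index is applied first, in contrast to `act`. An induction on t
    -- thus meets the largest exponent first, which is where the outermost denominator of `ρ` can
    -- cancel.
    desc : ℕ → Seq → Seq
    desc zero    f = f
    desc (suc t) f = desc t (f ◁ β t)

    desc-cong : ∀ t {f g} → f ≐ g → desc t f ≐ desc t g
    desc-cong zero    f≐g = f≐g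
    desc-cong (suc t) f≐g = desc-cong t (◁-cong (β t) f≐g)

    desc-◁ : ∀ t f x → desc t (f ◁ x) ≐ desc t f ◁ x
    desc-◁ zero    f x k = refl
    desc-◁ (suc t) f x k = trans (desc-cong t (◁-comm f x (β t)) k) (desc-◁ t (f ◁ β t) x k)

    desc-act : ∀ t n b f → act n b (desc t f) ≐ desc t (act n b f)
    desc-act t zero    b f k = refl
    desc-act t (suc n) b f k = trans
      (act-cong n (b ∘ suc) (λ l → sym (desc-◁ t f (b 0) l)) k) (desc-act t n (b ∘ suc) (f ◁ b 0) k)

    desc-+ : ∀ j m f → desc (j ℕ.+ m) f ≐ act j (λ l → β (j ℕ.+ m ∸ suc l)) (desc m f)
    desc-+ zero    m f k = refl
    desc-+ (suc j) m f k = trans (desc-+ j m (f ◁ β (j ℕ.+ m)) k)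
      (act-cong j _ (desc-◁ m f (β (j ℕ.+ m))) k)

    act-desc : ∀ n m f → act n (λ l → β (m ℕ.+ l)) (desc m f) ≐ desc (n ℕ.+ m) f
    act-desc zero    m f k = refl
    act-desc (suc n) m f k = begin
      act n (λ l → β (m ℕ.+ suc l)) (desc m f ◁ β (m ℕ.+ 0)) k
        ≈⟨ act-cong n _ (λ l → trans (◁-congʳ (desc m f) (reflexive (≡.cong β (ℕP.+-identityʳ m))) l) (sym (desc-◁ m f (β m) l))) k ⟩
      act n (λ l → β (m ℕ.+ suc l)) (desc (suc m) f) k
        ≈⟨ act-congˡ n (desc (suc m) f) (λ l _ → reflexive (≡.cong β (ℕP.+-suc m l))) k ⟩
      act n (λ l → β (suc m ℕ.+ l)) (desc (suc m) f) k
        ≈⟨ act-desc n (suc m) f k ⟩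
      desc (n ℕ.+ suc m) f k
        ≡⟨ ≡.cong (λ t → desc t f k) (ℕP.+-suc n m) ⟩
      desc (suc n ℕ.+ m) f k ∎

    -- The index intervals [m, m + n) and [0, j + m) cover the same indices, with multiplicity, as
    -- [m, j + m) and [0, n + m). This regrouping separates the part of a matrix entry that depends
    -- on the column from the part that depends on the row.
    act-desc-exchange : ∀ n j m f →
      act n (λ l → β (m ℕ.+ l)) (desc (j ℕ.+ m) f) ≐
      act j (λ l → β (j ℕ.+ m ∸ suc l)) (desc (n ℕ.+ m) f)
    act-desc-exchange n j m f k = begin
      act n (λ l → β (m ℕ.+ l)) (desc (j ℕ.+ m) f) k
        ≈⟨ act-cong n _ (desc-+ j m f) k ⟩
      act n (λ l → β (m ℕ.+ l)) (act j (λ l → β (j ℕ.+ m ∸ suc l)) (desc m f)) k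
        ≈⟨ act-act n j _ _ (desc m f) k ⟩
      act j (λ l → β (j ℕ.+ m ∸ suc l)) (act n (λ l → β (m ℕ.+ l)) (desc m f)) k
        ≈⟨ act-cong j _ (act-desc n m f) k ⟩
      act j (λ l → β (j ℕ.+ m ∸ suc l)) (desc (n ℕ.+ m) f) k ∎

    Lead-desc : ∀ t {p f} → Lead (t ℕ.+ p) f → Lead p (desc t f)
    Lead-desc zero    lead = lead
    Lead-desc (suc t) lead = Lead-desc t (Lead-◁ (β t) lead)

    -- The nodes of the diagram with n rows r, shifted so that all
    -- exponents are natural numbers.
    nodes : ℕ → (ℕ → ℕ) → ℕ → Carrier
    nodes n r i = β (r i ℕ.+ (n ∸ suc i))

    TailZero : Seq → Set e
    TailZero f = ∀ k → f (suc k) ≈ 0#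

    TailZero-◁ : ∀ {f} b → TailZero f → TailZero (f ◁ b)
    TailZero-◁ b f₊≈0 k = trans (+-cong (f₊≈0 (suc k)) (-‿cong (trans (*-congˡ (f₊≈0 k)) (zeroʳ b)))) (-‿inverseʳ 0#)

    TailZero-desc : ∀ t {f} → TailZero f → TailZero (desc t f)
    TailZero-desc zero    tz = tz
    TailZero-desc (suc t) {f} tz = TailZero-desc t (TailZero-◁ {f} (β t) tz)

    Antitone : (ℕ → ℕ) → Set
    Antitone r = ∀ i → r (suc i) ℕ.≤ r i

    -- All nodes are among β₀, ..., βₜ₋₁, at different exponents because r is antitone, so the
    -- quotient is a polynomial. Going down from the top, a factor either equals the largest
    -- remaining node and cancels, or lies above all of them and is spare.
    desc-vanish : ∀ t n r → Antitone r → r 0 ℕ.+ n ℕ.≤ t → TailZero (desc t (ρ n (nodes n r)))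
    desc-vanish t zero r anti le = TailZero-desc t {δ} (λ k → refl)
    desc-vanish zero (suc n) r anti le = contradiction (≡.subst (ℕ._≤ 0) (ℕP.+-suc (r 0) n) le) λ ()
    desc-vanish (suc t) (suc n) r anti le with ℕP.m≤n⇒m<n∨m≡n (ℕP.≤-pred (≡.subst (ℕ._≤ suc t) (ℕP.+-suc (r 0) n) le))
    ... | inj₁ r+n<t = λ k → trans (desc-◁ t _ (β t) (suc k))
            (TailZero-◁ {desc t (ρ (suc n) (nodes (suc n) r))} (β t) (desc-vanish t (suc n) r anti (≡.subst (ℕ._≤ t) (≡.sym (ℕP.+-suc (r 0) n)) r+n<t)) k)
    ... | inj₂ ≡.refl = λ k → trans (desc-cong t ([1/u-]-◁ (β (r 0 ℕ.+ n)) _) (suc k))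
            (desc-vanish t n (r ∘ suc) (anti ∘ suc) (ℕP.+-monoˡ-≤ n (anti 0)) k)

    -- γ enumerates the exponents below r 0 + n that are missing from the
    -- nodes of rows 1, …, n.
    desc-complement : ∀ n r x (γ : ℕ → Carrier) → Antitone r → r (suc n) ≡ 0 →
      (∀ i j → i ℕ.≤ n → r (suc i) ℕ.≤ j → j ℕ.< r i → γ j ≈ β (j ℕ.+ (n ∸ i))) →
      ∀ k → desc (r 0 ℕ.+ n) ([1/u- x ] (ρ n (nodes n (r ∘ suc)))) (suc k) ≈ prod (r 0) (λ j → x - γ j) * x ^ k
    desc-complement n r x γ anti last gap = ≡.subst claim (ℕP.m∸n+n≡m (anti 0)) (climb (r 0 ∸ r 1) (ℕP.≤-reflexive (ℕP.m∸n+n≡m (anti 0))))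
      where
      F = [1/u- x ] (ρ n (nodes n (r ∘ suc)))

      -- The whole tail is described, not only the coefficient of 1/u, since multiplication by the
      -- next factor mixes consecutive coefficients. P(u) / (u - x) has fractional part P(x) / (u -
      -- x), with coefficients P(x) xᵏ.
      claim : ℕ → Set e
      claim s = ∀ k → desc (s ℕ.+ n) F (suc k) ≈ prod s (λ j → x - γ j) * x ^ k

      powers-δ : ∀ k → [1/u- x ] δ (suc k) ≈ 1# * x ^ k
      powers-δ zero    = solve 1 (λ x → x :* con (+ 0) :+ con (+ 1) := con (+ 1) :* con (+ 1)) refl x
      powers-δ (suc k) = trans (+-congʳ (*-congˡ (powers-δ k)))
        (solve 2 (λ x y → x :* (con (+ 1) :* y) :+ con (+ 0) := con (+ 1) :* (x :* y)) refl x (x ^ k))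

      -- Here the top factor is the node of row 1 and cancels. If no row is left, only 1 / (u - x)
      -- remains.
      base : ∀ m → m ≡ n → claim (r 1)
      base zero ≡.refl = ≡.subst claim (≡.sym last) powers-δ
      base (suc m) ≡.refl k = begin
        desc (r 1 ℕ.+ suc m) F (suc k)
          ≡⟨ ≡.cong (λ t → desc t F (suc k)) (ℕP.+-suc (r 1) m) ⟩
        desc (r 1 ℕ.+ m) (F ◁ β (r 1 ℕ.+ m)) (suc k)
          ≈⟨ desc-cong (r 1 ℕ.+ m) (λ l → trans (sym ([1/u-]-◁-comm x (β (r 1 ℕ.+ m)) refl l))
               ([1/u-]-cong x ([1/u-]-◁ (β (r 1 ℕ.+ m)) _) l)) (suc k) ⟩
        desc (r 1 ℕ.+ m) ([1/u- x ] (ρ m (nodes m (λ i → r (2 ℕ.+ i))))) (suc k)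
          ≈⟨ desc-complement m (r ∘ suc) x γ (anti ∘ suc) last (λ i j i≤m → gap (suc i) j (s≤s i≤m)) k ⟩
        prod (r 1) (λ j → x - γ j) * x ^ k ∎

      climb : ∀ d → d ℕ.+ r 1 ℕ.≤ r 0 → claim (d ℕ.+ r 1)
      climb zero    _  k = base n ≡.refl k
      climb (suc d) le k = begin
        desc (s ℕ.+ n) (F ◁ y) (suc k)                ≈⟨ desc-◁ (s ℕ.+ n) F y (suc k) ⟩
        desc (s ℕ.+ n) F (2 ℕ.+ k) - y * desc (s ℕ.+ n) F (suc k)
          ≈⟨ +-cong (IH (suc k)) (-‿cong (*-congˡ (IH k))) ⟩
        P * (x * x ^ k) - y * (P * x ^ k)
          ≈⟨ solve 4 (λ P x w y → P :* (x :* w) :- y :* (P :* w) := (P :* (x :- y)) :* w) refl P x (x ^ k) y ⟩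
        (P * (x - y)) * x ^ k
          ≈⟨ *-congʳ (*-congˡ (+-congˡ (-‿cong (sym (gap 0 s z≤n (ℕP.m≤n+m (r 1) d) le))))) ⟩
        (P * (x - γ s)) * x ^ k
          ≈⟨ *-congʳ (sym (prod-last s (λ j → x - γ j))) ⟩
        prod (suc s) (λ j → x - γ j) * x ^ k          ∎
        where
        s = d ℕ.+ r 1
        y = β (s ℕ.+ n)
        P = prod s (λ j → x - γ j)
        IH = climb d (ℕP.<⇒≤ le)

-- Rows, columns and diagonal of a diagram.

nth-antitone : ∀ {xs} → Linked _≥_ xs → ∀ i → nth xs (suc i) ≤ nth xs i
nth-antitone []            i       = z≤n
nth-antitone [-]           zero    = z≤n
nth-antitone [-]           (suc i) = z≤n
nth-antitone (x≥y ∷ link)  zero    = x≥y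
nth-antitone (x≥y ∷ link)  (suc i) = nth-antitone link i

antitone-≤ : ∀ {r : ℕ → ℕ} → (∀ i → r (suc i) ≤ r i) → ∀ {i k} → i ≤ k → r k ≤ r i
antitone-≤ {r} anti {i} i≤k = ≡.subst (λ k → r k ≤ r i) (ℕP.m∸n+n≡m i≤k) (go _)
  where
  go : ∀ d → r (d ℕ.+ i) ≤ r i
  go zero    = ℕP.≤-refl
  go (suc d) = ℕP.≤-trans (anti (d ℕ.+ i)) (go d)

nth-beyond : ∀ xs {i} → length xs ≤ i → nth xs i ≡ 0
nth-beyond []       _         = ≡.refl
nth-beyond (x ∷ xs) (s≤s le) = nth-beyond xs le

nth-<-length : ∀ xs {i} → 0 < nth xs i → i < length xs
nth-<-length xs {i} 0<nth = ℕP.≰⇒> λ le → ℕP.<-irrefl (≡.sym (nth-beyond xs le)) 0<nth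

nth-applyUpTo : ∀ f n {i} → i < n → nth (applyUpTo f n) i ≡ f i
nth-applyUpTo f (suc n) {zero}  _         = ≡.refl
nth-applyUpTo f (suc n) {suc i} (s≤s i<n) = nth-applyUpTo (f ∘ suc) n i<n

-- As P passes from an entry to the one before it, `filter` keeps an initial segment, and its length
-- locates the positions where P holds. Column lengths and the length of the diagonal are both of
-- this kind.
length-filter-prefix : ∀ {p} {P : ℕ → Set p} (P? : Decidable P) {xs} →
  Linked (λ x y → P y → P x) xs → ∀ i →
  i < length (filter P? xs) ⇔ (i < length xs × P (nth xs i))
length-filter-prefix P? {[]} link i = mk⇔ (λ ()) (λ ())
length-filter-prefix {P = P} P? {x ∷ xs} link i with P? x
... | yes Px = with-head i
  where
  tail⇔ = length-filter-prefix P? (Linked.tail link)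
  with-head : ∀ i → i < suc (length (filter P? xs)) ⇔ (i < suc (length xs) × P (nth (x ∷ xs) i))
  with-head zero    = mk⇔ (λ _ → s≤s z≤n , Px) (λ _ → s≤s z≤n)
  with-head (suc i) = mk⇔
    (λ { (s≤s lt) → let (i<n , Pi) = Equivalence.to (tail⇔ i) lt in s≤s i<n , Pi })
    (λ { (s≤s i<n , Pi) → s≤s (Equivalence.from (tail⇔ i) (i<n , Pi)) })
... | no ¬Px = mk⇔
    (λ lt → let (i<n , Pi) = Equivalence.to (length-filter-prefix P? (Linked.tail link) i) lt
            in contradiction Pi (never link ¬Px (suc i) (s≤s i<n)))
    (λ { (i<n , Pi) → contradiction Pi (never link ¬Px i i<n) })
  where
  never : ∀ {x xs} → Linked (λ x y → P y → P x) (x ∷ xs) → ¬ P x → ∀ i → i < suc (length xs) → ¬ P (nth (x ∷ xs) i)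
  never link         ¬Px zero    _             = ¬Px
  never (cl ∷ link)  ¬Px (suc i) (s≤s i<n)     = never link (¬Px ∘ cl) i i<n
  never [-]          ¬Px (suc i) (s≤s ())

module _ (μ : Diagram) where

  rows : ℕ → ℕ
  rows = nth (parts μ)

  cols : ℕ → ℕ
  cols j = col μ (suc j)

  rows-antitone : ∀ i → rows (suc i) ≤ rows i
  rows-antitone = nth-antitone (decreasing μ)

  cols-rows : ∀ i j → i < cols j ⇔ j < rows i
  cols-rows i j = mk⇔
    (proj₂ ∘ Equivalence.to iff)
    (λ j<r → Equivalence.from iff (nth-<-length (parts μ) (ℕP.≤-trans (s≤s z≤n) j<r) , j<r))
    where
    iff = length-filter-prefix (suc j ℕP.≤?_)
            (Linked.map (λ x≥y j<y → ℕP.≤-trans j<y x≥y) (decreasing μ)) i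

  diagonal-rows : ∀ i → i < diagonal μ ⇔ i < rows i
  diagonal-rows i = mk⇔
    (λ i<d → let (i<n , lt) = Equivalence.to iff i<d in
             ≡.subst (λ k → k < rows k) (nth-applyUpTo id (ℓ μ) (upTo< i<n)) lt)
    (λ i<r → let i<ℓ = nth-<-length (parts μ) (ℕP.≤-trans (s≤s z≤n) i<r) in
             Equivalence.from iff
               ( ≡.subst (i <_) (≡.sym (ListP.length-upTo (ℓ μ))) i<ℓ
               , ≡.subst (λ k → k < rows k) (≡.sym (nth-applyUpTo id (ℓ μ) i<ℓ)) i<r))
    where
    upTo< : ∀ {i} → i < length (upTo (ℓ μ)) → i < ℓ μ
    upTo< = ≡.subst (_ <_) (ListP.length-upTo (ℓ μ))
    iff = length-filter-prefix (λ i → suc i ℕP.≤? row μ (suc i))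
            (LinkedP.applyUpTo⁺₂ id (ℓ μ) (λ k lt → ℕP.≤-trans (ℕP.n≤1+n _) (ℕP.≤-trans lt (rows-antitone k)))) i

-- If no entry of xs exceeds the corresponding entry of ys, then ys contains xs as a diagram and has
-- more boxes unless they coincide. Positivity excludes lists that differ by trailing zeros.
sum-nth-compare : ∀ {xs ys} → All NonZero xs → All NonZero ys →
  (∃[ i ] nth ys i < nth xs i) ⊎ xs ≡ ys ⊎ ℕList.sum xs < ℕList.sum ys
sum-nth-compare [] [] = inj₂ (inj₁ ≡.refl)
sum-nth-compare [] (_∷_ {x = suc y} _ _) = inj₂ (inj₂ (s≤s z≤n))
sum-nth-compare (_∷_ {x = suc x} _ _) [] = inj₁ (0 , s≤s z≤n)
sum-nth-compare (_∷_ {x = x} px pxs) (_∷_ {x = y} py pys) with y ℕP.<? x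
... | yes y<x = inj₁ (0 , y<x)
... | no  y≮x with sum-nth-compare pxs pys
...   | inj₁ (i , lt)     = inj₁ (suc i , lt)
...   | inj₂ (inj₂ sum<)  = inj₂ (inj₂ (ℕP.+-mono-≤-< (ℕP.≮⇒≥ y≮x) sum<))
...   | inj₂ (inj₁ ≡.refl) with ℕP.m≤n⇒m<n∨m≡n (ℕP.≮⇒≥ y≮x)
...     | inj₁ x<y    = inj₂ (inj₂ (ℕP.+-monoˡ-< _ x<y))
...     | inj₂ ≡.refl = inj₂ (inj₁ ≡.refl)

noncontained-row : ∀ {μ ν} → ν ≢ᴰ μ → ∣ ν ∣ ≤ ∣ μ ∣ → ∃[ i ] rows ν i < rows μ i
noncontained-row {μ} {ν} ν≢μ ν≤μ with sum-nth-compare (positive μ) (positive ν)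
... | inj₁ found        = found
... | inj₂ (inj₁ eq)    = contradiction (≡.sym eq) ν≢μ
... | inj₂ (inj₂ μ<ν)   = contradiction ν≤μ (ℕP.<⇒≱ μ<ν)

suc-suc : ∀ m n → + suc m ℤ.- + suc n ≡ + m ℤ.- + n
suc-suc m n = ≡.trans (ℤP.m-n≡m⊖n (suc m) (suc n)) (≡.trans (ℤP.[1+m]⊖[1+n]≡m⊖n m n) (≡.sym (ℤP.m-n≡m⊖n m n)))

suc-<-∸1 : ∀ m n → m < n ∸ 1 ⇔ suc m < n
suc-<-∸1 m zero    = mk⇔ (λ ()) (λ ())
suc-<-∸1 m (suc n) = mk⇔ s≤s ℕP.≤-pred

≮⇒≡0 : ∀ {n} → ¬ 0 < n → n ≡ 0
≮⇒≡0 {zero}  _  = ≡.refl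
≮⇒≡0 {suc n} n≮ = contradiction (s≤s z≤n) n≮

-- Sums over ranges, and sums over Frobenius coordinates.

module RangeSums {c e} (R : CommutativeRing c e) where
  open CommutativeRing R hiding (zero)
  open SemiringSum semiring
  open DeterminantProperties R using (sum-zero)
  open IntegerSolver R
  open import Relation.Binary.Reasoning.Setoid setoid

  ∑< : ℕ → (ℕ → Carrier) → Carrier
  ∑< n f = sum {n} (f ∘ toℕ)

  ∑<-cong : ∀ n {f g} → (∀ i → i < n → f i ≈ g i) → ∑< n f ≈ ∑< n g
  ∑<-cong n f≈g = sum-cong-≋ {n} λ i → f≈g (toℕ i) (FinP.toℕ<n i)

  ∑<-last : ∀ n f → ∑< (suc n) f ≈ ∑< n f + f n
  ∑<-last zero    f = trans (+-identityʳ _) (sym (+-identityˡ _))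
  ∑<-last (suc n) f = trans (+-congˡ (∑<-last n (f ∘ suc))) (sym (+-assoc _ _ _))

  ∑<-extend : ∀ m k f → (∀ i → m ≤ i → f i ≈ 0#) → ∑< (m ℕ.+ k) f ≈ ∑< m f
  ∑<-extend zero    k f f≈0 = sum-zero {k} (λ i → f≈0 (toℕ i) z≤n)
  ∑<-extend (suc m) k f f≈0 = +-congˡ (∑<-extend m k (f ∘ suc) (λ i m≤i → f≈0 (suc i) (s≤s m≤i)))

  ∑<-reverse : ∀ n f → ∑< n (λ i → f (n ∸ suc i)) ≈ ∑< n f
  ∑<-reverse zero    f = refl
  ∑<-reverse (suc n) f = trans (+-congˡ (∑<-reverse n f)) (trans (+-comm _ _) (sym (∑<-last n f)))

  ∑<-telescope : ∀ n (x G : ℕ → Carrier) →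
    ∑< n (λ i → x i - G i) - G n ≈ ∑< n (λ i → x i - G (suc i)) - G 0
  ∑<-telescope zero    x G = refl
  ∑<-telescope (suc n) x G = begin
    (x 0 - G 0 + A) - G (suc n)        ≈⟨ solve 4 (λ x g a h → ((x :- g) :+ a) :- h := (x :- g) :+ (a :- h)) refl (x 0) (G 0) A (G (suc n)) ⟩
    (x 0 - G 0) + (A - G (suc n))      ≈⟨ +-congˡ (∑<-telescope n (x ∘ suc) (G ∘ suc)) ⟩
    (x 0 - G 0) + (B - G 1)            ≈⟨ solve 4 (λ x g b h → (x :- g) :+ (b :- h) := ((x :- h) :+ b) :- g) refl (x 0) (G 0) B (G 1) ⟩
    (x 0 - G 1 + B) - G 0              ∎
    where
    A = ∑< n (λ i → x (suc i) - G (suc i))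
    B = ∑< n (λ i → x (suc i) - G (suc (suc i)))

  -- Induction on the number of diagonal boxes: removing the first
  -- principal hook replaces rᵢ by rᵢ₊₁ - 1 and cⱼ by cⱼ₊₁ - 1.
  hook-sum : (g : ℤ → Carrier) → ∀ d m (r c : ℕ → ℕ) → (∀ i → r (suc i) ≤ r i) →
    (∀ i j → i < c j ⇔ j < r i) → (∀ i → i < d ⇔ i < r i) → r m ≡ 0 →
    ∑< d (λ i → g (+ r i ℤ.- + i) - g (+ suc i ℤ.- + c i)) ≈
    ∑< m (λ i → g (+ r i ℤ.- + i) - g (ℤ.- + i))
  hook-sum g zero    m r c anti cr dr rm = sym (sum-zero {m} λ i → begin
    g (+ r (toℕ i) ℤ.- + toℕ i) - g (ℤ.- + toℕ i)
      ≡⟨ ≡.cong (λ k → g (+ k ℤ.- + toℕ i) - g (ℤ.- + toℕ i)) (r≡0 (toℕ i)) ⟩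
    g (+ 0 ℤ.- + toℕ i) - g (ℤ.- + toℕ i)
      ≡⟨ ≡.cong (λ k → g k - g (ℤ.- + toℕ i)) (ℤP.+-identityˡ _) ⟩
    g (ℤ.- + toℕ i) - g (ℤ.- + toℕ i)
      ≈⟨ -‿inverseʳ _ ⟩
    0# ∎)
    where
    r≡0 : ∀ i → r i ≡ 0
    r≡0 i = ≮⇒≡0 λ 0<r → contradiction (Equivalence.from (dr 0) (ℕP.≤-trans 0<r (antitone-≤ anti z≤n))) λ ()
  hook-sum g (suc d) m r c anti cr dr rm = begin
    (X 0 - Y 0) + ∑< d (λ i → X (suc i) - Y (suc i))
      ≈⟨ +-cong (+-congˡ (-‿cong (reflexive (≡.cong (λ k → g (+ 1 ℤ.- + k)) c₀≡))))
                (trans (∑<-cong d X-Y) (trans (hook-sum g d m′ r′ c′ anti′ cr′ dr′ rm′) (∑<-cong m′ X-G))) ⟩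
    (X 0 - g (+ 1 ℤ.- + suc m′)) + ∑< m′ (λ i → X (suc i) - G i)
      ≈⟨ +-congʳ (+-congˡ (-‿cong (reflexive (≡.cong g (≡.trans (suc-suc 0 m′) (ℤP.+-identityˡ _)))))) ⟩
    (X 0 - G m′) + ∑< m′ (λ i → X (suc i) - G i)
      ≈⟨ solve 3 (λ x h s → (x :- h) :+ s := x :+ (s :- h)) refl (X 0) (G m′) (∑< m′ (λ i → X (suc i) - G i)) ⟩
    X 0 + (∑< m′ (λ i → X (suc i) - G i) - G m′)
      ≈⟨ +-congˡ (∑<-telescope m′ (X ∘ suc) G) ⟩
    X 0 + (∑< m′ (λ i → X (suc i) - G (suc i)) - G 0)
      ≈⟨ solve 3 (λ x h s → x :+ (s :- h) := (x :- h) :+ s) refl (X 0) (G 0) (∑< m′ (λ i → X (suc i) - G (suc i))) ⟩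
    ∑< (suc m′) (λ i → X i - G i)
      ≈⟨ ∑<-extend (suc m′) (m ∸ suc m′) (λ i → X i - G i) beyond ⟨
    ∑< (suc m′ ℕ.+ (m ∸ suc m′)) (λ i → X i - G i)
      ≡⟨ ≡.cong (λ k → ∑< k (λ i → X i - G i)) (ℕP.m+[n∸m]≡n m′<m) ⟩
    ∑< m (λ i → X i - G i) ∎
    where
    X Y G : ℕ → Carrier
    X i = g (+ r i ℤ.- + i)
    Y i = g (+ suc i ℤ.- + c i)
    G i = g (ℤ.- + i)

    0<r₀ : 0 < r 0
    0<r₀ = Equivalence.to (dr 0) (s≤s z≤n)

    -- Without its first hook the diagram has at most `m′` nonempty rows. The leg of that hook
    -- contributes g (1 - c₀) = g (-m′), which is the boundary term `G m′` of the telescoping sum.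
    m′ = c 0 ∸ 1

    c₀≡ : c 0 ≡ suc m′
    c₀≡ = ≡.sym (ℕP.m+[n∸m]≡n (Equivalence.from (cr 0 0) 0<r₀))

    r′ c′ : ℕ → ℕ
    r′ i = r (suc i) ∸ 1
    c′ j = c (suc j) ∸ 1

    anti′ : ∀ i → r′ (suc i) ≤ r′ i
    anti′ i = ℕP.∸-monoˡ-≤ 1 (anti (suc i))

    cr′ : ∀ i j → i < c′ j ⇔ j < r′ i
    cr′ i j = mk⇔
      (Equivalence.from (suc-<-∸1 j _) ∘ Equivalence.to (cr (suc i) (suc j)) ∘ Equivalence.to (suc-<-∸1 i _))
      (Equivalence.from (suc-<-∸1 i _) ∘ Equivalence.from (cr (suc i) (suc j)) ∘ Equivalence.to (suc-<-∸1 j _))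

    dr′ : ∀ i → i < d ⇔ i < r′ i
    dr′ i = mk⇔
      (Equivalence.from (suc-<-∸1 i _) ∘ Equivalence.to (dr (suc i)) ∘ s≤s)
      (ℕP.≤-pred ∘ Equivalence.from (dr (suc i)) ∘ Equivalence.to (suc-<-∸1 i _))

    beyond-c₀ : ∀ i → suc m′ ≤ i → r i ≡ 0
    beyond-c₀ i m′<i = ≮⇒≡0 λ 0<r → contradiction (Equivalence.from (cr i 0) 0<r)
      (ℕP.≤⇒≯ (≡.subst (_≤ i) (≡.sym c₀≡) m′<i))

    rm′ : r′ m′ ≡ 0
    rm′ = ≡.cong (_∸ 1) (beyond-c₀ (suc m′) ℕP.≤-refl)

    m′<m : m′ < m
    m′<m = ℕP.≰⇒> λ m≤m′ → ℕP.<-irrefl (≡.sym rm)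
      (ℕP.≤-trans (Equivalence.to (cr m′ 0) (ℕP.≤-reflexive (≡.sym c₀≡))) (antitone-≤ anti m≤m′))

    beyond : ∀ i → suc m′ ≤ i → X i - G i ≈ 0#
    beyond i m′<i = begin
      X i - G i                     ≡⟨ ≡.cong (λ k → g (+ k ℤ.- + i) - G i) (beyond-c₀ i m′<i) ⟩
      g (+ 0 ℤ.- + i) - G i         ≡⟨ ≡.cong (λ k → g k - G i) (ℤP.+-identityˡ _) ⟩
      G i - G i                     ≈⟨ -‿inverseʳ _ ⟩
      0#                            ∎

    shift : ∀ {k} i → 0 < k → + k ℤ.- + suc i ≡ + (k ∸ 1) ℤ.- + i
    shift {suc k} i _ = suc-suc k i

    shift′ : ∀ {k} i → 0 < k → + suc i ℤ.- + k ≡ + i ℤ.- + (k ∸ 1)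
    shift′ {suc k} i _ = suc-suc i k

    X-Y : ∀ i → i < d → X (suc i) - Y (suc i) ≈ g (+ r′ i ℤ.- + i) - g (+ suc i ℤ.- + c′ i)
    X-Y i i<d = +-cong (reflexive (≡.cong g (shift i (ℕP.≤-trans (s≤s z≤n) i<r))))
                       (-‿cong (reflexive (≡.cong g (shift′ (suc i) (ℕP.≤-trans (s≤s z≤n) (Equivalence.from (cr (suc i) (suc i)) i<r))))))
      where i<r = Equivalence.to (dr (suc i)) (s≤s i<d)

    X-G : ∀ i → i < m′ → g (+ r′ i ℤ.- + i) - G i ≈ X (suc i) - G i
    X-G i i<m′ = +-congʳ (reflexive (≡.cong g (≡.sym (shift i
      (Equivalence.to (cr (suc i) 0) (≡.subst (suc i <_) (≡.sym c₀≡) (s≤s i<m′)))))))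

lookup-zero : ∀ {a} {A : Set a} {n} (v : Vec.Vec A (suc n)) → Vec.lookup v zero ≡ Vec.head v
lookup-zero (x Vec.∷ _) = ≡.refl

-- Newton's identities for products of linear factors.

module NewtonProducts {c e} (R : CommutativeRing c e) where
  open CommutativeRing R hiding (zero)
  open RingProperties ring
  open SequenceOperators R
  open RangeSums R
  open IntegerSolver R
  open SemiringSum semiring
  open import Relation.Binary.Reasoning.Setoid setoid

  conv-sum : ∀ p f n → conv p f n ≈ sum {n} (λ i → p (toℕ i) * f (n ∸ suc (toℕ i)))
  conv-sum p f zero    = refl
  conv-sum p f (suc n) = +-congˡ (conv-sum (p ∘ suc) f n)

  Newton-ρ : ∀ n z → Newton n (λ k → ∑< n (λ i → powers (z i) k)) (ρ n z)
  Newton-ρ zero    z = Newton-δ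
  Newton-ρ (suc n) z = Newton-cong {suc n} {f = ρ (suc n) z} (λ k → +-comm _ _)
    (Newton-[1/u-] {n} {f = ρ n (z ∘ suc)} (z 0) (Newton-ρ n (z ∘ suc)))

  module _ (β : ℕ → Carrier) where
    open Beta β

    Newton-desc : ∀ t {m p f} → Lead (t ℕ.+ m) f → Newton (t ℕ.+ m) p f →
      Newton m (λ k → p k - ∑< t (λ i → powers (β i) k)) (desc t f)
    Newton-desc zero    {m} {p} {f} lead nf = Newton-cong {m} {f = f} (λ k → sym (trans (+-congˡ -0#≈0#) (+-identityʳ _))) nf
    Newton-desc (suc t) {m} {p} {f} lead nf = Newton-cong {m} {f = desc t (f ◁ β t)}
      (λ k → trans (solve 3 (λ p b s → (p :- b) :- s := p :- (s :+ b)) refl (p k) (powers (β t) k) _)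
                   (+-congˡ (-‿cong (sym (∑<-last t (λ i → powers (β i) k))))))
      (Newton-desc t (Lead-◁ (β t) lead) (Newton-◁ {t ℕ.+ m} {f = f} (β t) (proj₁ lead 0 (s≤s z≤n)) nf))

-- Evaluation of complete functions and of their deformations.

module Evaluation {c ℓ₁ ℓ₂} (𝕜 : HeytingField c ℓ₁ ℓ₂) (char0 : CharacteristicZero 𝕜) where
  open SymmetricFunctions 𝕜 char0 hiding (0#; _≈_; det; +-assoc; +-comm; +-cong; *-cong; *-assoc; *-comm; *-identity; +-identity; distrib; -‿cong)
  module Λᴰ = SymmetricFunctions 𝕜 char0
  open CommutativeRing 𝕜-ring hiding (zero)
  open RingProperties ring
  open SemiringSum semiring
  open import Algebra.Definitions.RawSemiring (Semiring.rawSemiring semiring) using (_^_)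
    renaming (_×_ to _·_)
  open Determinant 𝕜-ring using (det)
  open DeterminantProperties 𝕜-ring
  open SequenceOperators 𝕜-ring
  open RangeSums 𝕜-ring
  open NewtonProducts 𝕜-ring
  open IntegerSolver 𝕜-ring renaming (con to conˢ)
  open import Relation.Binary.Reasoning.Setoid setoid

  eval-cong : ∀ {d} (x y : Vector Carrier d) {F G} → F ≈Λ G → eval x y F ≈ eval x y G
  eval-cong x y reflΛ              = refl
  eval-cong x y (symΛ p)           = sym (eval-cong x y p)
  eval-cong x y (transΛ p q)       = trans (eval-cong x y p) (eval-cong x y q)
  eval-cong x y (con-cong p)       = p
  eval-cong x y (Λᴰ.+-cong p q)    = +-cong (eval-cong x y p) (eval-cong x y q)
  eval-cong x y (Λᴰ.*-cong p q)    = *-cong (eval-cong x y p) (eval-cong x y q)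
  eval-cong x y (Λᴰ.-‿cong p)      = -‿cong (eval-cong x y p)
  eval-cong x y (con-+ _ _)        = refl
  eval-cong x y (con-* _ _)        = refl
  eval-cong x y (Λᴰ.+-assoc _ _ _) = +-assoc _ _ _
  eval-cong x y (Λᴰ.+-comm _ _)    = +-comm _ _
  eval-cong x y (Λᴰ.+-identity _)  = +-identityˡ _
  eval-cong x y (Λᴰ.-‿inverse _)   = -‿inverseˡ _
  eval-cong x y (Λᴰ.*-assoc _ _ _) = *-assoc _ _ _
  eval-cong x y (Λᴰ.*-comm _ _)    = *-comm _ _
  eval-cong x y (Λᴰ.*-identity _)  = *-identityˡ _
  eval-cong x y (Λᴰ.distrib _ _ _) = distribˡ _ _ _

  private
    module Λ-det = DeterminantProperties Λ-ring

  eval-sum : ∀ {d} (x y : Vector Carrier d) {n} (G : Fin n → Λ) → eval x y (∑Λ G) ≈ sum (λ i → eval x y (G i))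
  eval-sum x y {zero}  G = refl
  eval-sum x y {suc n} G = +-congˡ (eval-sum x y (G ∘ suc))

  eval-sign : ∀ {d} (x y : Vector Carrier d) {n} (j : Fin n) → eval x y (Λ-det.sign j) ≈ sign j
  eval-sign x y zero    = refl
  eval-sign x y (suc j) = *-congˡ (eval-sign x y j)

  eval-det : ∀ {d} (x y : Vector Carrier d) {n} (M : Fin n → Fin n → Λ) →
    eval x y (Λᴰ.det M) ≈ det (λ i j → eval x y (M i j))
  eval-det x y {zero}  M = refl
  eval-det x y {suc n} M = trans
    (eval-sum x y (λ j → Λ-det.sign j *Λ (M zero j *Λ Λᴰ.det (Λ-det.minor M j))))
    (sum-cong-≋ λ j → *-cong (eval-sign x y j)
      (*-congˡ {eval x y (M zero j)} (eval-det x y (Λ-det.minor M j))))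

  recip-inverse : ∀ k → recip k * (suc k · 1#) ≈ 1#
  recip-inverse k = trans (*-congˡ (sym (trans (+-congˡ -0#≈0#) (+-identityʳ _))))
    (proj₁ (proj₂ (HeytingField.#⇒invertible 𝕜 (char0 k))))

  -- Newton's identities for m = 0 determine a series from its constant term, because n is
  -- invertible for n > 0; `h` is defined by the very same recursion.
  eval-h : ∀ {d} (x y : Vector Carrier d) {f} → f 0 ≈ 1# → Newton 0 (λ k → eval x y 𝐩[1+ k ]) f →
    ∀ n → eval x y (h n) ≈ f n
  eval-h x y {f} f₀ nf n = trans (reflexive (≡.cong (eval x y) (≡.sym (lookup-zero (h↓ n))))) (lookups n zero)
    where
    P : Seq
    P k = eval x y 𝐩[1+ k ]

    lookups : ∀ k (i : Fin (suc k)) → eval x y (Vec.lookup (h↓ k) i) ≈ f (k ∸ toℕ i)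
    lookups zero    zero    = sym f₀
    lookups (suc k) (suc i) = lookups k i
    lookups (suc k) zero    = begin
      recip k * eval x y (∑Λ λ i → 𝐩[1+ toℕ i ] *Λ Vec.lookup (h↓ k) i)
        ≈⟨ *-congˡ (trans (eval-sum x y (λ i → 𝐩[1+ toℕ i ] *Λ Vec.lookup (h↓ k) i))
              (sum-cong-≋ λ i → *-congˡ {P (toℕ i)} (lookups k i))) ⟩
      recip k * sum {suc k} (λ i → P (toℕ i) * f (k ∸ toℕ i))
        ≈⟨ *-congˡ (conv-sum P f (suc k)) ⟨
      recip k * conv P f (suc k)
        ≈⟨ *-congˡ (trans (nf (suc k)) (trans (+-congʳ (zeroˡ _)) (+-identityˡ _))) ⟨
      recip k * ((suc k · 1#) * f (suc k))
        ≈⟨ *-assoc _ _ _ ⟨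
      (recip k * (suc k · 1#)) * f (suc k)
        ≈⟨ trans (*-congʳ (recip-inverse k)) (*-identityˡ _) ⟩
      f (suc k) ∎

  -- The value of `conv c f (suc m)`, summed in the order used by `h⟨_⟩`.
  conv′ : (ℕ → Carrier) → Seq → ℕ → Carrier
  conv′ c f m = ∑< (suc m) (λ i → c (m ∸ i) * f i)

  signed-elementary : ∀ L → (ℕ → Carrier) → ℕ → Carrier
  signed-elementary L b k = (- 1#) ^ k * elementary {L} k (b ∘ toℕ)

  elementary-zero : ∀ L k (x : Fin L → Carrier) → L < k → elementary k x ≈ 0#
  elementary-zero zero    (suc k) x _         = refl
  elementary-zero (suc L) (suc k) x (s≤s L<k) = trans
    (+-cong (trans (*-congˡ (elementary-zero L k (x ∘ suc) L<k)) (zeroʳ _)) (elementary-zero L (suc k) (x ∘ suc) (ℕP.m<n⇒m<1+n L<k)))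
    (+-identityˡ 0#)

  signed-elementary-suc : ∀ L b k → signed-elementary (suc L) b (suc k) ≈
    signed-elementary L (b ∘ suc) (suc k) - b 0 * signed-elementary L (b ∘ suc) k
  signed-elementary-suc L b k =
    solve 4 (λ s b p q → (:- conˢ (+ 1) :* s) :* (b :* p :+ q) := (:- conˢ (+ 1) :* s) :* q :- b :* (s :* p))
      refl ((- 1#) ^ k) (b 0) (elementary {L} k (λ l → b (suc (toℕ l)))) (elementary {L} (suc k) (λ l → b (suc (toℕ l))))

  conv′-elementary-suc : ∀ L b f m → conv′ (signed-elementary (suc L) b) f (suc m) ≈
    conv′ (signed-elementary L (b ∘ suc)) f (suc m) - b 0 * conv′ (signed-elementary L (b ∘ suc)) f m
  conv′-elementary-suc L b f zero = begin
    signed-elementary (suc L) b 1 * f 0 + (signed-elementary L (b ∘ suc) 0 * f 1 + 0#)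
      ≈⟨ +-congʳ (*-congʳ (signed-elementary-suc L b 0)) ⟩
    (s₁ - b 0 * s₀) * f 0 + (s₀ * f 1 + 0#)
      ≈⟨ solve 5 (λ s t b x y → (s :- b :* t) :* x :+ (t :* y :+ conˢ (+ 0)) := (s :* x :+ (t :* y :+ conˢ (+ 0))) :- b :* (t :* x :+ conˢ (+ 0)))
           refl s₁ s₀ (b 0) (f 0) (f 1) ⟩
    (s₁ * f 0 + (s₀ * f 1 + 0#)) - b 0 * (s₀ * f 0 + 0#) ∎
    where
    s₁ = signed-elementary L (b ∘ suc) 1
    s₀ = signed-elementary L (b ∘ suc) 0
  conv′-elementary-suc L b f (suc m) = begin
    signed-elementary (suc L) b (2 ℕ.+ m) * f 0 + conv′ (signed-elementary (suc L) b) (f ∘ suc) (suc m)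
      ≈⟨ +-cong (*-congʳ (signed-elementary-suc L b (suc m))) (conv′-elementary-suc L b (f ∘ suc) m) ⟩
    (s (2 ℕ.+ m) - b 0 * s (suc m)) * f 0 + (conv′ s (f ∘ suc) (suc m) - b 0 * conv′ s (f ∘ suc) m)
      ≈⟨ solve 6 (λ s t b x y z → (s :- b :* t) :* x :+ (y :- b :* z) := (s :* x :+ y) :- b :* (t :* x :+ z))
           refl (s (2 ℕ.+ m)) (s (suc m)) (b 0) (f 0) (conv′ s (f ∘ suc) (suc m)) (conv′ s (f ∘ suc) m) ⟩
    conv′ s f (2 ℕ.+ m) - b 0 * conv′ s f (suc m) ∎
    where s = signed-elementary L (b ∘ suc)

  conv′-◁ : ∀ c f x m → conv′ c (f ∘ suc) m - x * conv′ c f m ≈ conv′ c (f ◁ x) m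
  conv′-◁ c f x zero = solve 4 (λ c f x y → (c :* y :+ conˢ (+ 0)) :- x :* (c :* f :+ conˢ (+ 0)) := c :* (y :- x :* f) :+ conˢ (+ 0))
    refl (c 0) (f 0) x (f 1)
  conv′-◁ c f x (suc m) = trans
    (solve 6 (λ c f x y p q → (c :* y :+ p) :- x :* (c :* f :+ q) := c :* (y :- x :* f) :+ (p :- x :* q))
      refl (c (suc m)) (f 0) x (f 1) (conv′ c (λ l → f (2 ℕ.+ l)) m) (conv′ c (f ∘ suc) m))
    (+-congˡ (conv′-◁ c (f ∘ suc) x m))

  -- Vieta's formula: the signed elementary functions are the coefficients of (u - b₀) ⋯ (u - bₘ₋₁).
  -- For n = 1 it shows that `h⟨ b ⟩ (+ suc m)` is the coefficient of 1/u in such a product times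
  -- H(u).
  act-elementary : ∀ m b f n → act m b f n ≈ conv′ (signed-elementary m b) (f ∘ (n ℕ.+_)) m
  act-elementary zero    b f n = trans (reflexive (≡.cong f (≡.sym (ℕP.+-identityʳ n))))
    (solve 1 (λ x → x := (conˢ (+ 1) :* conˢ (+ 1)) :* x :+ conˢ (+ 0)) refl (f (n ℕ.+ 0)))
  act-elementary (suc m) b f n = sym (begin
    conv′ (signed-elementary (suc m) b) g (suc m)
      ≈⟨ conv′-elementary-suc m b g m ⟩
    conv′ s g (suc m) - b 0 * conv′ s g m
      -- The first summand contains the elementary function of degree m + 1 in m variables, which is
      -- zero.
      ≈⟨ +-congʳ (trans (+-congʳ (trans (*-congʳ (trans (*-congˡ (elementary-zero m (suc m) (λ l → b (suc (toℕ l))) ℕP.≤-refl)) (zeroʳ _))) (zeroˡ _))) (+-identityˡ _)) ⟩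
    conv′ s (g ∘ suc) m - b 0 * conv′ s g m
      ≈⟨ conv′-◁ s g (b 0) m ⟩
    conv′ s (g ◁ b 0) m
      ≈⟨ ∑<-cong (suc m) (λ i _ → *-congˡ {s (m ∸ i)} (+-congʳ { - (b 0 * f (n ℕ.+ i)) } (reflexive (≡.cong f (ℕP.+-suc n i))))) ⟩
    conv′ s ((f ◁ b 0) ∘ (n ℕ.+_)) m
      ≈⟨ act-elementary m (b ∘ suc) (f ◁ b 0) n ⟨
    act m (b ∘ suc) (f ◁ b 0) n ∎)
    where
    g = f ∘ (n ℕ.+_)
    s = signed-elementary m (b ∘ suc)

  eval-h⟨⟩-suc : ∀ {d} (x y : Vector Carrier d) {f} → (∀ n → eval x y (h n) ≈ f n) →
    ∀ b m → eval x y (h⟨ b ⟩ (+ suc m)) ≈ act m (λ l → b (+ suc l)) f 1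
  eval-h⟨⟩-suc x y {f} h≈f b m = begin
    eval x y (h⟨ b ⟩ (+ suc m))
      ≈⟨ eval-sum x y {suc m} (λ i → con (s (m ∸ toℕ i)) *Λ h (pos i)) ⟩
    sum {suc m} (λ i → s (m ∸ toℕ i) * eval x y (h (pos i)))
      ≈⟨ sum-cong-≋ {suc m} (λ i → *-congˡ {s (m ∸ toℕ i)} (h≈f (pos i))) ⟩
    conv′ s (f ∘ suc) m
      ≈⟨ act-elementary m (λ l → b (+ suc l)) f 1 ⟨
    act m (λ l → b (+ suc l)) f 1 ∎
    where s = signed-elementary m (λ l → b (+ suc l))

-- From ν_k ≤ ν_p < μ_p ≤ μ_i and i ≤ k one gets ν_k - k < μ_i - i. This puts zeros on the rectangle
-- i ≤ p ≤ k, which has the shape required by `det-zeroBlock`.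
exceeded-row : ∀ μ ν M {p i k} → rows ν p < rows μ p → i < M → i ≤ p → p ≤ k →
  rows ν k ℕ.+ (M ∸ k) ≤ rows μ i ℕ.+ (M ∸ suc i)
exceeded-row μ ν M {p} {i} {k} νp<μp i<M i≤p p≤k = begin
  rows ν k ℕ.+ (M ∸ k)               ≤⟨ ℕP.+-mono-≤ (antitone-≤ (rows-antitone ν) p≤k) (ℕP.∸-monoʳ-≤ M (ℕP.≤-trans i≤p p≤k)) ⟩
  rows ν p ℕ.+ (M ∸ i)               ≡⟨ ≡.cong (rows ν p ℕ.+_) (ℕP.+-∸-assoc 1 i<M) ⟩
  rows ν p ℕ.+ suc (M ∸ suc i)       ≡⟨ ℕP.+-suc (rows ν p) _ ⟩
  suc (rows ν p) ℕ.+ (M ∸ suc i)     ≤⟨ ℕP.+-monoˡ-≤ _ νp<μp ⟩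
  rows μ p ℕ.+ (M ∸ suc i)           ≤⟨ ℕP.+-monoˡ-≤ _ (antitone-≤ (rows-antitone μ) i≤p) ⟩
  rows μ i ℕ.+ (M ∸ suc i)           ∎
  where open ℕP.≤-Reasoning

cols-unique : ∀ μ i j → rows μ (suc i) ≤ j → j < rows μ i → cols μ j ≡ suc i
cols-unique μ i j ≤j j< = ℕP.≤-antisym
  (ℕP.≮⇒≥ λ i<c → ℕP.<⇒≱ (Equivalence.to (cols-rows μ (suc i) j) i<c) ≤j)
  (Equivalence.from (cols-rows μ i j) j<)

-- The two indices differ by the hook length of the box, which is positive.
box-indices : ∀ μ i j → j < rows μ i → + rows μ i ℤ.- + suc i ℤ.+ + 1 ≢ + suc j ℤ.- + cols μ j
box-indices μ i j j<r eq = ℕP.<-irrefl (≡.sym (ℤP.+-injective sums))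
  (ℕP.+-mono-≤-< {suc j} {rows μ i} {i} {cols μ j} j<r (Equivalence.from (cols-rows μ i j) j<r))
  where
  sums : + (rows μ i ℕ.+ cols μ j) ≡ + (suc j ℕ.+ i)
  sums = ≡.trans
    (ℤS.solve 3 (λ r c i → r ℤS.:+ c ℤS.:= ((r ℤS.:- (ℤS.con (+ 1) ℤS.:+ i)) ℤS.:+ ℤS.con (+ 1)) ℤS.:+ (i ℤS.:+ c))
      ≡.refl (+ rows μ i) (+ cols μ j) (+ i))
    (≡.trans (≡.cong (ℤ._+ (+ i ℤ.+ + cols μ j)) eq)
      (ℤS.solve 3 (λ j c i → (ℤS.con (+ 1) ℤS.:+ j ℤS.:- c) ℤS.:+ (i ℤS.:+ c) ℤS.:= (ℤS.con (+ 1) ℤS.:+ j) ℤS.:+ i)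
        ≡.refl (+ j) (+ cols μ j) (+ i)))

-- Values of the determinant at the points of diagrams.

module Values {c ℓ₁ ℓ₂} (𝕜 : HeytingField c ℓ₁ ℓ₂) (char0 : CharacteristicZero 𝕜) where
  open SymmetricFunctions 𝕜 char0 hiding (0#; _≈_; det; +-assoc; +-comm; +-cong; *-cong; *-assoc; *-comm; *-identity; +-identity; distrib; -‿cong)
  open CommutativeRing 𝕜-ring hiding (zero)
  open RingProperties ring
  open SemiringSum semiring
  open import Algebra.Definitions.RawSemiring (Semiring.rawSemiring semiring) using (_^_; product)
  open Determinant 𝕜-ring using (det)
  open DeterminantProperties 𝕜-ring
  open SequenceOperators 𝕜-ring
  open RangeSums 𝕜-ring
  open NewtonProducts 𝕜-ring
  open Evaluation 𝕜 char0
  open IntegerSolver 𝕜-ring renaming (con to conˢ)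
  open import Relation.Binary.Reasoning.Setoid setoid
  private
    module 𝕂 = HeytingField 𝕜

  -- By tightness it is enough to refute `x # 0#`. An x apart from zero is invertible, which would
  -- force y to be zero.
  zero-product : ∀ {x y} → x * y ≈ 0# → ¬ y ≈ 0# → x ≈ 0#
  zero-product {x} {y} xy≈0 y≉0 = proj₁ (𝕂.tight x 0#) λ x#0 →
    let (w , wx≈1 , _) = 𝕂.#⇒invertible x#0 in y≉0 (begin
      y                    ≈⟨ *-identityˡ y ⟨
      1# * y               ≈⟨ *-congʳ wx≈1 ⟨
      (w * (x - 0#)) * y   ≈⟨ solve 3 (λ w x y → (w :* (x :- conˢ (+ 0))) :* y := w :* (x :* y)) refl w x y ⟩
      w * (x * y)          ≈⟨ *-congˡ xy≈0 ⟩
      w * 0#               ≈⟨ zeroʳ w ⟩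
      0#                   ∎)

  1≉0 : ¬ 1# ≈ 0#
  1≉0 1≈0 = proj₂ (𝕂.tight (1# + 0#) 0#) (trans (+-identityʳ 1#) 1≈0) (char0 0)

  product-nonzero : ∀ {n} (f : Fin n → Carrier) → (∀ i → ¬ f i ≈ 0#) → ¬ product f ≈ 0#
  product-nonzero {zero}  f f≉0 = 1≉0
  product-nonzero {suc n} f f≉0 eq = f≉0 zero (zero-product eq (product-nonzero (f ∘ suc) (f≉0 ∘ suc)))

  -- The sign in the evaluation of 𝐩ₖ and the sign in the dual sequence combine, so that
  -- y-coordinates contribute negative powers sums of members of `a`, that is, zeros of H(u).
  alternate-power : ∀ w k → (- 1#) ^ k * (- w) ^ suc k ≈ - (w ^ suc k)
  alternate-power w zero    = solve 1 (λ w → conˢ (+ 1) :* (:- w :* conˢ (+ 1)) := :- (w :* conˢ (+ 1))) refl w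
  alternate-power w (suc k) = begin
    (- 1# * (- 1#) ^ k) * (- w * (- w) ^ suc k)
      ≈⟨ solve 3 (λ w s p → (:- conˢ (+ 1) :* s) :* (:- w :* p) := w :* (s :* p)) refl w ((- 1#) ^ k) ((- w) ^ suc k) ⟩
    w * ((- 1#) ^ k * (- w) ^ suc k)
      ≈⟨ *-congˡ (alternate-power w k) ⟩
    w * - (w ^ suc k)
      ≈⟨ -‿distribʳ-* w _ ⟨
    - (w * w ^ suc k) ∎

  module _ (a : Sequence) where

    -- The first M terms are a₁₋ₘ, ..., a₀ with m = M, the zeros of H(u) that survive the cut-off.
    β : ℕ → ℕ → Carrier
    β M k = a (+ suc k ℤ.- + M)

    ρ⟨_,_⟩ : ℕ → (ℕ → ℕ) → Seq
    ρ⟨ M , r ⟩ = ρ M (Beta.nodes (β M) M r)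

    desc⟨_⟩ : ℕ → ℕ → Seq → Seq
    desc⟨ M ⟩ = Beta.desc (β M)

    a-cong : ∀ {i j} → i ≡ j → a i ≈ a j
    a-cong eq = reflexive (≡.cong a eq)

    power-sums : ∀ ν M → ℓ ν ≤ M → ∀ k → evalAt a ν 𝐩[1+ k ] ≈
      ∑< M (λ i → powers (Beta.nodes (β M) M (rows ν) i) k) - ∑< M (λ i → powers (β M i) k)
    power-sums ν M ℓ≤M k = begin
      sum (λ i → x i ^ suc k) + (- 1#) ^ k * sum (λ i → y i ^ suc k)
        ≈⟨ +-congˡ (*-distribˡ-sum ((- 1#) ^ k) (λ i → y i ^ suc k)) ⟩
      sum (λ i → x i ^ suc k) + sum (λ i → (- 1#) ^ k * y i ^ suc k)
        ≈⟨ ∑-distrib-+ (λ i → x i ^ suc k) (λ i → (- 1#) ^ k * y i ^ suc k) ⟨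
      sum (λ i → x i ^ suc k + (- 1#) ^ k * y i ^ suc k)
        ≈⟨ sum-cong-≋ (λ i → +-cong (reflexive (≡.cong g (x-index (toℕ i))))
             (trans (alternate-power (a (+ 1 ℤ.- (frobQ ν i ℤ.+ + 1))) k) (-‿cong (reflexive (≡.cong g (y-index (toℕ i))))))) ⟩
      ∑< (diagonal ν) (λ i → g (+ r i ℤ.- + i) - g (+ suc i ℤ.- + cols ν i))
        ≈⟨ hook-sum g (diagonal ν) M r (cols ν) (rows-antitone ν) (cols-rows ν) (diagonal-rows ν) (nth-beyond (parts ν) ℓ≤M) ⟩
      ∑< M (λ i → g (+ r i ℤ.- + i) - g (ℤ.- + i))
        ≈⟨ ∑<-cong M (λ i i<M → +-cong (reflexive (≡.cong g (node-index i i<M))) (-‿cong (reflexive (≡.cong g (base-index i i<M))))) ⟩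
      ∑< M (λ i → powers (Beta.nodes (β M) M r i) k - powers (β M (M ∸ suc i)) k)
        ≈⟨ ∑-distrib-+ {M} (λ i → powers (Beta.nodes (β M) M r (toℕ i)) k) (λ i → - powers (β M (M ∸ suc (toℕ i))) k) ⟩
      ∑< M (λ i → powers (Beta.nodes (β M) M r i) k) + ∑< M (λ i → - powers (β M (M ∸ suc i)) k)
        ≈⟨ +-congˡ (sum-neg M (λ i → powers (β M (M ∸ suc i)) k)) ⟩
      ∑< M (λ i → powers (Beta.nodes (β M) M r i) k) - ∑< M (λ i → powers (β M (M ∸ suc i)) k)
        ≈⟨ +-congˡ (-‿cong (∑<-reverse M (λ i → powers (β M i) k))) ⟩
      ∑< M (λ i → powers (Beta.nodes (β M) M r i) k) - ∑< M (λ i → powers (β M i) k) ∎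
      where
      r = rows ν
      x = xCoords a ν
      y = yCoords a ν

      g : ℤ → Carrier
      g j = a j ^ suc k

      sum-neg : ∀ n f → ∑< n (λ i → - f i) ≈ - ∑< n f
      sum-neg zero    f = sym -0#≈0#
      sum-neg (suc n) f = trans (+-congˡ (sum-neg n (f ∘ suc)))
        (solve 2 (λ p q → :- p :+ :- q := :- (p :+ q)) refl (f 0) (∑< n (f ∘ suc)))

      x-index : ∀ i → (+ r i ℤ.- + suc i) ℤ.+ + 1 ≡ + r i ℤ.- + i
      x-index i = ℤS.solve 2 (λ r i → (r ℤS.:- (ℤS.con (+ 1) ℤS.:+ i)) ℤS.:+ ℤS.con (+ 1) ℤS.:= r ℤS.:- i) ≡.refl (+ r i) (+ i)

      y-index : ∀ i → + 1 ℤ.- ((+ cols ν i ℤ.- + suc i) ℤ.+ + 1) ≡ + suc i ℤ.- + cols ν i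
      y-index i = ℤS.solve 2 (λ c i → ℤS.con (+ 1) ℤS.:- ((c ℤS.:- (ℤS.con (+ 1) ℤS.:+ i)) ℤS.:+ ℤS.con (+ 1)) ℤS.:= (ℤS.con (+ 1) ℤS.:+ i) ℤS.:- c) ≡.refl (+ cols ν i) (+ i)

      node-index : ∀ i → i < M → + r i ℤ.- + i ≡ + suc (r i ℕ.+ (M ∸ suc i)) ℤ.- + M
      node-index i i<M = ≡.trans
        (ℤS.solve 3 (λ r i q → r ℤS.:- i ℤS.:= (ℤS.con (+ 1) ℤS.:+ (r ℤS.:+ q)) ℤS.:- (q ℤS.:+ (ℤS.con (+ 1) ℤS.:+ i))) ≡.refl (+ r i) (+ i) (+ (M ∸ suc i)))
        (≡.cong (λ m → + suc (r i ℕ.+ (M ∸ suc i)) ℤ.- + m) (ℕP.m∸n+n≡m i<M))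

      base-index : ∀ i → i < M → ℤ.- + i ≡ + suc (M ∸ suc i) ℤ.- + M
      base-index i i<M = ≡.trans
        (ℤS.solve 2 (λ i q → ℤS.:- i ℤS.:= (ℤS.con (+ 1) ℤS.:+ q) ℤS.:- (q ℤS.:+ (ℤS.con (+ 1) ℤS.:+ i))) ≡.refl (+ i) (+ (M ∸ suc i)))
        (≡.cong (λ m → + suc (M ∸ suc i) ℤ.- + m) (ℕP.m∸n+n≡m i<M))

    -- The product formula for H(u): the quotient on the right satisfies Newton's identities for the
    -- power sums of its poles minus those of its zeros, and `power-sums` identifies these with the
    -- evaluated 𝐩ₖ.
    evalAt-h : ∀ ν M → ℓ ν ≤ M → ∀ n → evalAt a ν (h n) ≈ desc⟨ M ⟩ M ρ⟨ M , rows ν ⟩ n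
    evalAt-h ν M ℓ≤M = eval-h (xCoords a ν) (yCoords a ν)
      (proj₂ (Beta.Lead-desc (β M) M lead))
      (Newton-cong {0} {f = desc⟨ M ⟩ M ρ⟨ M , rows ν ⟩} (λ k → sym (power-sums ν M ℓ≤M k))
        (Newton-desc (β M) M lead
          (≡.subst (λ m → Newton m (λ k → ∑< M (λ i → powers (Beta.nodes (β M) M (rows ν) i) k)) ρ⟨ M , rows ν ⟩) (≡.sym (ℕP.+-identityʳ M)) (Newton-ρ M _))))
      where
      lead : Lead (M ℕ.+ 0) ρ⟨ M , rows ν ⟩
      lead = ≡.subst (λ m → Lead m ρ⟨ M , rows ν ⟩) (≡.sym (ℕP.+-identityʳ M)) (Lead-ρ M _)

    -- For z > 0 the column shift makes the factors run through a at 1 - j, ..., z - 1 - j. They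
    -- overlap with the zeros of H(u) and are regrouped into the row product and j further factors.
    -- For z ≤ 0 the right side is read off from its leading power: it is u⁻¹ for z = 0, and lower
    -- for z < 0.
    eval-h⟨⟩ : ∀ {d} (x y : Vector Carrier d) M f → Lead M f → (∀ n → eval x y (h n) ≈ desc⟨ M ⟩ M f n) →
      ∀ z t j → j ≤ M → z ℤ.+ + M ≡ + suc (t ℕ.+ j) →
      eval x y (h⟨ τ (+ 1 ℤ.- + suc j) a ⟩ z) ≈ act j (λ l → β M (M ∸ suc l)) (desc⟨ M ⟩ t f) 1
    eval-h⟨⟩ x y M f lead h≈ (+ zero) t j j≤M eq = sym (proj₂ (Lead-act j _ (Beta.Lead-desc (β M) t
      (≡.subst (λ m → Lead m f)
        (≡.trans (ℤP.+-injective eq) (≡.trans (≡.sym (ℕP.+-suc t j)) (≡.cong (t ℕ.+_) (ℕP.+-comm 1 j)))) lead))))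
    eval-h⟨⟩ x y M f lead h≈ -[1+ n ] t j j≤M eq = sym (proj₁ (Lead-act j {2 ℕ.+ n} _ (Beta.Lead-desc (β M) t
      (≡.subst (λ m → Lead m f) M≡ lead))) 1 (s≤s (s≤s z≤n)))
      where
      M≡ : M ≡ t ℕ.+ (j ℕ.+ (2 ℕ.+ n))
      M≡ = ℤP.+-injective (≡.trans
        (ℤS.solve 2 (λ m k → m ℤS.:= (ℤS.:- k ℤS.:+ m) ℤS.:+ k) ≡.refl (+ M) (+ suc n))
        (≡.trans (≡.cong (ℤ._+ + suc n) eq)
          (ℤS.solve 3 (λ t j n → (ℤS.con (+ 1) ℤS.:+ (t ℤS.:+ j)) ℤS.:+ (ℤS.con (+ 1) ℤS.:+ n) ℤS.:= t ℤS.:+ (j ℤS.:+ (ℤS.con (+ 2) ℤS.:+ n)))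
            ≡.refl (+ t) (+ j) (+ n))))
    eval-h⟨⟩ x y M f lead h≈ (+ suc n) t j j≤M eq = trans
      (eval-h⟨⟩-suc x y h≈ (τ (+ 1 ℤ.- + suc j) a) n)
      (go (M ∸ j) (≡.sym (ℕP.m+[n∸m]≡n j≤M)) (ℕP.suc-injective (ℤP.+-injective eq)))
      where
      go : ∀ m → M ≡ j ℕ.+ m → n ℕ.+ M ≡ t ℕ.+ j →
        act n (λ l → a (+ suc l ℤ.+ (+ 1 ℤ.- + suc j))) (desc⟨ M ⟩ M f) 1 ≈ act j (λ l → β M (M ∸ suc l)) (desc⟨ M ⟩ t f) 1
      go m ≡.refl n+M≡ = begin
        act n (λ l → a (+ suc l ℤ.+ (+ 1 ℤ.- + suc j))) (desc⟨ M ⟩ (j ℕ.+ m) f) 1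
          ≈⟨ act-congˡ n (desc⟨ M ⟩ (j ℕ.+ m) f) (λ l _ → a-cong
               (ℤS.solve 3 (λ l m j → (ℤS.con (+ 1) ℤS.:+ l) ℤS.:+ (ℤS.con (+ 1) ℤS.:- (ℤS.con (+ 1) ℤS.:+ j))
                                   ℤS.:= (ℤS.con (+ 1) ℤS.:+ (m ℤS.:+ l)) ℤS.:- (j ℤS.:+ m)) ≡.refl (+ l) (+ m) (+ j))) 1 ⟩
        act n (λ l → β M (m ℕ.+ l)) (desc⟨ M ⟩ (j ℕ.+ m) f) 1
          ≈⟨ Beta.act-desc-exchange (β M) n j m f 1 ⟩
        act j (λ l → β M (M ∸ suc l)) (desc⟨ M ⟩ (n ℕ.+ m) f) 1
          ≡⟨ ≡.cong (λ t → act j (λ l → β M (M ∸ suc l)) (desc⟨ M ⟩ t f) 1) n+m≡t ⟩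
        act j (λ l → β M (M ∸ suc l)) (desc⟨ M ⟩ t f) 1 ∎
        where
        n+m≡t : n ℕ.+ m ≡ t
        n+m≡t = ℕP.+-cancelʳ-≡ j (n ℕ.+ m) t
          (≡.trans (ℕP.+-assoc n m j) (≡.trans (≡.cong (n ℕ.+_) (ℕP.+-comm m j)) n+M≡))

    ρ-cong : ∀ n {z z′ : ℕ → Carrier} → (∀ l → z l ≈ z′ l) → ρ n z ≐ ρ n z′
    ρ-cong zero    eq k = refl
    ρ-cong (suc n) {z} {z′} eq k = trans ([1/u-]-congˡ (ρ n (z ∘ suc)) (eq 0) k)
      ([1/u-]-cong (z′ 0) (ρ-cong n (eq ∘ suc)) k)

    -- Row i lists coefficients of Newton interpolation for Tᵢ, with nodes taken from the last one
    -- backwards. The nodes from j on belong to ν without its first j rows, with M - j in place of M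
    -- and unchanged `β M`.
    newtonMatrix : ℕ → Diagram → Diagram → ℕ → ℕ → Carrier
    newtonMatrix M μ ν i j = desc⟨ M ⟩ (rows μ i ℕ.+ (M ∸ suc i))
      (ρ (M ∸ j) (Beta.nodes (β M) (M ∸ j) (λ l → rows ν (l ℕ.+ j)))) 1

    -- M counts the poles of H(u) and N is the size of the determinant. They are kept apart because
    -- N depends on μ and may be smaller than `ℓ ν`.
    evalAt-s : ∀ M N μ ν → N ≤ M → ℓ ν ≤ M →
      evalAt a ν (s⟨ a ⟩ N μ) ≈ det {N} (λ i j → newtonMatrix M μ ν (toℕ i) (toℕ j))
    evalAt-s M N μ ν N≤M ℓ≤M = begin
      evalAt a ν (s⟨ a ⟩ N μ)
        ≈⟨ eval-det (xCoords a ν) (yCoords a ν) {N} _ ⟩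
      det {N} (λ i j → evalAt a ν (h⟨ τ (+ 1 ℤ.- + pos j) a ⟩ (+ row μ (pos i) ℤ.- + pos i ℤ.+ + pos j)))
        ≈⟨ det-cong {N} (λ i j → eval-h⟨⟩ (xCoords a ν) (yCoords a ν) M f (Lead-ρ M z) (evalAt-h ν M ℓ≤M)
             (+ row μ (pos i) ℤ.- + pos i ℤ.+ + pos j) (rows μ (toℕ i) ℕ.+ (M ∸ pos i)) (toℕ j) (ℕP.<⇒≤ (ℕP.≤-trans (FinP.toℕ<n j) N≤M))
             (index (rows μ (toℕ i)) (toℕ i) (toℕ j) (ℕP.≤-trans (FinP.toℕ<n i) N≤M))) ⟩
      det {N} (actMatrix φ (λ l → β M (M ∸ suc l)))
        ≈⟨ det-actMatrix {N} φ (λ l → β M (M ∸ suc l)) z ⟩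
      det {N} (actMatrix φ z)
        ≈⟨ det-cong {N} (λ i j → entry (rows μ (toℕ i) ℕ.+ (M ∸ pos i)) (toℕ j) (ℕP.<⇒≤ (ℕP.≤-trans (FinP.toℕ<n j) N≤M))) ⟩
      det {N} (λ i j → newtonMatrix M μ ν (toℕ i) (toℕ j)) ∎
      where
      z = Beta.nodes (β M) M (rows ν)
      f = ρ⟨ M , rows ν ⟩

      φ : Fin N → Seq
      φ i = desc⟨ M ⟩ (rows μ (toℕ i) ℕ.+ (M ∸ pos i)) f

      index : ∀ r i j → i < M → (+ r ℤ.- + suc i ℤ.+ + suc j) ℤ.+ + M ≡ + suc ((r ℕ.+ (M ∸ suc i)) ℕ.+ j)
      index r i j i<M = ≡.trans
        (≡.cong (λ m → (+ r ℤ.- + suc i ℤ.+ + suc j) ℤ.+ + m) (≡.sym (ℕP.m∸n+n≡m i<M)))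
        (ℤS.solve 4 (λ r i j q → ((r ℤS.:- (ℤS.con (+ 1) ℤS.:+ i)) ℤS.:+ (ℤS.con (+ 1) ℤS.:+ j)) ℤS.:+ (q ℤS.:+ (ℤS.con (+ 1) ℤS.:+ i))
                             ℤS.:= ℤS.con (+ 1) ℤS.:+ ((r ℤS.:+ q) ℤS.:+ j)) ≡.refl (+ r) (+ i) (+ j) (+ (M ∸ suc i)))

      entry : ∀ t j → j ≤ M → act j z (desc⟨ M ⟩ t f) 1 ≈
        desc⟨ M ⟩ t (ρ (M ∸ j) (Beta.nodes (β M) (M ∸ j) (λ l → rows ν (l ℕ.+ j)))) 1
      entry t j j≤M = trans (Beta.desc-act (β M) t j z f 1) (Beta.desc-cong (β M) t (λ k → begin
        act j z (ρ M z) k                      ≡⟨ ≡.cong (λ m → act j z (ρ m z) k) (ℕP.m+[n∸m]≡n j≤M) ⟨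
        act j z (ρ (j ℕ.+ (M ∸ j)) z) k        ≈⟨ act-ρ j (M ∸ j) z k ⟩
        ρ (M ∸ j) (z ∘ (j ℕ.+_)) k
          ≈⟨ ρ-cong (M ∸ j) (λ l → reflexive (≡.cong (β M) (≡.cong₂ ℕ._+_ (≡.cong (rows ν) (ℕP.+-comm j l))
               (≡.trans (≡.cong (M ∸_) (≡.sym (ℕP.+-suc j l))) (≡.sym (ℕP.∸-+-assoc M j (suc l))))))) k ⟩
        ρ (M ∸ j) (Beta.nodes (β M) (M ∸ j) (λ l → rows ν (l ℕ.+ j))) k ∎) 1)

    newtonMatrix-zero : ∀ M μ ν i k → i < M → rows ν k ℕ.+ (M ∸ k) ≤ rows μ i ℕ.+ (M ∸ suc i) →
      newtonMatrix M μ ν i k ≈ 0#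
    newtonMatrix-zero M μ ν i k i<M le =
      Beta.desc-vanish (β M) (rows μ i ℕ.+ (M ∸ suc i)) (M ∸ k) (λ l → rows ν (l ℕ.+ k)) (λ l → rows-antitone ν (l ℕ.+ k)) le 0

    s-vanishes : ∀ N μ ν → ℓ μ ≤ N → ν ≢ᴰ μ → ∣ ν ∣ ≤ ∣ μ ∣ → evalAt a ν (s⟨ a ⟩ N μ) ≈ 0#
    s-vanishes N μ ν ℓ≤N ν≢μ ν≤μ with noncontained-row {μ} {ν} ν≢μ ν≤μ
    ... | p , νp<μp = trans (evalAt-s M N μ ν (ℕP.m≤m+n N (ℓ ν)) (ℕP.m≤n+m (ℓ ν) N))
            (det-zeroBlock {N} _ p (ℕP.≤-trans (nth-<-length (parts μ) (ℕP.≤-trans (s≤s z≤n) νp<μp)) ℓ≤N) λ i k i≤p p≤k →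
              newtonMatrix-zero M μ ν (toℕ i) (toℕ k) (i<M i) (exceeded-row μ ν M νp<μp (i<M i) i≤p p≤k))
      where
      M = N ℕ.+ ℓ ν
      i<M : (i : Fin N) → toℕ i < M
      i<M i = ℕP.≤-trans (FinP.toℕ<n i) (ℕP.m≤m+n N (ℓ ν))

    hookFactor : Diagram → ℕ → Carrier
    hookFactor μ i = prod (rows μ i) λ j → a (+ rows μ i ℤ.- + suc i ℤ.+ + 1) - a (+ suc j ℤ.- + cols μ j)

    -- The zeros of Tᵢ that are not nodes have to be listed. Counting rows from 1, the indices from
    -- 1 - N to μᵢ - i split into the μₖ - k + 1 for i < k ≤ N and the j - μ′ⱼ for j ≤ μᵢ; `γ`
    -- enumerates the latter.
    newtonMatrix-diagonal : ∀ N μ i → ℓ μ ≤ N → i < N → newtonMatrix N μ μ i i ≈ hookFactor μ i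
    newtonMatrix-diagonal N μ i ℓ≤N i<N = begin
      desc⟨ N ⟩ (rows μ i ℕ.+ q) (ρ (N ∸ i) (Beta.nodes (β N) (N ∸ i) r)) 1
        ≡⟨ ≡.cong (λ m → desc⟨ N ⟩ (rows μ i ℕ.+ q) (ρ m (Beta.nodes (β N) m r)) 1) (ℕP.+-∸-assoc 1 i<N) ⟩
      desc⟨ N ⟩ (rows μ i ℕ.+ q) (ρ (suc q) (Beta.nodes (β N) (suc q) r)) 1
        ≈⟨ Beta.desc-complement (β N) q r x γ (λ l → rows-antitone μ (l ℕ.+ i))
             (nth-beyond (parts μ) (≡.subst (ℓ μ ≤_) (≡.sym N≡) ℓ≤N)) gap 0 ⟩
      prod (rows μ i) (λ j → x - γ j) * 1#
        ≈⟨ *-identityʳ _ ⟩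
      prod (rows μ i) (λ j → x - γ j)
        ≡⟨ ≡.cong (λ k → prod (rows μ i) (λ j → a k - γ j)) x-index ⟩
      hookFactor μ i ∎
      where
      q = N ∸ suc i
      r = λ l → rows μ (l ℕ.+ i)
      x = β N (rows μ i ℕ.+ q)
      γ = λ j → a (+ suc j ℤ.- + cols μ j)

      N≡ : suc (q ℕ.+ i) ≡ N
      N≡ = ≡.trans (≡.sym (ℕP.+-suc q i)) (ℕP.m∸n+n≡m i<N)

      x-index : + suc (rows μ i ℕ.+ q) ℤ.- + N ≡ + rows μ i ℤ.- + suc i ℤ.+ + 1
      x-index = ≡.trans (≡.cong (λ m → + suc (rows μ i ℕ.+ q) ℤ.- + m) (≡.sym N≡))
        (ℤS.solve 3 (λ r q i → (ℤS.con (+ 1) ℤS.:+ (r ℤS.:+ q)) ℤS.:- (ℤS.con (+ 1) ℤS.:+ (q ℤS.:+ i))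
                            ℤS.:= (r ℤS.:- (ℤS.con (+ 1) ℤS.:+ i)) ℤS.:+ ℤS.con (+ 1)) ≡.refl (+ rows μ i) (+ q) (+ i))

      gap : ∀ l j → l ≤ q → r (suc l) ≤ j → j < r l → γ j ≈ β N (j ℕ.+ (q ∸ l))
      gap l j l≤q r≤j j<r = a-cong (≡.trans
        (≡.cong (λ m → + suc j ℤ.- + m) (cols-unique μ (l ℕ.+ i) j r≤j j<r))
        (≡.trans
          (ℤS.solve 4 (λ j l i p → (ℤS.con (+ 1) ℤS.:+ j) ℤS.:- (ℤS.con (+ 1) ℤS.:+ (l ℤS.:+ i))
                                ℤS.:= (ℤS.con (+ 1) ℤS.:+ (j ℤS.:+ p)) ℤS.:- (ℤS.con (+ 1) ℤS.:+ ((p ℤS.:+ l) ℤS.:+ i)))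
            ≡.refl (+ j) (+ l) (+ i) (+ (q ∸ l)))
          (≡.cong (λ m → + suc (j ℕ.+ (q ∸ l)) ℤ.- + m)
            (≡.trans (≡.cong (λ m → suc (m ℕ.+ i)) (ℕP.m∸n+n≡m l≤q)) N≡))))

    s-value : ∀ N μ → ℓ μ ≤ N → evalAt a μ (s⟨ a ⟩ N μ) ≈ boxProduct a μ
    s-value N μ ℓ≤N = begin
      evalAt a μ (s⟨ a ⟩ N μ)
        ≈⟨ evalAt-s N N μ μ ℕP.≤-refl ℓ≤N ⟩
      det {N} (λ i j → newtonMatrix N μ μ (toℕ i) (toℕ j))
        ≈⟨ det-lowerTriangular {N} _ (λ i k i<k → newtonMatrix-zero N μ μ (toℕ i) (toℕ k) (FinP.toℕ<n i)
             (ℕP.+-mono-≤ (antitone-≤ (rows-antitone μ) (ℕP.<⇒≤ i<k)) (ℕP.∸-monoʳ-≤ N i<k))) ⟩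
      product {N} (λ i → newtonMatrix N μ μ (toℕ i) (toℕ i))
        ≈⟨ prod-cong N (λ i i<N → newtonMatrix-diagonal N μ i ℓ≤N i<N) ⟩
      prod N (hookFactor μ)
        ≡⟨ ≡.cong (λ m → prod m (hookFactor μ)) (ℕP.m+[n∸m]≡n ℓ≤N) ⟨
      prod (ℓ μ ℕ.+ (N ∸ ℓ μ)) (hookFactor μ)
        -- Rows past `ℓ μ` have no boxes, so their factors are empty products.
        ≈⟨ prod-extend (ℓ μ) (N ∸ ℓ μ) (hookFactor μ) (λ i ℓ≤i → reflexive (≡.cong
             (λ m → prod m λ j → a (+ rows μ i ℤ.- + suc i ℤ.+ + 1) - a (+ suc j ℤ.- + cols μ j)) (nth-beyond (parts μ) ℓ≤i))) ⟩
      boxProduct a μ ∎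
      where
      prod-cong : ∀ n {f g} → (∀ i → i < n → f i ≈ g i) → prod n f ≈ prod n g
      prod-cong zero    f≈g = refl
      prod-cong (suc n) f≈g = *-cong (f≈g 0 (s≤s z≤n)) (prod-cong n (λ i i<n → f≈g (suc i) (s≤s i<n)))

    module _ (distinct : ∀ i j → i ≢ j → ¬ a i ≈ a j) where

      boxProduct-nonzero : ∀ μ → ¬ boxProduct a μ ≈ 0#
      boxProduct-nonzero μ = product-nonzero {ℓ μ} _ λ i → product-nonzero {row μ (pos i)} _ λ j eq →
        distinct _ _ (box-indices μ (toℕ i) (toℕ j) (FinP.toℕ<n j)) (x-y≈0 eq)
        where
        x-y≈0 : ∀ {x y} → x - y ≈ 0# → x ≈ y
        x-y≈0 {x} {y} eq = trans (solve 2 (λ x y → x := (x :- y) :+ y) refl x y) (trans (+-congʳ eq) (+-identityˡ y))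

-- Degrees and leading components.

∑ℤ-rows : ∀ xs N → length xs ≤ N → ℤ∑.sum {N} (λ i → + nth xs (toℕ i)) ≡ + ℕList.sum xs
∑ℤ-rows []       zero    _        = ≡.refl
∑ℤ-rows []       (suc N) _        = ≡.trans (ℤP.+-identityˡ _) (∑ℤ-rows [] N z≤n)
∑ℤ-rows (x ∷ xs) (suc N) (s≤s le) = ≡.cong (ℤ._+_ (+ x)) (∑ℤ-rows xs N le)

∑ℤ-Jacobi-Trudi : ∀ μ N → ℓ μ ≤ N →
  ℤ∑.sum {N} (λ i → + row μ (pos i) ℤ.- + pos i) ℤ.+ ℤ∑.sum {N} (λ j → + pos j) ≡ + ∣ μ ∣
∑ℤ-Jacobi-Trudi μ N ℓ≤N = ≡.trans
  (≡.sym (ℤ∑.∑-distrib-+ {N} (λ i → + row μ (pos i) ℤ.- + pos i) (λ j → + pos j)))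
  (≡.trans (ℤ∑.sum-cong-≋ {N} λ i →
      ≡.trans (ℤP.+-assoc (+ row μ (pos i)) (ℤ.- + pos i) (+ pos i))
        (≡.trans (≡.cong (ℤ._+_ (+ row μ (pos i))) (ℤP.+-inverseˡ (+ pos i))) (ℤP.+-identityʳ _)))
    (∑ℤ-rows (parts μ) N ℓ≤N))

module Degrees {c ℓ₁ ℓ₂} (𝕜 : HeytingField c ℓ₁ ℓ₂) (char0 : CharacteristicZero 𝕜) where
  open SymmetricFunctions 𝕜 char0 hiding (+-assoc; +-comm; +-cong; *-cong; *-assoc; *-comm; *-identity; +-identity; distrib; -‿cong; -‿inverse)
  module Λᴰ = SymmetricFunctions 𝕜 char0
  private
    module K = CommutativeRing 𝕜-ring
  open K using (1#) renaming (Carrier to 𝕂)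
  open CommutativeRing Λ-ring using (+-assoc; +-comm; +-cong; +-congˡ; +-congʳ; *-cong; *-congˡ; *-congʳ; *-assoc; *-comm;
    *-identityˡ; +-identityˡ; +-identityʳ; distribˡ; distribʳ; -‿cong; -‿inverseˡ; -‿inverseʳ; zeroˡ; zeroʳ;
    setoid; ring; semiring)
  open RingProperties ring using (-1*x≈-x; -0#≈0#)
  open SemiringSum semiring using (sum; ∑-distrib-+; sum-remove; sum-init-last)
  open SemiringMult K.semiring using () renaming (_×_ to _·_; ×-homo-+ to ·-homo-+)
  open import Algebra.Definitions.RawSemiring (Semiring.rawSemiring K.semiring) using () renaming (_^_ to _^ᴷ_)
  open DeterminantProperties Λ-ring using (sum-zero; sign; minor)
  open IntegerSolver Λ-ring renaming (con to conˢ)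
  open import Relation.Binary.Reasoning.Setoid setoid

  -1Λ : con (K.- 1#) ≈Λ -Λ 1Λ
  -1Λ = begin
    con (K.- 1#)                              ≈⟨ solve 1 (λ x → x := (:- conˢ (+ 1) :+ (conˢ (+ 1) :+ x))) reflΛ _ ⟩
    -Λ 1Λ +Λ (con 1# +Λ con (K.- 1#))         ≈⟨ +-congˡ (symΛ (con-+ 1# (K.- 1#))) ⟩
    -Λ 1Λ +Λ con (1# K.+ K.- 1#)              ≈⟨ +-congˡ (con-cong (K.-‿inverseʳ 1#)) ⟩
    -Λ 1Λ +Λ 0Λ                               ≈⟨ +-identityʳ _ ⟩
    -Λ 1Λ                                     ∎

  con-neg : ∀ F → con (K.- 1#) *Λ F ≈Λ -Λ F
  con-neg F = transΛ (*-congʳ -1Λ) (-1*x≈-x F)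

  Homogeneous-neg : ∀ {n F} → Homogeneous n F → Homogeneous n (-Λ F)
  Homogeneous-neg {n} {F} hom = resp (con-neg F) (mul (con (K.- 1#)) hom)

  -- An inductive form of Degree<, for which products are easy.
  data Fil (n : ℕ) : Λ → Set (c ⊔ ℓ₁) where
    zeroF : Fil n 0Λ
    homF  : ∀ {m F} → m < n → Homogeneous m F → Fil n F
    addF  : ∀ {F G} → Fil n F → Fil n G → Fil n (F +Λ G)
    respF : ∀ {F G} → F ≈Λ G → Fil n F → Fil n G

  Fil-neg : ∀ {n F} → Fil n F → Fil n (-Λ F)
  Fil-neg zeroF         = respF (symΛ -0#≈0#) zeroF
  Fil-neg (homF m<n h)  = homF m<n (Homogeneous-neg h)
  Fil-neg (addF f g)    = respF (solve 2 (λ x y → :- x :+ :- y := :- (x :+ y)) reflΛ _ _) (addF (Fil-neg f) (Fil-neg g))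
  Fil-neg (respF eq f)  = respF (-‿cong eq) (Fil-neg f)

  Fil-sub : ∀ {n F G} → Fil n F → Fil n G → Fil n (F -Λ G)
  Fil-sub f g = addF f (Fil-neg g)

  Fil-weaken : ∀ {m n F} → m ≤ n → Fil m F → Fil n F
  Fil-weaken m≤n zeroF        = zeroF
  Fil-weaken m≤n (homF k<m h) = homF (ℕP.≤-trans k<m m≤n) h
  Fil-weaken m≤n (addF f g)   = addF (Fil-weaken m≤n f) (Fil-weaken m≤n g)
  Fil-weaken m≤n (respF eq f) = respF eq (Fil-weaken m≤n f)

  Fil-*-homogeneous : ∀ {m n F G} → Homogeneous m F → Fil n G → Fil (m ℕ.+ n) (F *Λ G)
  Fil-*-homogeneous h zeroF        = respF (symΛ (zeroʳ _)) zeroF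
  Fil-*-homogeneous {m} h (homF k<n g) = homF (ℕP.+-monoʳ-< m k<n) (mul h g)
  Fil-*-homogeneous h (addF f g)   = respF (symΛ (distribˡ _ _ _)) (addF (Fil-*-homogeneous h f) (Fil-*-homogeneous h g))
  Fil-*-homogeneous h (respF eq g) = respF (*-congˡ eq) (Fil-*-homogeneous h g)

  -- A degree below m and a degree at most n add up to a degree below m + n; the unequal bounds suit
  -- the product of an error term with a full factor.
  Fil-* : ∀ {m n F G} → Fil m F → Fil (suc n) G → Fil (m ℕ.+ n) (F *Λ G)
  Fil-* zeroF        g = respF (symΛ (zeroˡ _)) zeroF
  Fil-* {m} {n} (homF {k} k<m h) g = Fil-weaken (≡.subst (ℕ._≤ m ℕ.+ n) (≡.sym (ℕP.+-suc k n)) (ℕP.+-monoˡ-≤ n k<m)) (Fil-*-homogeneous h g)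
  Fil-* (addF f f′)  g = respF (symΛ (distribʳ _ _ _)) (addF (Fil-* f g) (Fil-* f′ g))
  Fil-* (respF eq f) g = respF (*-congʳ eq) (Fil-* f g)

  Fil-sum : ∀ {n k} (G : Fin k → Λ) → (∀ i → Fil n (G i)) → Fil n (∑Λ G)
  Fil-sum {k = zero}  G fil = zeroF
  Fil-sum {k = suc k} G fil = addF (fil zero) (Fil-sum (G ∘ suc) (fil ∘ suc))

  Fil-0⇒≈0 : ∀ {F} → Fil 0 F → F ≈Λ 0Λ
  Fil-0⇒≈0 zeroF        = reflΛ
  Fil-0⇒≈0 (addF f g)   = transΛ (+-cong (Fil-0⇒≈0 f) (Fil-0⇒≈0 g)) (+-identityˡ 0Λ)
  Fil-0⇒≈0 (respF eq f) = transΛ (symΛ eq) (Fil-0⇒≈0 f)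

  Degree<⇒Fil : ∀ {n F} → Degree< n F → Fil n F
  Degree<⇒Fil (G , hom , eq) = respF (symΛ eq) (Fil-sum G λ i → homF (FinP.toℕ<n i) (hom i))

  Degree<-homogeneous : ∀ {m n F} → m < n → Homogeneous m F → Degree< n F
  Degree<-homogeneous {m} {n = suc n} {F} m<n hom = G , G-hom , symΛ (begin
    sum G                                    ≈⟨ sum-remove {i = p} G ⟩
    G p +Λ sum (λ k → G (punchIn p k))       ≈⟨ +-cong G-p (sum-zero λ k → G-other (punchIn p k) (FinP.punchInᵢ≢i p k)) ⟩
    F +Λ 0Λ                                  ≈⟨ +-identityʳ F ⟩
    F                                        ∎)
    where
    p = Fin.fromℕ< m<n

    G : Fin (suc n) → Λ
    G i with i FinP.≟ p
    ... | yes _ = F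
    ... | no  _ = 0Λ

    G-p : G p ≈Λ F
    G-p with p FinP.≟ p
    ... | yes _   = reflΛ
    ... | no  p≢p = contradiction ≡.refl p≢p

    G-other : ∀ i → i ≢ p → G i ≈Λ 0Λ
    G-other i i≢p with i FinP.≟ p
    ... | yes i≡p = contradiction i≡p i≢p
    ... | no  _   = reflΛ

    G-hom : ∀ i → Homogeneous (toℕ i) (G i)
    G-hom i with i FinP.≟ p
    ... | yes ≡.refl = ≡.subst (λ k → Homogeneous k F) (≡.sym (FinP.toℕ-fromℕ< m<n)) hom
    ... | no  _      = nil

  Fil⇒Degree< : ∀ {n F} → Fil n F → Degree< n F
  Fil⇒Degree< {n} zeroF = (λ _ → 0Λ) , (λ _ → nil) , symΛ (sum-zero {n} λ _ → reflΛ)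
  Fil⇒Degree< (homF m<n h) = Degree<-homogeneous m<n h
  Fil⇒Degree< (addF f g) with Fil⇒Degree< f | Fil⇒Degree< g
  ... | G , hom , eq | G′ , hom′ , eq′ = (λ i → G i +Λ G′ i) , (λ i → add (hom i) (hom′ i)) ,
          transΛ (+-cong eq eq′) (symΛ (∑-distrib-+ G G′))
  Fil⇒Degree< (respF eq f) with Fil⇒Degree< f
  ... | G , hom , eq′ = G , hom , transΛ (symΛ eq) eq′

  -- G is the component of F of degree z, and F has no component above;
  -- negative degrees make the entries of Jacobi–Trudi matrices uniform.
  Leading : ℤ → Λ → Λ → Set (c ⊔ ℓ₁)
  Leading (+ n)    F G = Homogeneous n G × Fil n (F -Λ G)
  Leading -[1+ n ] F G = F ≈Λ 0Λ × G ≈Λ 0Λ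

  Leading-zero : ∀ z {F G} → F ≈Λ 0Λ → G ≈Λ 0Λ → Leading z F G
  Leading-zero (+ n)    F≈0 G≈0 = resp (symΛ G≈0) nil ,
    respF (symΛ (transΛ (+-cong F≈0 (-‿cong G≈0)) (-‿inverseʳ 0Λ))) zeroF
  Leading-zero -[1+ n ] F≈0 G≈0 = F≈0 , G≈0

  Leading-homogeneous : ∀ {n F} → Homogeneous n F → Leading (+ n) F F
  Leading-homogeneous hom = hom , respF (symΛ (-‿inverseʳ _)) zeroF

  Leading-+ : ∀ z {F G F′ G′} → Leading z F G → Leading z F′ G′ → Leading z (F +Λ F′) (G +Λ G′)
  Leading-+ (+ n) {F} {G} {F′} {G′} (hom , fil) (hom′ , fil′) = add hom hom′ ,
    respF (solve 4 (λ f g f′ g′ → (f :- g) :+ (f′ :- g′) := (f :+ f′) :- (g :+ g′)) reflΛ F G F′ G′) (addF fil fil′)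
  Leading-+ -[1+ n ] (F≈0 , G≈0) (F′≈0 , G′≈0) =
    transΛ (+-cong F≈0 F′≈0) (+-identityˡ 0Λ) , transΛ (+-cong G≈0 G′≈0) (+-identityˡ 0Λ)

  Leading⇒Fil : ∀ n {F G} → Leading (+ n) F G → Fil (suc n) F
  Leading⇒Fil n {F} {G} (hom , fil) = respF (solve 2 (λ f g → (f :- g) :+ g := f) reflΛ F G)
    (addF (Fil-weaken (ℕP.n≤1+n n) fil) (homF ℕP.≤-refl hom))

  Leading-* : ∀ z w {F G F′ G′} → Leading z F G → Leading w F′ G′ → Leading (z ℤ.+ w) (F *Λ F′) (G *Λ G′)
  Leading-* (+ m) (+ n) {F} {G} {F′} {G′} lead@(hom , fil) lead′@(hom′ , fil′) = mul hom hom′ ,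
    respF (solve 4 (λ f g f′ g′ → (f :- g) :* f′ :+ g :* (f′ :- g′) := f :* f′ :- g :* g′) reflΛ F G F′ G′)
      (addF (Fil-* fil (Leading⇒Fil n lead′)) (Fil-*-homogeneous hom fil′))
  Leading-* -[1+ m ] w (F≈0 , G≈0) _ = Leading-zero (-[1+ m ] ℤ.+ w)
    (transΛ (*-congʳ F≈0) (zeroˡ _)) (transΛ (*-congʳ G≈0) (zeroˡ _))
  Leading-* z@(+ m) -[1+ n ] _ (F≈0 , G≈0) = Leading-zero (z ℤ.+ -[1+ n ])
    (transΛ (*-congˡ F≈0) (zeroʳ _)) (transΛ (*-congˡ G≈0) (zeroʳ _))

  Leading-sum : ∀ z {k} (F G : Fin k → Λ) → (∀ i → Leading z (F i) (G i)) → Leading z (∑Λ F) (∑Λ G)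
  Leading-sum z {zero}  F G lead = Leading-zero z reflΛ reflΛ
  Leading-sum z {suc k} F G lead = Leading-+ z (lead zero) (Leading-sum z (F ∘ suc) (G ∘ suc) (lead ∘ suc))

  sign-homogeneous : ∀ {n} (j : Fin n) → Homogeneous 0 (sign j)
  sign-homogeneous zero    = con 1#
  sign-homogeneous (suc j) = mul (resp -1Λ (con (K.- 1#))) (sign-homogeneous j)

  -- With entry degrees of the form uᵢ + vⱼ, every term of the expansion has degree Σ u + Σ v: the
  -- entry takes u₀ and vⱼ, and the minor the rest.
  Leading-det : ∀ {n} (u v : Fin n → ℤ) (M M′ : Fin n → Fin n → Λ) →
    (∀ i j → Leading (u i ℤ.+ v j) (M i j) (M′ i j)) → Leading (ℤ∑.sum u ℤ.+ ℤ∑.sum v) (det M) (det M′)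
  Leading-det {zero}  u v M M′ lead = Leading-homogeneous (con 1#)
  Leading-det {suc n} u v M M′ lead = Leading-sum (ℤ∑.sum u ℤ.+ ℤ∑.sum v)
    (λ j → sign j *Λ (M zero j *Λ det (minor M j))) (λ j → sign j *Λ (M′ zero j *Λ det (minor M′ j)))
    λ j → ≡.subst (λ z → Leading z (sign j *Λ (M zero j *Λ det (minor M j))) (sign j *Λ (M′ zero j *Λ det (minor M′ j))))
      (degree j)
      (Leading-* (+ 0) ((u zero ℤ.+ v j) ℤ.+ (ℤ∑.sum (u ∘ suc) ℤ.+ ℤ∑.sum (v ∘ punchIn j)))
        (Leading-homogeneous (sign-homogeneous j))
        (Leading-* (u zero ℤ.+ v j) (ℤ∑.sum (u ∘ suc) ℤ.+ ℤ∑.sum (v ∘ punchIn j)) (lead zero j)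
          (Leading-det (u ∘ suc) (v ∘ punchIn j) (minor M j) (minor M′ j) λ i k → lead (suc i) (punchIn j k))))
    where
    degree : ∀ j → + 0 ℤ.+ ((u zero ℤ.+ v j) ℤ.+ (ℤ∑.sum (u ∘ suc) ℤ.+ ℤ∑.sum (v ∘ punchIn j))) ≡ ℤ∑.sum u ℤ.+ ℤ∑.sum v
    degree j = ≡.trans
      (ℤS.solve 4 (λ a b x y → ℤS.con (+ 0) ℤS.:+ ((a ℤS.:+ b) ℤS.:+ (x ℤS.:+ y)) ℤS.:= (a ℤS.:+ x) ℤS.:+ (b ℤS.:+ y)) ≡.refl
        (u zero) (v j) (ℤ∑.sum (u ∘ suc)) (ℤ∑.sum (v ∘ punchIn j)))
      (≡.cong (ℤ._+_ (ℤ∑.sum u)) (≡.sym (ℤ∑.sum-remove {i = j} v)))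

  h-homogeneous : ∀ n → Homogeneous n (h n)
  h-homogeneous n = ≡.subst (Homogeneous n) (lookup-zero (h↓ n)) (lookups n zero)
    where
    lookups : ∀ k (i : Fin (suc k)) → Homogeneous (k ∸ toℕ i) (Vec.lookup (h↓ k) i)
    lookups zero    zero    = con 1#
    lookups (suc k) (suc i) = lookups k i
    lookups (suc k) zero    = mul (con (recip k)) (sum-homogeneous (λ i → 𝐩[1+ toℕ i ] *Λ Vec.lookup (h↓ k) i) λ i →
      ≡.subst (λ m → Homogeneous m (𝐩[1+ toℕ i ] *Λ Vec.lookup (h↓ k) i)) (≡.cong suc (ℕP.m+[n∸m]≡n (ℕP.≤-pred (FinP.toℕ<n i)))) (mul (𝐩 (toℕ i)) (lookups k i)))
      where
      sum-homogeneous : ∀ {n m} (G : Fin m → Λ) → (∀ i → Homogeneous n (G i)) → Homogeneous n (∑Λ G)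
      sum-homogeneous {m = zero}  G hom = nil
      sum-homogeneous {m = suc m} G hom = add (hom zero) (sum-homogeneous (G ∘ suc) (hom ∘ suc))

  hℤ-leading : ∀ z → Leading z (hℤ z) (hℤ z)
  hℤ-leading (+ n)    = Leading-homogeneous (h-homogeneous n)
  hℤ-leading -[1+ n ] = reflΛ , reflΛ

  -- Only the last summand has full degree, and its coefficient is e₀ = 1.
  h⟨⟩-leading : ∀ b z → Leading z (h⟨ b ⟩ z) (hℤ z)
  h⟨⟩-leading b -[1+ n ]  = reflΛ , reflΛ
  h⟨⟩-leading b (+ zero)  = Leading-homogeneous (con 1#)
  h⟨⟩-leading b (+ suc m) = h-homogeneous (suc m) , respF (symΛ (begin
    ∑Λ t -Λ h (suc m)                                ≈⟨ +-congʳ (sum-init-last t) ⟩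
    (S +Λ t (Fin.fromℕ m)) -Λ h (suc m)              ≈⟨ +-congʳ (+-congˡ last-term) ⟩
    (S +Λ h (suc m)) -Λ h (suc m)                    ≈⟨ solve 2 (λ s x → (s :+ x) :- x := s) reflΛ S (h (suc m)) ⟩
    S                                                ∎))
    (Fil-sum (t ∘ inject₁) λ i → homF
      (s≤s (ℕP.≤-trans (ℕP.≤-reflexive (≡.cong suc (FinP.toℕ-inject₁ i))) (FinP.toℕ<n i)))
      (mul (con (coefficient (m ∸ toℕ (inject₁ i)))) (h-homogeneous (pos (inject₁ i)))))
    where
    coefficient : ℕ → 𝕂
    coefficient e = ((K.- 1#) ^ᴷ e) K.* elementary {m} e (λ l → b (+ pos l))

    t : Fin (suc m) → Λ
    t i = con (coefficient (m ∸ toℕ i)) *Λ h (pos i)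

    S = ∑Λ (t ∘ inject₁)

    last-term : t (Fin.fromℕ m) ≈Λ h (suc m)
    last-term = begin
      con (coefficient (m ∸ toℕ (Fin.fromℕ m))) *Λ h (suc (toℕ (Fin.fromℕ m)))
        ≡⟨ ≡.cong (λ k → con (coefficient (m ∸ k)) *Λ h (suc k)) (FinP.toℕ-fromℕ m) ⟩
      con (coefficient (m ∸ m)) *Λ h (suc m)
        ≡⟨ ≡.cong (λ e → con (coefficient e) *Λ h (suc m)) (ℕP.n∸n≡0 m) ⟩
      con (1# K.* 1#) *Λ h (suc m)
        ≈⟨ *-congʳ (con-cong (K.*-identityˡ 1#)) ⟩
      1Λ *Λ h (suc m)
        ≈⟨ *-identityˡ _ ⟩
      h (suc m) ∎

  schurᴺ : ℕ → Diagram → Λ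
  schurᴺ N μ = det {N} λ i j → hℤ (+ row μ (pos i) ℤ.- + pos i ℤ.+ + pos j)

  s-leading : ∀ a N μ → ℓ μ ≤ N → Leading (+ ∣ μ ∣) (s⟨ a ⟩ N μ) (schurᴺ N μ)
  s-leading a N μ ℓ≤N = ≡.subst (λ z → Leading z (s⟨ a ⟩ N μ) (schurᴺ N μ)) (∑ℤ-Jacobi-Trudi μ N ℓ≤N)
    (Leading-det {N} (λ i → + row μ (pos i) ℤ.- + pos i) (λ j → + pos j) _ _ λ i j → h⟨⟩-leading (τ (+ 1 ℤ.- + pos j) a) (+ row μ (pos i) ℤ.- + pos i ℤ.+ + pos j))

  -- The Euler derivation Σ k 𝐩ₖ ∂/∂𝐩ₖ, with degree n as eigenvalue on homogeneous elements. It
  -- shows that a nonzero element has at most one degree, which is needed because `IsTopComponent`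
  -- leaves the degree existential.
  euler : Λ → Λ
  euler (con x)  = 0Λ
  euler 𝐩[1+ k ] = con (suc k · 1#) *Λ 𝐩[1+ k ]
  euler (F +Λ G) = euler F +Λ euler G
  euler (F *Λ G) = euler F *Λ G +Λ F *Λ euler G
  euler (-Λ F)   = -Λ euler F

  euler-cong : ∀ {F G} → F ≈Λ G → euler F ≈Λ euler G
  euler-cong reflΛ              = reflΛ
  euler-cong (symΛ p)           = symΛ (euler-cong p)
  euler-cong (transΛ p q)       = transΛ (euler-cong p) (euler-cong q)
  euler-cong (con-cong p)       = reflΛ
  euler-cong (Λᴰ.+-cong p q)    = +-cong (euler-cong p) (euler-cong q)
  euler-cong (Λᴰ.*-cong p q)    = +-cong (*-cong (euler-cong p) q) (*-cong p (euler-cong q))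
  euler-cong (Λᴰ.-‿cong p)      = -‿cong (euler-cong p)
  euler-cong (con-+ x y)        = symΛ (+-identityˡ 0Λ)
  euler-cong (con-* x y)        = symΛ (transΛ (+-cong (zeroˡ _) (zeroʳ _)) (+-identityˡ 0Λ))
  euler-cong (Λᴰ.+-assoc _ _ _) = +-assoc _ _ _
  euler-cong (Λᴰ.+-comm _ _)    = +-comm _ _
  euler-cong (Λᴰ.+-identity _)  = +-identityˡ _
  euler-cong (Λᴰ.-‿inverse _)   = -‿inverseˡ _
  euler-cong (Λᴰ.*-assoc F G H) =
    solve 6 (λ f g h f′ g′ h′ → (f′ :* g :+ f :* g′) :* h :+ (f :* g) :* h′ := f′ :* (g :* h) :+ f :* (g′ :* h :+ g :* h′))
      reflΛ F G H (euler F) (euler G) (euler H)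
  euler-cong (Λᴰ.*-comm F G)    = solve 4 (λ f g f′ g′ → f′ :* g :+ f :* g′ := g′ :* f :+ g :* f′) reflΛ F G (euler F) (euler G)
  euler-cong (Λᴰ.*-identity F)  = transΛ (+-cong (zeroˡ F) (*-identityˡ _)) (+-identityˡ _)
  euler-cong (Λᴰ.distrib F G H) =
    solve 6 (λ f g h f′ g′ h′ → f′ :* (g :+ h) :+ f :* (g′ :+ h′) := (f′ :* g :+ f :* g′) :+ (f′ :* h :+ f :* h′))
      reflΛ F G H (euler F) (euler G) (euler H)

  euler-homogeneous : ∀ {n F} → Homogeneous n F → euler F ≈Λ con (n · 1#) *Λ F
  euler-homogeneous nil     = symΛ (zeroʳ _)
  euler-homogeneous (con x) = symΛ (zeroˡ _)
  euler-homogeneous (𝐩 k)   = reflΛ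
  euler-homogeneous (add {F = F} {G} f g) = transΛ (+-cong (euler-homogeneous f) (euler-homogeneous g)) (symΛ (distribˡ _ F G))
  euler-homogeneous (mul {m} {n} {F} {G} f g) = begin
    euler F *Λ G +Λ F *Λ euler G
      ≈⟨ +-cong (*-congʳ (euler-homogeneous f)) (*-congˡ (euler-homogeneous g)) ⟩
    (con (m · 1#) *Λ F) *Λ G +Λ F *Λ (con (n · 1#) *Λ G)
      ≈⟨ solve 4 (λ x y f g → (x :* f) :* g :+ f :* (y :* g) := (x :+ y) :* (f :* g)) reflΛ (con (m · 1#)) (con (n · 1#)) F G ⟩
    (con (m · 1#) +Λ con (n · 1#)) *Λ (F *Λ G)
      ≈⟨ *-congʳ (transΛ (symΛ (con-+ _ _)) (con-cong (K.sym (·-homo-+ 1# m n)))) ⟩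
    con ((m ℕ.+ n) · 1#) *Λ (F *Λ G) ∎
  euler-homogeneous (resp eq f) = transΛ (symΛ (euler-cong eq)) (transΛ (euler-homogeneous f) (*-congˡ eq))

  con-inverse : ∀ k F → con (recip k) *Λ (con (suc k · 1#) *Λ F) ≈Λ F
  con-inverse k F = begin
    con (recip k) *Λ (con (suc k · 1#) *Λ F)     ≈⟨ *-assoc _ _ _ ⟨
    (con (recip k) *Λ con (suc k · 1#)) *Λ F     ≈⟨ *-congʳ (symΛ (con-* _ _)) ⟩
    con (recip k K.* (suc k · 1#)) *Λ F          ≈⟨ *-congʳ (con-cong (recip-inverse k)) ⟩
    1Λ *Λ F                                      ≈⟨ *-identityˡ F ⟩
    F                                            ∎
    where open Evaluation 𝕜 char0 using (recip-inverse)

  -- F would be an eigenvector for m and for m + k + 1, and the difference of the two is invertible.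
  homogeneous-<⇒≈0 : ∀ m k {F} → Homogeneous m F → Homogeneous (m ℕ.+ suc k) F → F ≈Λ 0Λ
  homogeneous-<⇒≈0 m k {F} hom hom′ = begin
    F                                               ≈⟨ con-inverse k F ⟨
    con (recip k) *Λ (con (suc k · 1#) *Λ F)        ≈⟨ *-congˡ vanish ⟩
    con (recip k) *Λ 0Λ                             ≈⟨ zeroʳ _ ⟩
    0Λ                                              ∎
    where
    vanish : con (suc k · 1#) *Λ F ≈Λ 0Λ
    vanish = begin
      con (suc k · 1#) *Λ F
        ≈⟨ solve 3 (λ x y f → y :* f := (x :+ y) :* f :- x :* f) reflΛ (con (m · 1#)) (con (suc k · 1#)) F ⟩
      (con (m · 1#) +Λ con (suc k · 1#)) *Λ F -Λ con (m · 1#) *Λ F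
        ≈⟨ +-congʳ (*-congʳ (transΛ (con-cong (·-homo-+ 1# m (suc k))) (con-+ _ _))) ⟨
      con ((m ℕ.+ suc k) · 1#) *Λ F -Λ con (m · 1#) *Λ F
        ≈⟨ +-cong (euler-homogeneous hom′) (-‿cong (euler-homogeneous hom)) ⟨
      euler F -Λ euler F
        ≈⟨ -‿inverseʳ _ ⟩
      0Λ ∎

  degree-unique : ∀ {m n F} → Homogeneous m F → Homogeneous n F → ¬ F ≈Λ 0Λ → m ≡ n
  degree-unique {m} {n} {F} hom hom′ F≉0 with ℕP.<-cmp m n
  ... | tri≈ _ m≡n _ = m≡n
  ... | tri< m<n _ _ = contradiction (homogeneous-<⇒≈0 m (n ∸ suc m) hom
          (≡.subst (λ k → Homogeneous k F) (≡.trans (≡.sym (ℕP.m+[n∸m]≡n m<n)) (≡.sym (ℕP.+-suc m _))) hom′)) F≉0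
  ... | tri> _ _ n<m = contradiction (homogeneous-<⇒≈0 n (m ∸ suc n) hom′
          (≡.subst (λ k → Homogeneous k F) (≡.trans (≡.sym (ℕP.m+[n∸m]≡n n<m)) (≡.sym (ℕP.+-suc n _))) hom)) F≉0

-- Schur functions span Λ.

module Spanning {c ℓ₁ ℓ₂} (𝕜 : HeytingField c ℓ₁ ℓ₂) (char0 : CharacteristicZero 𝕜) where
  open SymmetricFunctions 𝕜 char0 hiding (+-assoc; +-comm; +-cong; *-cong; *-assoc; *-comm; *-identity; +-identity; distrib; -‿cong; -‿inverse)
  private
    module K = CommutativeRing 𝕜-ring
  open K using (1#) renaming (Carrier to 𝕂)
  open CommutativeRing Λ-ring using (+-assoc; +-comm; +-cong; +-congˡ; +-congʳ; *-cong; *-congˡ; *-congʳ; *-assoc; *-comm;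
    *-identityˡ; *-identityʳ; +-identityˡ; +-identityʳ; distribˡ; distribʳ; -‿cong; zeroˡ; zeroʳ;
    reflexive; setoid; ring; semiring)
  open SemiringSum semiring using (sum-cong-≋; sum-init-last; *-distribˡ-sum)
  open SemiringMult K.semiring using () renaming (_×_ to _·_)
  open DeterminantProperties Λ-ring using (sign; minor; det-cong; zero-term′)
  open Evaluation 𝕜 char0 using (eval-cong)
  open Values 𝕜 char0 using (s-vanishes; s-value; boxProduct-nonzero; zero-product)
  open Degrees 𝕜 char0
  open IntegerSolver Λ-ring renaming (con to conˢ)
  open import Relation.Binary.Reasoning.Setoid setoid

  lookup-h↓ : ∀ k (i : Fin (suc k)) → Vec.lookup (h↓ k) i ≡ h (k ∸ toℕ i)
  lookup-h↓ k       zero    = lookup-zero (h↓ k)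
  lookup-h↓ (suc k) (suc i) = lookup-h↓ k i

  -- A weak form of the fact that the hₖ generate Λ: one factor of positive index is split off and
  -- the cofactor remains an arbitrary homogeneous element, to which an induction on the degree
  -- applies.
  data HDecomposition : ℕ → Λ → Set (c ⊔ ℓ₁) where
    scalar : ∀ x → HDecomposition 0 (con x)
    h-mul  : ∀ {n G} m k → n ≡ suc m ℕ.+ k → Homogeneous k G → HDecomposition n (h (suc m) *Λ G)
    zeroD  : ∀ {n} → HDecomposition n 0Λ
    addD   : ∀ {n F G} → HDecomposition n F → HDecomposition n G → HDecomposition n (F +Λ G)
    respD  : ∀ {n F G} → F ≈Λ G → HDecomposition n F → HDecomposition n G

  scaleD : ∀ {n F} x → HDecomposition n F → HDecomposition n (con x *Λ F)
  scaleD x (scalar y)       = respD (con-* x y) (scalar (x K.* y))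
  scaleD x (h-mul {G = G} m k n≡ hom) = respD (solve 3 (λ x h g → h :* (x :* g) := x :* (h :* g)) reflΛ (con x) (h (suc m)) G)
                                (h-mul m k n≡ (mul (con x) hom))
  scaleD x zeroD            = respD (symΛ (zeroʳ _)) zeroD
  scaleD x (addD f g)       = respD (symΛ (distribˡ _ _ _)) (addD (scaleD x f) (scaleD x g))
  scaleD x (respD eq f)     = respD (*-congˡ eq) (scaleD x f)

  mulD : ∀ {m n F G} → HDecomposition m F → Homogeneous n G → HDecomposition n G → HDecomposition (m ℕ.+ n) (F *Λ G)
  mulD (scalar x)         hom dec = scaleD x dec
  mulD {n = n} (h-mul m k n≡ f) hom dec = respD (symΛ (*-assoc _ _ _))
    (h-mul m (k ℕ.+ n) (≡.trans (≡.cong (ℕ._+ n) n≡) (ℕP.+-assoc (suc m) k n)) (mul f hom))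
  mulD zeroD              hom dec = respD (symΛ (zeroˡ _)) zeroD
  mulD (addD f g)         hom dec = respD (symΛ (distribʳ _ _ _)) (addD (mulD f hom dec) (mulD g hom dec))
  mulD (respD eq f)       hom dec = respD (*-congʳ eq) (mulD f hom dec)

  sumD : ∀ {n k} (G : Fin k → Λ) → (∀ i → HDecomposition n (G i)) → HDecomposition n (∑Λ G)
  sumD {k = zero}  G dec = zeroD
  sumD {k = suc k} G dec = addD (dec zero) (sumD (G ∘ suc) (dec ∘ suc))

  homogeneous⇒HDecomposition : ∀ {n F} → Homogeneous n F → HDecomposition n F
  homogeneous⇒HDecomposition nil         = zeroD
  homogeneous⇒HDecomposition (con x)     = scalar x
  homogeneous⇒HDecomposition (add f g)   = addD (homogeneous⇒HDecomposition f) (homogeneous⇒HDecomposition g)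
  homogeneous⇒HDecomposition (mul f g)   = mulD (homogeneous⇒HDecomposition f) g (homogeneous⇒HDecomposition g)
  homogeneous⇒HDecomposition (resp eq f) = respD eq (homogeneous⇒HDecomposition f)
  -- Newton's identity solved for its last power sum, whose cofactor is h₀ = 1. Every other summand
  -- contains some h of positive index.
  homogeneous⇒HDecomposition (𝐩 k)       = respD newton (addD
    (h-mul k 0 (≡.sym (ℕP.+-identityʳ (suc k))) (con (suc k · 1#)))
    (respD (con-neg S) (scaleD (K.- 1#) (sumD (t ∘ inject₁) λ i → respD (term i)
      (h-mul (k ∸ suc (toℕ i)) (suc (toℕ i)) (≡.cong suc (≡.sym (ℕP.m∸n+n≡m (FinP.toℕ<n i)))) (𝐩 (toℕ i)))))))
    where
    t : Fin (suc k) → Λ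
    t i = 𝐩[1+ toℕ i ] *Λ Vec.lookup (h↓ k) i

    S = ∑Λ (t ∘ inject₁)

    term : ∀ i → h (suc (k ∸ suc (toℕ i))) *Λ 𝐩[1+ toℕ i ] ≈Λ t (inject₁ i)
    term i = begin
      h (suc (k ∸ suc (toℕ i))) *Λ 𝐩[1+ toℕ i ]
        ≈⟨ *-comm _ _ ⟩
      𝐩[1+ toℕ i ] *Λ h (suc (k ∸ suc (toℕ i)))
        ≡⟨ ≡.cong (λ m → 𝐩[1+ toℕ i ] *Λ h m) (ℕP.+-∸-assoc 1 (FinP.toℕ<n i)) ⟨
      𝐩[1+ toℕ i ] *Λ h (k ∸ toℕ i)
        ≡⟨ ≡.cong (λ m → 𝐩[1+ m ] *Λ h (k ∸ m)) (FinP.toℕ-inject₁ i) ⟨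
      𝐩[1+ toℕ (inject₁ i) ] *Λ h (k ∸ toℕ (inject₁ i))
        ≡⟨ ≡.cong (𝐩[1+ toℕ (inject₁ i) ] *Λ_) (lookup-h↓ k (inject₁ i)) ⟨
      t (inject₁ i) ∎

    t-last : t (Fin.fromℕ k) ≈Λ 𝐩[1+ k ]
    t-last = begin
      𝐩[1+ toℕ (Fin.fromℕ k) ] *Λ Vec.lookup (h↓ k) (Fin.fromℕ k)
        ≡⟨ ≡.cong (𝐩[1+ toℕ (Fin.fromℕ k) ] *Λ_) (lookup-h↓ k (Fin.fromℕ k)) ⟩
      𝐩[1+ toℕ (Fin.fromℕ k) ] *Λ h (k ∸ toℕ (Fin.fromℕ k))
        ≡⟨ ≡.cong (λ m → 𝐩[1+ m ] *Λ h (k ∸ m)) (FinP.toℕ-fromℕ k) ⟩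
      𝐩[1+ k ] *Λ h (k ∸ k)
        ≡⟨ ≡.cong (λ m → 𝐩[1+ k ] *Λ h m) (ℕP.n∸n≡0 k) ⟩
      𝐩[1+ k ] *Λ 1Λ
        ≈⟨ *-identityʳ _ ⟩
      𝐩[1+ k ] ∎

    newton : h (suc k) *Λ con (suc k · 1#) +Λ -Λ S ≈Λ 𝐩[1+ k ]
    newton = begin
      h (suc k) *Λ con (suc k · 1#) +Λ -Λ S
        ≈⟨ +-congʳ (solve 3 (λ r s x → (r :* s) :* x := r :* (x :* s)) reflΛ (con (recip k)) (∑Λ t) (con (suc k · 1#))) ⟩
      con (recip k) *Λ (con (suc k · 1#) *Λ ∑Λ t) +Λ -Λ S
        ≈⟨ +-congʳ (transΛ (con-inverse k (∑Λ t)) (sum-init-last t)) ⟩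
      (S +Λ t (Fin.fromℕ k)) +Λ -Λ S
        ≈⟨ solve 2 (λ s x → (s :+ x) :- s := x) reflΛ S (t (Fin.fromℕ k)) ⟩
      t (Fin.fromℕ k)
        ≈⟨ t-last ⟩
      𝐩[1+ k ] ∎

  data SchurSpan (n : ℕ) : Λ → Set (c ⊔ ℓ₁) where
    basis : ∀ ν → ∣ ν ∣ ≡ n → SchurSpan n (schur ν)
    zeroS : SchurSpan n 0Λ
    addS  : ∀ {F G} → SchurSpan n F → SchurSpan n G → SchurSpan n (F +Λ G)
    scale : ∀ x {F} → SchurSpan n F → SchurSpan n (con x *Λ F)
    respS : ∀ {F G} → F ≈Λ G → SchurSpan n F → SchurSpan n G

  negS : ∀ {n F} → SchurSpan n F → SchurSpan n (-Λ F)
  negS f = respS (con-neg _) (scale (K.- 1#) f)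

  sumS : ∀ {n k} (G : Fin k → Λ) → (∀ i → SchurSpan n (G i)) → SchurSpan n (∑Λ G)
  sumS {k = zero}  G span = zeroS
  sumS {k = suc k} G span = addS (span zero) (sumS (G ∘ suc) (span ∘ suc))

  signS : ∀ {n k F} (j : Fin k) → SchurSpan n F → SchurSpan n (sign j *Λ F)
  signS zero    f = respS (symΛ (*-identityˡ _)) f
  signS (suc j) f = respS (solve 2 (λ s f → :- (s :* f) := (:- conˢ (+ 1) :* s) :* f) reflΛ (sign j) _) (negS (signS j f))

  mulS : ∀ {k n G} H → (∀ ν → ∣ ν ∣ ≡ k → SchurSpan n (H *Λ schur ν)) → SchurSpan k G → SchurSpan n (H *Λ G)
  mulS H base (basis ν ν≡) = base ν ν≡
  mulS H base zeroS        = respS (symΛ (zeroʳ _)) zeroS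
  mulS H base (addS f g)   = respS (symΛ (distribˡ _ _ _)) (addS (mulS H base f) (mulS H base g))
  mulS H base (scale x {F} f) = respS (solve 3 (λ x h f → x :* (h :* f) := h :* (x :* f)) reflΛ (con x) H F) (scale x (mulS H base f))
  mulS H base (respS eq f) = respS (*-congˡ eq) (mulS H base f)

  jacobiTrudi : (μ : Diagram) → Fin (ℓ μ) → Fin (ℓ μ) → Λ
  jacobiTrudi μ i j = hℤ (+ row μ (pos i) ℤ.- + pos i ℤ.+ + pos j)

  first-index : ∀ v j → + v ℤ.- + 1 ℤ.+ + suc j ≡ + (v ℕ.+ j)
  first-index v j = ℤS.solve 2 (λ v j → (v ℤS.:- ℤS.con (+ 1)) ℤS.:+ (ℤS.con (+ 1) ℤS.:+ j) ℤS.:= v ℤS.:+ j) ≡.refl (+ v) (+ j)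

  -- The degree of the minor is what the first-row entry leaves of the number of boxes. It may be
  -- negative, and then `Leading` says that the minor is zero.
  minor-degree : ∀ {v xs link nz} (let κ = mkDiagram (v ∷ xs) link nz) (j : Fin (ℓ κ)) →
    Σ[ z ∈ ℤ ] + (v ℕ.+ toℕ j) ℤ.+ z ≡ + ∣ κ ∣ × Leading z (det (minor (jacobiTrudi κ) j)) (det (minor (jacobiTrudi κ) j))
  minor-degree {v} {xs} {link} {nz} j = z , degree ,
    Leading-det (u ∘ suc) (w ∘ punchIn j) _ _ λ i k → hℤ-leading (u (suc i) ℤ.+ w (punchIn j k))
    where
    κ = mkDiagram (v ∷ xs) link nz

    u w : Fin (ℓ κ) → ℤ
    u i = + row κ (pos i) ℤ.- + pos i
    w k = + pos k

    z = ℤ∑.sum (u ∘ suc) ℤ.+ ℤ∑.sum (w ∘ punchIn j)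

    degree : + (v ℕ.+ toℕ j) ℤ.+ z ≡ + ∣ κ ∣
    degree = ≡.trans (≡.cong (ℤ._+ z) (≡.sym (first-index v (toℕ j))))
      (≡.trans
        (ℤS.solve 4 (λ a b x y → (a ℤS.:+ b) ℤS.:+ (x ℤS.:+ y) ℤS.:= (a ℤS.:+ x) ℤS.:+ (b ℤS.:+ y)) ≡.refl
          (u zero) (w j) (ℤ∑.sum (u ∘ suc)) (ℤ∑.sum (w ∘ punchIn j)))
        (≡.trans (≡.cong (ℤ._+_ (ℤ∑.sum u)) (≡.sym (ℤ∑.sum-remove {i = j} w)))
          (∑ℤ-Jacobi-Trudi κ (ℓ κ) ℕP.≤-refl)))

  first-row : ∀ {v xs link nz} (let κ = mkDiagram (v ∷ xs) link nz) →
    schur κ ≈Λ ∑Λ λ j → sign j *Λ (h (v ℕ.+ toℕ j) *Λ det (minor (jacobiTrudi κ) j))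
  first-row {v} {xs} {link} {nz} = sum-cong-≋ λ j →
    *-congˡ {sign j} (*-congʳ {det (minor (jacobiTrudi (mkDiagram (v ∷ xs) link nz)) j)} (reflexive (≡.cong hℤ (first-index v (toℕ j)))))

  ∷-linked : ∀ {v xs} → nth xs 0 ≤ v → Linked _≥_ xs → Linked _≥_ (v ∷ xs)
  ∷-linked {xs = []}    _   _    = [-]
  ∷-linked {xs = _ ∷ _} x≤v link = x≤v ∷ link

  minor-zero : ∀ {v xs link nz link′ nz′} →
    det (minor (jacobiTrudi (mkDiagram (v ∷ xs) link nz)) zero) ≈Λ schur (mkDiagram xs link′ nz′)
  minor-zero {v} {xs} = det-cong {length xs} λ i j → reflexive (≡.cong hℤ
    (ℤS.solve 3 (λ r i j → (r ℤS.:- (ℤS.con (+ 1) ℤS.:+ i)) ℤS.:+ (ℤS.con (+ 1) ℤS.:+ j) ℤS.:= (r ℤS.:- i) ℤS.:+ j) ≡.refl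
      (+ nth xs (toℕ i)) (+ pos i) (+ pos j)))

  -- hₘ s_ν is expanded along the first row of s_{(m, ν)} if ν₁ ≤ m, and
  -- along the first row of s_ν if ν₁ > m; this leaves products of some hₘ′,
  -- m′ > m, with elements of lower degree.
  homogeneous⇒SchurSpan : ∀ n {F} → Homogeneous n F → SchurSpan n F
  homogeneous⇒SchurSpan = <-rec _ outer
    where
    outer : ∀ n → (∀ {n′} → n′ < n → ∀ {F} → Homogeneous n′ F → SchurSpan n′ F) →
      ∀ {F} → Homogeneous n F → SchurSpan n F
    outer n below hom = combine (homogeneous⇒HDecomposition hom)
      where
      Claim : ℕ → Set _
      Claim k = ∀ m G → n ≡ suc m ℕ.+ k → Homogeneous k G → SchurSpan n (h (suc m) *Λ G)

      smaller-term : ∀ {k} → (∀ {k′} → k′ < k → Claim k′) → ∀ m q z {D} → + suc q ℤ.+ z ≡ + k →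
        n ≡ suc m ℕ.+ k → Leading z D D → SchurSpan n (h (suc m ℕ.+ suc q) *Λ D)
      smaller-term inner m q -[1+ _ ] eq n≡ (D≈0 , _) = respS (symΛ (transΛ (*-congˡ D≈0) (zeroʳ _))) zeroS
      smaller-term inner m q (+ k′) {D} eq n≡ (hom , _) = inner
        (≡.subst (k′ <_) (ℤP.+-injective eq) (s≤s (ℕP.m≤n+m k′ q))) (m ℕ.+ suc q) D
        (≡.trans n≡ (≡.cong suc (≡.trans (≡.cong (m ℕ.+_) (≡.sym (ℤP.+-injective eq))) (≡.sym (ℕP.+-assoc m (suc q) k′))))) hom

      schur-term : ∀ k → (∀ {k′} → k′ < k → Claim k′) → ∀ m → n ≡ suc m ℕ.+ k →
        ∀ ν → ∣ ν ∣ ≡ k → SchurSpan n (h (suc m) *Λ schur ν)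
      schur-term k inner m n≡ (mkDiagram xs link nz) ν≡ with nth xs 0 ℕP.≤? suc m
      ... | yes x≤m = respS split (addS (basis κ κ≡) (negS (sumS (t ∘ suc) later)))
        where
        κ = mkDiagram (suc m ∷ xs) (∷-linked x≤m link) (_ ∷ nz)

        κ≡ : ∣ κ ∣ ≡ n
        κ≡ = ≡.trans (≡.cong (suc m ℕ.+_) ν≡) (≡.sym n≡)

        t : Fin (ℓ κ) → Λ
        t j = sign j *Λ (h (suc m ℕ.+ toℕ j) *Λ det (minor (jacobiTrudi κ) j))

        t₀ : t zero ≈Λ h (suc m) *Λ schur (mkDiagram xs link nz)
        t₀ = transΛ (*-identityˡ _) (*-cong (reflexive (≡.cong h (ℕP.+-identityʳ (suc m))))
          (minor-zero {suc m} {xs} {∷-linked x≤m link} {_ ∷ nz} {link} {nz}))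

        split : schur κ -Λ ∑Λ (t ∘ suc) ≈Λ h (suc m) *Λ schur (mkDiagram xs link nz)
        split = begin
          schur κ -Λ ∑Λ (t ∘ suc)                   ≈⟨ +-congʳ (first-row {suc m} {xs} {∷-linked x≤m link} {_ ∷ nz}) ⟩
          (t zero +Λ ∑Λ (t ∘ suc)) -Λ ∑Λ (t ∘ suc)  ≈⟨ solve 2 (λ x s → (x :+ s) :- s := x) reflΛ (t zero) (∑Λ (t ∘ suc)) ⟩
          t zero                                    ≈⟨ t₀ ⟩
          h (suc m) *Λ schur (mkDiagram xs link nz) ∎

        later : ∀ j → SchurSpan n (t (suc j))
        later j with minor-degree {suc m} {xs} {∷-linked x≤m link} {_ ∷ nz} (suc j)
        ... | z , degree , lead = signS (suc j) (smaller-term inner m (toℕ j) z shifted n≡ lead)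
          where
          shifted : + suc (toℕ j) ℤ.+ z ≡ + k
          shifted = ℤ-cancel (suc m) (+ suc (toℕ j) ℤ.+ z) k (≡.trans (≡.sym (ℤP.+-assoc (+ suc m) (+ suc (toℕ j)) z))
            (≡.trans degree (≡.cong +_ (≡.cong (suc m ℕ.+_) ν≡))))
            where
            ℤ-cancel : ∀ a x k → + a ℤ.+ x ≡ + (a ℕ.+ k) → x ≡ + k
            ℤ-cancel a x k eq = ≡.trans
              (ℤS.solve 2 (λ a x → x ℤS.:= (a ℤS.:+ x) ℤS.:- a) ≡.refl (+ a) x)
              (≡.trans (≡.cong (ℤ._- + a) eq) (ℤS.solve 2 (λ a k → (a ℤS.:+ k) ℤS.:- a ℤS.:= k) ≡.refl (+ a) (+ k)))
      schur-term k inner m n≡ (mkDiagram [] link nz) ν≡ | no x≰m = contradiction z≤n x≰m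
      schur-term k inner m n≡ (mkDiagram (zero ∷ xs) link nz) ν≡ | no x≰m = contradiction z≤n x≰m
      schur-term k inner m n≡ (mkDiagram (suc v ∷ xs) link nz) ν≡ | no x≰m = respS split (sumS t term)
        where
        ν = mkDiagram (suc v ∷ xs) link nz

        D : Fin (ℓ ν) → Λ
        D j = det (minor (jacobiTrudi ν) j)

        t : Fin (ℓ ν) → Λ
        t j = sign j *Λ (h (suc v ℕ.+ toℕ j) *Λ (h (suc m) *Λ D j))

        split : ∑Λ t ≈Λ h (suc m) *Λ schur ν
        split = begin
          ∑Λ t
            ≈⟨ sum-cong-≋ (λ j → solve 4 (λ s a b d → s :* (a :* (b :* d)) := b :* (s :* (a :* d))) reflΛ
                 (sign j) (h (suc v ℕ.+ toℕ j)) (h (suc m)) (D j)) ⟩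
          ∑Λ (λ j → h (suc m) *Λ (sign j *Λ (h (suc v ℕ.+ toℕ j) *Λ D j)))
            ≈⟨ *-distribˡ-sum (h (suc m)) (λ j → sign j *Λ (h (suc v ℕ.+ toℕ j) *Λ D j)) ⟨
          h (suc m) *Λ ∑Λ (λ j → sign j *Λ (h (suc v ℕ.+ toℕ j) *Λ D j))
            ≈⟨ *-congˡ (first-row {suc v} {xs} {link} {nz}) ⟨
          h (suc m) *Λ schur ν ∎

        m≤v : suc m ≤ v
        m≤v = ℕP.≤-pred (ℕP.≰⇒> x≰m)

        term : ∀ j → SchurSpan n (t j)
        term j with minor-degree {suc v} {xs} {link} {nz} j
        ... | -[1+ _ ] , _ , (D≈0 , _) = respS (symΛ (zero-term′ (sign j) (h (suc v ℕ.+ toℕ j)) (transΛ (*-congˡ D≈0) (zeroʳ _)))) zeroS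
        -- The entry of s_ν takes over as the factor split off, and the old factor joins the minor.
        -- The new cofactor has degree below k because the entry has the larger index.
        ... | + k′ , degree , (hom , _) = signS j (inner
                (≡.subst (suc (suc m ℕ.+ k′) ≤_) k≡ (s≤s (ℕP.+-monoˡ-≤ k′ (ℕP.≤-trans m≤v (ℕP.m≤m+n v (toℕ j))))))
                (v ℕ.+ toℕ j) (h (suc m) *Λ D j) n≡′ (mul (h-homogeneous (suc m)) hom))
          where
          k≡ : suc (v ℕ.+ toℕ j) ℕ.+ k′ ≡ k
          k≡ = ≡.trans (ℤP.+-injective degree) ν≡

          n≡′ : n ≡ suc (v ℕ.+ toℕ j) ℕ.+ (suc m ℕ.+ k′)
          n≡′ = ≡.trans n≡ (≡.trans (≡.cong (suc m ℕ.+_) (≡.sym k≡))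
            (≡.trans (≡.sym (ℕP.+-assoc (suc m) (suc (v ℕ.+ toℕ j)) k′))
              (≡.trans (≡.cong (ℕ._+ k′) (ℕP.+-comm (suc m) (suc (v ℕ.+ toℕ j)))) (ℕP.+-assoc (suc (v ℕ.+ toℕ j)) (suc m) k′))))

      claim : ∀ k → Claim k
      claim = <-rec _ λ k inner m G n≡ hom → mulS (h (suc m)) (schur-term k inner m n≡)
        (below (≡.subst (k <_) (≡.sym n≡) (s≤s (ℕP.m≤n+m k m))) hom)

      combine : ∀ {F} → HDecomposition n F → SchurSpan n F
      combine (scalar x)         = respS (*-identityʳ (con x)) (scale x (basis (mkDiagram [] [] []) ≡.refl))
      combine (h-mul {G = G} m k n≡ hom) = claim k m G n≡ hom
      combine zeroD              = zeroS
      combine (addD f g)         = addS (combine f) (combine g)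
      combine (respD eq f)       = respS eq (combine f)

  -- Linear combinations of the s_{ν;a} and uniqueness.

  module _ (a : Sequence) where

    S : Diagram → Λ
    S μ = s⟨ a ⟩ (ℓ μ) μ

    combination : List (𝕂 × Diagram) → Λ
    combination []            = 0Λ
    combination ((x , ν) ∷ L) = con x *Λ S ν +Λ combination L

    combination-++ : ∀ L L′ → combination (L ++ L′) ≈Λ combination L +Λ combination L′
    combination-++ []            L′ = symΛ (+-identityˡ _)
    combination-++ ((x , ν) ∷ L) L′ = transΛ (+-congˡ (combination-++ L L′)) (symΛ (+-assoc _ _ _))

    scaleL : 𝕂 → List (𝕂 × Diagram) → List (𝕂 × Diagram)
    scaleL x = List.map λ (y , ν) → x K.* y , ν

    combination-scaleL : ∀ x L → combination (scaleL x L) ≈Λ con x *Λ combination L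
    combination-scaleL x []            = symΛ (zeroʳ _)
    combination-scaleL x ((y , ν) ∷ L) = transΛ (+-cong (transΛ (*-congʳ (con-* x y)) (*-assoc _ _ _)) (combination-scaleL x L)) (symΛ (distribˡ _ _ _))

    Sizes : (ℕ → Set) → List (𝕂 × Diagram) → Set _
    Sizes P = All λ (_ , ν) → P ∣ ν ∣

    Combination : ℕ → Λ → Set _
    Combination n F = Σ[ L ∈ List (𝕂 × Diagram) ] Sizes (_< n) L × F ≈Λ combination L

    addC : ∀ {n F G} → Combination n F → Combination n G → Combination n (F +Λ G)
    addC (L , L< , eq) (L′ , L′< , eq′) = L ++ L′ , AllP.++⁺ L< L′< , transΛ (+-cong eq eq′) (symΛ (combination-++ L L′))

    scaleC : ∀ {n F} x → Combination n F → Combination n (con x *Λ F)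
    scaleC x (L , L< , eq) = scaleL x L , AllP.map⁺ L< , transΛ (*-congˡ eq) (symΛ (combination-scaleL x L))

    respC : ∀ {n F G} → F ≈Λ G → Combination n F → Combination n G
    respC F≈G (L , L< , eq) = L , L< , transΛ (symΛ F≈G) eq

    -- A Schur function is s_{ν;a} minus an element of lower degree, which is a combination by
    -- induction on the bound.
    Fil⇒Combination : ∀ n {F} → Fil n F → Combination n F
    Fil⇒Combination zero    f = [] , [] , Fil-0⇒≈0 f
    Fil⇒Combination (suc n) zeroF        = [] , [] , reflΛ
    Fil⇒Combination (suc n) (addF f g)   = addC (Fil⇒Combination (suc n) f) (Fil⇒Combination (suc n) g)
    Fil⇒Combination (suc n) (respF eq f) = respC eq (Fil⇒Combination (suc n) f)
    Fil⇒Combination (suc n) (homF {m} (s≤s m≤n) hom) = fromSpan (homogeneous⇒SchurSpan m hom)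
      where
      fromSpan : ∀ {G} → SchurSpan m G → Combination (suc n) G
      fromSpan (basis ν ≡.refl) with s-leading a (ℓ ν) ν ℕP.≤-refl
      ... | _ , lower with Fil⇒Combination n (Fil-weaken m≤n lower)
      ...   | L , L< , eq = respC
                (transΛ (+-cong (*-identityˡ (S ν)) (con-neg _)) (solve 2 (λ s t → s :- (s :- t) := t) reflΛ (S ν) (schur ν)))
                (addC ((1# , ν) ∷ [] , s≤s m≤n ∷ [] , symΛ (+-identityʳ _))
                      (scaleC (K.- 1#) (L , All.map ℕP.m<n⇒m<1+n L< , eq)))
      fromSpan zeroS        = [] , [] , reflΛ
      fromSpan (addS f g)   = addC (fromSpan f) (fromSpan g)
      fromSpan (scale x f)  = scaleC x (fromSpan f)
      fromSpan (respS eq f) = respC eq (fromSpan f)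

    minimal : ∀ x ν L → Σ[ μ ∈ Diagram ]
      Any (λ (_ , κ) → parts κ ≡ parts μ) ((x , ν) ∷ L) × Sizes (∣ μ ∣ ≤_) ((x , ν) ∷ L)
    minimal x ν []            = ν , here ≡.refl , ℕP.≤-refl ∷ []
    minimal x ν ((y , κ) ∷ L) with minimal y κ L
    ... | μ , found , least with ℕP.≤-total ∣ ν ∣ ∣ μ ∣
    ...   | inj₁ ν≤μ = ν , here ≡.refl , ℕP.≤-refl ∷ All.map (ℕP.≤-trans ν≤μ) least
    ...   | inj₂ μ≤ν = μ , there found , μ≤ν ∷ least

    -- A list may repeat a diagram, so all occurrences are collected. Diagrams are compared by their
    -- parts, on which alone `S` depends.
    coefficient : Diagram → List (𝕂 × Diagram) → 𝕂
    coefficient μ []            = K.0#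
    coefficient μ ((x , ν) ∷ L) with ListP.≡-dec ℕP._≟_ (parts ν) (parts μ)
    ... | yes _ = x K.+ coefficient μ L
    ... | no  _ = coefficient μ L

    remove : Diagram → List (𝕂 × Diagram) → List (𝕂 × Diagram)
    remove μ []            = []
    remove μ ((x , ν) ∷ L) with ListP.≡-dec ℕP._≟_ (parts ν) (parts μ)
    ... | yes _ = remove μ L
    ... | no  _ = (x , ν) ∷ remove μ L

    remove-All : ∀ {p} {P : 𝕂 × Diagram → Set p} μ {L} → All P L → All P (remove μ L)
    remove-All μ []                      = []
    remove-All μ (_∷_ {x = x , ν} px all) with ListP.≡-dec ℕP._≟_ (parts ν) (parts μ)
    ... | yes _ = remove-All μ all
    ... | no  _ = px ∷ remove-All μ all

    remove-≢ : ∀ μ L → All (λ (_ , ν) → μ ≢ᴰ ν) (remove μ L)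
    remove-≢ μ []            = []
    remove-≢ μ ((x , ν) ∷ L) with ListP.≡-dec ℕP._≟_ (parts ν) (parts μ)
    ... | yes _   = remove-≢ μ L
    ... | no  ν≢μ = (ν≢μ ∘ ≡.sym) ∷ remove-≢ μ L

    remove-≤ : ∀ μ L → length (remove μ L) ≤ length L
    remove-≤ μ []            = z≤n
    remove-≤ μ ((x , ν) ∷ L) with ListP.≡-dec ℕP._≟_ (parts ν) (parts μ)
    ... | yes _ = ℕP.m≤n⇒m≤1+n (remove-≤ μ L)
    ... | no  _ = s≤s (remove-≤ μ L)

    remove-< : ∀ μ {L} → Any (λ (_ , ν) → parts ν ≡ parts μ) L → length (remove μ L) < length L
    remove-< μ {(x , ν) ∷ L} found with ListP.≡-dec ℕP._≟_ (parts ν) (parts μ) | found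
    ... | yes _   | _          = s≤s (remove-≤ μ L)
    ... | no  ν≢μ | here eq    = contradiction eq ν≢μ
    ... | no  _   | there rest = s≤s (remove-< μ rest)

    S-cong : ∀ {μ ν} → parts μ ≡ parts ν → S μ ≡ S ν
    S-cong {mkDiagram _ _ _} {mkDiagram _ _ _} ≡.refl = ≡.refl

    evalAt-parts : ∀ {μ ν} F → parts μ ≡ parts ν → evalAt a μ F ≡ evalAt a ν F
    evalAt-parts {mkDiagram _ _ _} {mkDiagram _ _ _} F ≡.refl = ≡.refl

    combination-remove : ∀ μ L → combination L ≈Λ con (coefficient μ L) *Λ S μ +Λ combination (remove μ L)
    combination-remove μ [] = symΛ (transΛ (+-identityʳ _) (zeroˡ _))
    combination-remove μ ((x , ν) ∷ L) with ListP.≡-dec ℕP._≟_ (parts ν) (parts μ)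
    ... | yes eq = begin
      con x *Λ S ν +Λ combination L
        ≈⟨ +-cong (*-congˡ (reflexive (S-cong {ν} {μ} eq))) (combination-remove μ L) ⟩
      con x *Λ S μ +Λ (con (coefficient μ L) *Λ S μ +Λ combination (remove μ L))
        ≈⟨ solve 4 (λ x y s c → x :* s :+ (y :* s :+ c) := (x :+ y) :* s :+ c) reflΛ (con x) (con (coefficient μ L)) (S μ) (combination (remove μ L)) ⟩
      (con x +Λ con (coefficient μ L)) *Λ S μ +Λ combination (remove μ L)
        ≈⟨ +-congʳ (*-congʳ (con-+ _ _)) ⟨
      con (x K.+ coefficient μ L) *Λ S μ +Λ combination (remove μ L) ∎
    ... | no _ = transΛ (+-congˡ (combination-remove μ L))
      (solve 3 (λ u v w → u :+ (v :+ w) := v :+ (u :+ w)) reflΛ (con x *Λ S ν) (con (coefficient μ L) *Λ S μ) (combination (remove μ L)))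

    evalAt-larger : ∀ μ {L} → All (λ (_ , ν) → μ ≢ᴰ ν) L → Sizes (∣ μ ∣ ≤_) L → evalAt a μ (combination L) K.≈ K.0#
    evalAt-larger μ []            []            = K.refl
    evalAt-larger μ (_∷_ {x = x , ν} μ≢ν ≢s) (μ≤ν ∷ ≤s) = K.trans
      (K.+-cong (K.trans (K.*-congˡ (s-vanishes a (ℓ ν) ν μ ℕP.≤-refl μ≢ν μ≤ν)) (K.zeroʳ x)) (evalAt-larger μ ≢s ≤s))
      (K.+-identityˡ K.0#)

    module _ (distinct : ∀ i j → i ≢ j → ¬ a i ≈ a j) where

      -- The smallest diagram in a combination that vanishes at all small
      -- diagrams has coefficient zero.
      combination-zero : ∀ n k L → length L ≤ k → Sizes (_< n) L →
        (∀ ν → ∣ ν ∣ < n → evalAt a ν (combination L) ≈ 0#) → combination L ≈Λ 0Λ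
      -- `k` bounds the length of the list, which makes the recursion on the shorter list
      -- `remove μ L` structural.
      combination-zero n k       []            _         _   _      = reflΛ
      combination-zero n (suc k) L@((x , ν) ∷ L₁) (s≤s len) L<n vanish with minimal x ν L₁
      ... | μ , found , least = transΛ L≈L′ (combination-zero n k (remove μ L)
              (ℕP.≤-trans (ℕP.≤-pred (remove-< μ {L} found)) len) (remove-All μ L<n)
              λ κ κ<n → K.trans (K.sym (eval-cong _ _ L≈L′)) (vanish κ κ<n))
        where
        μ<n : ∣ μ ∣ < n
        μ<n = at-found found L<n
          where
          at-found : ∀ {L} → Any (λ (_ , ν) → parts ν ≡ parts μ) L → Sizes (_< n) L → ∣ μ ∣ < n
          at-found (here eq)    (ν<n ∷ _)  = ≡.subst (λ xs → ℕList.sum xs < n) eq ν<n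
          at-found (there rest) (_ ∷ rest<) = at-found rest rest<

        coefficient≈0 : coefficient μ L K.≈ K.0#
        -- At μ the remaining terms vanish, as their diagrams are different and not smaller. What is
        -- left is the coefficient times the hook product.
        coefficient≈0 = zero-product
          (K.trans (K.sym (K.*-congˡ (s-value a (ℓ μ) μ ℕP.≤-refl)))
            (K.trans (K.sym (K.trans (K.+-congˡ (evalAt-larger μ (remove-≢ μ L) (remove-All μ least))) (K.+-identityʳ _)))
              (K.trans (K.sym (eval-cong _ _ (combination-remove μ L))) (vanish μ μ<n))))
          (boxProduct-nonzero a distinct μ)

        L≈L′ : combination L ≈Λ combination (remove μ L)
        L≈L′ = begin
          combination L                                                  ≈⟨ combination-remove μ L ⟩
          con (coefficient μ L) *Λ S μ +Λ combination (remove μ L)       ≈⟨ +-congʳ (transΛ (*-congʳ (con-cong coefficient≈0)) (zeroˡ (S μ))) ⟩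
          0Λ +Λ combination (remove μ L)                                 ≈⟨ +-identityˡ _ ⟩
          combination (remove μ L)                                       ∎

      vanishing-unique : ∀ n {F G} → Fil n (F -Λ G) →
        (∀ ν → ∣ ν ∣ < n → evalAt a ν F ≈ evalAt a ν G) → F ≈Λ G
      vanishing-unique n {F} {G} fil agree with Fil⇒Combination n fil
      ... | L , L< , eq = begin
        F                 ≈⟨ solve 2 (λ f g → f := (f :- g) :+ g) reflΛ F G ⟩
        (F -Λ G) +Λ G     ≈⟨ +-congʳ (transΛ eq (combination-zero n (length L) L ℕP.≤-refl L< λ ν ν<n →
                               K.trans (K.sym (eval-cong _ _ eq)) (K.trans (K.+-congʳ (agree ν ν<n)) (K.-‿inverseʳ _)))) ⟩
        0Λ +Λ G           ≈⟨ +-identityˡ G ⟩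
        G                 ∎

      module _ (μ : Diagram) where

        s-degree : ∀ N → ℓ μ ≤ N → Fil (suc ∣ μ ∣) (s⟨ a ⟩ N μ)
        s-degree N ℓ≤N = Leading⇒Fil ∣ μ ∣ (s-leading a N μ ℓ≤N)

        characterised-by-values : ∀ N → ℓ μ ≤ N → ∀ {F} → Fil (suc ∣ μ ∣) F →
          (∀ ν → ν ≢ᴰ μ → ∣ ν ∣ ≤ ∣ μ ∣ → evalAt a ν F ≈ 0#) → evalAt a μ F ≈ boxProduct a μ →
          F ≈Λ s⟨ a ⟩ N μ
        characterised-by-values N ℓ≤N {F} fil vanish value =
          vanishing-unique (suc ∣ μ ∣) (Fil-sub fil (s-degree N ℓ≤N)) agree
          where
          agree : ∀ ν → ∣ ν ∣ < suc ∣ μ ∣ → evalAt a ν F ≈ evalAt a ν (s⟨ a ⟩ N μ)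
          agree ν (s≤s ν≤μ) with ListP.≡-dec ℕP._≟_ (parts ν) (parts μ)
          ... | no  ν≢μ = K.trans (vanish ν ν≢μ ν≤μ) (K.sym (s-vanishes a N μ ν ℓ≤N ν≢μ ν≤μ))
          ... | yes ν≡μ = K.trans (K.reflexive (evalAt-parts {ν} {μ} F ν≡μ)) (K.trans value
                (K.trans (K.sym (s-value a N μ ℓ≤N)) (K.reflexive (≡.sym (evalAt-parts {ν} {μ} (s⟨ a ⟩ N μ) ν≡μ)))))

        -- Determinants of different sizes agree because they have the same degree bound and the
        -- same values.
        S≈s : ∀ N → ℓ μ ≤ N → S μ ≈Λ s⟨ a ⟩ N μ
        S≈s N ℓ≤N = characterised-by-values N ℓ≤N (s-degree (ℓ μ) ℕP.≤-refl)
          (λ ν → s-vanishes a (ℓ μ) μ ν ℕP.≤-refl) (s-value a (ℓ μ) μ ℕP.≤-refl)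

        s-vanishes-below : ∀ N → ℓ μ ≤ N → ∀ ν → ∣ ν ∣ < ∣ μ ∣ → evalAt a ν (s⟨ a ⟩ N μ) ≈ 0#
        s-vanishes-below N ℓ≤N ν ν<μ = s-vanishes a N μ ν ℓ≤N
          (λ eq → ℕP.<-irrefl (≡.cong ℕList.sum eq) ν<μ) (ℕP.<⇒≤ ν<μ)

        schur-homogeneous : Homogeneous ∣ μ ∣ (schur μ)
        schur-homogeneous = proj₁ (s-leading a (ℓ μ) μ ℕP.≤-refl)

        S-schur : Fil ∣ μ ∣ (S μ -Λ schur μ)
        S-schur = proj₂ (s-leading a (ℓ μ) μ ℕP.≤-refl)

        -- If the leading component were zero, `S μ` would have degree below the number of boxes. As
        -- it vanishes at all smaller diagrams it would be zero, against its nonzero value at μ.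
        schur-nonzero : ¬ schur μ ≈Λ 0Λ
        schur-nonzero schur≈0 = boxProduct-nonzero a distinct μ
          (K.trans (K.sym (s-value a (ℓ μ) μ ℕP.≤-refl)) (eval-cong _ _ S≈0))
          where
          S≈0 : S μ ≈Λ 0Λ
          S≈0 = vanishing-unique ∣ μ ∣
            (respF (+-congˡ (-‿cong schur≈0)) S-schur)
            (s-vanishes-below (ℓ μ) ℕP.≤-refl)

        -- F and `S μ` have the same leading component, so their difference has lower degree and
        -- vanishes at all smaller diagrams. The degree n that comes with the hypothesis is the
        -- number of boxes by `degree-unique`.
        characterised-by-top : ∀ N → ℓ μ ≤ N → ∀ {F} → (∀ ν → ∣ ν ∣ < ∣ μ ∣ → evalAt a ν F ≈ 0#) →
          IsTopComponent F (schur μ) → F ≈Λ s⟨ a ⟩ N μ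
        characterised-by-top N ℓ≤N {F} vanish (n , hom , _ , degree) = transΛ
          (vanishing-unique ∣ μ ∣
            (respF (solve 3 (λ f s t → (f :- t) :- (s :- t) := f :- s) reflΛ F (S μ) (schur μ))
              (Fil-sub (≡.subst (λ m → Fil m (F -Λ schur μ)) (degree-unique hom schur-homogeneous schur-nonzero) (Degree<⇒Fil degree)) S-schur))
            (λ ν ν<μ → K.trans (vanish ν ν<μ) (K.sym (s-vanishes-below (ℓ μ) ℕP.≤-refl ν ν<μ))))
          (S≈s N ℓ≤N)

        s-top : ∀ N → ℓ μ ≤ N → ∀ {F} → F ≈Λ s⟨ a ⟩ N μ → IsTopComponent F (schur μ)
        s-top N ℓ≤N F≈s = ∣ μ ∣ , schur-homogeneous , schur-nonzero ,
          Fil⇒Degree< (respF (+-congʳ (transΛ (S≈s N ℓ≤N) (symΛ F≈s))) S-schur)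

theorem13 : ∀ {c ℓ₁ ℓ₂} (𝕜 : HeytingField c ℓ₁ ℓ₂) (char0 : CharacteristicZero 𝕜) →
    let open SymmetricFunctions 𝕜 char0 in
    (a : Sequence) → (∀ i j → i ≢ j → ¬ (a i ≈ a j)) →
    (μ : Diagram) (N : ℕ) → ℓ μ ≤ N → (F : Λ) →
    (F ≈Λ s⟨ a ⟩ N μ ⇔
    ((∀ (ν : Diagram) → ν ≢ᴰ μ → ∣ ν ∣ ≤ ∣ μ ∣ → evalAt a ν F ≈ 0#) ×
    (Degree≤ ∣ μ ∣ F × evalAt a μ F ≈ boxProduct a μ))) ×
    (F ≈Λ s⟨ a ⟩ N μ ⇔
    ((∀ (ν : Diagram) → ∣ ν ∣ < ∣ μ ∣ → evalAt a ν F ≈ 0#) ×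
    IsTopComponent F (schur μ)))
theorem13 𝕜 char0 a distinct μ N ℓ≤N F =
  mk⇔
    (λ F≈s → (λ ν ν≢μ ν≤μ → K.trans (eval-cong _ _ F≈s) (s-vanishes a N μ ν ℓ≤N ν≢μ ν≤μ)) ,
             Fil⇒Degree< (respF (symΛ F≈s) (s-degree a distinct μ N ℓ≤N)) ,
             K.trans (eval-cong _ _ F≈s) (s-value a N μ ℓ≤N))
    (λ (vanish , degree , value) → characterised-by-values a distinct μ N ℓ≤N (Degree<⇒Fil degree) vanish value) ,
  mk⇔
    (λ F≈s → (λ ν ν<μ → K.trans (eval-cong _ _ F≈s) (s-vanishes-below a distinct μ N ℓ≤N ν ν<μ)) ,
             s-top a distinct μ N ℓ≤N F≈s)
    (λ (vanish , top) → characterised-by-top a distinct μ N ℓ≤N vanish top)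
  where
  open SymmetricFunctions 𝕜 char0 using (𝕜-ring; symΛ)
  open Evaluation 𝕜 char0 using (eval-cong)
  open Values 𝕜 char0 using (s-vanishes; s-value)
  open Degrees 𝕜 char0 using (Fil⇒Degree<; Degree<⇒Fil; respF)
  open Spanning 𝕜 char0
  module K = CommutativeRing 𝕜-ring
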